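{- Let $X$ be a weighted graph on $n$ vertices, let $M\in\{A(X),L(X),Q(X)\}$, let $U(t)=e^{\mathrm{i}tM}$, let $u$ be a vertex of $X$ and let $\tau>0$. The following are equivalent. (1) Local uniform mixing occurs at $u$ at time $\tau$ (relative to $M$). (2) There exists a vector $\boldsymbol{\mu}\in\mathbb{C}^n$ all of whose entries have modulus $1$ such that $\sqrt{n}\,U(\tau)\mathbf{e}_u=\boldsymbol{\mu}$. (3) There exists a vector $\boldsymbol{\mu}\in\mathbb{C}^n$ all of whose entries have modulus $1$ such that $\sqrt{n}\,e^{\mathrm{i}\tau\lambda}E_\lambda\mathbf{e}_u=E_\lambda\boldsymbol{\mu}$ for all $\lambda\in\Phi_{\mathbf{e}_u}$. Moreover, the condition in (3) is equivalent to: for each eigenpair $(\mathbf{v},\lambda)$ of $M$ with $\lambda\in\Phi_{\mathbf{e}_u}$, $\sqrt{n}\,e^{\mathrm{i}\tau\lambda}(\mathbf{v}^T\mathbf{e}_u)=\mathbf{v}^T\boldsymbol{\mu}$.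
   Context: Graphs are finite, simple, undirected and connected, with positive real edge weights. $A(X)$ is the weighted adjacency matrix, $D(X)$ is the diagonal matrix of vertex degrees (degree = sum of weights of incident edges), $L(X)=D(X)-A(X)$, $Q(X)=D(X)+A(X)$. $\mathbf{e}_u$ is the characteristic vector of $u$. For an eigenvalue $\lambda$ of $M$, $E_\lambda$ is the orthogonal projection onto the $\lambda$-eigenspace of $M$. The eigenvalue support of a vector $\mathbf{x}$ is $\Phi_{\mathbf{x}}=\{\lambda\in\mathrm{spec}(M): E_\lambda\mathbf{x}\neq\mathbf{0}\}$. Local uniform mixing occurs at $u$ at time $\tau>0$ relative to $M$ if every entry of the $u$th column of $U(\tau)$ has modulus $1/\sqrt{n}$. -}

module Defs where

open import Algebra.Bundles using (RawSemiring)
import Algebra.Definitions.RawSemiring as SemiringDefs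
open import Algebra.Structures using (IsCommutativeRing)
open import Axiom.ExcludedMiddle using (ExcludedMiddle)
open import Data.Bool.Base using (if_then_else_)
open import Data.Fin.Base using (Fin; toℕ)
open import Data.Fin.Properties using (_≟_)
open import Data.Nat.Base as ℕ using (ℕ)
import Data.Nat.Combinatorics as ℕ
open import Data.Product.Base using (∃; ∃-syntax; _×_; _,_)
open import Data.Vec.Functional using (Vector)
open import Level using (0ℓ)
open import Relation.Binary.Construct.Closure.ReflexiveTransitive using (Star)
open import Relation.Binary.Core using (Rel)
open import Relation.Binary.Definitions using (Decidable; Irreflexive; Symmetric)
open import Relation.Binary.PropositionalEquality.Core using (_≡_)
open import Relation.Binary.Structures using (IsTotalOrder)
open import Relation.Nullary.Decidable.Core using (does; yes; no)
open import Relation.Nullary.Negation.Core using (¬_)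
open import Relation.Unary using (Pred; _∈_)

-- The real numbers, characterised up to isomorphism as an ordered field with
-- the least-upper-bound property.  The inverse is total; its value at 0# is
-- unspecified.

record CompleteOrderedField : Set₁ where
  infix  9 _⁻¹
  infix  8 -_
  infixl 7 _*_
  infixl 6 _+_
  infix  4 _≈_ _≉_ _≤_ _<_
  field
    Carrier           : Set
    _≈_               : Rel Carrier 0ℓ
    _+_ _*_           : Carrier → Carrier → Carrier
    -_                : Carrier → Carrier
    0# 1#             : Carrier
    isCommutativeRing : IsCommutativeRing _≈_ _+_ _*_ -_ 0# 1#

  _≉_ : Rel Carrier 0ℓ
  x ≉ y = ¬ (x ≈ y)

  field
    0≉1               : 0# ≉ 1#
    _⁻¹               : Carrier → Carrier
    ⁻¹-cong           : ∀ {x y} → x ≈ y → x ⁻¹ ≈ y ⁻¹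
    ⁻¹-inverseˡ       : ∀ {x} → x ≉ 0# → x ⁻¹ * x ≈ 1#
    _≤_               : Rel Carrier 0ℓ
    ≤-isTotalOrder    : IsTotalOrder _≈_ _≤_
    +-monoˡ-≤         : ∀ z {x y} → x ≤ y → x + z ≤ y + z
    *-nonNegative     : ∀ {x y} → 0# ≤ x → 0# ≤ y → 0# ≤ x * y

  _<_ : Rel Carrier 0ℓ
  x < y = x ≤ y × x ≉ y

  UpperBound : Pred Carrier 0ℓ → Pred Carrier 0ℓ
  UpperBound P b = ∀ x → x ∈ P → x ≤ b

  IsSupremum : Pred Carrier 0ℓ → Pred Carrier 0ℓ
  IsSupremum P s = s ∈ UpperBound P × (∀ b → b ∈ UpperBound P → s ≤ b)

  field
    supremum          : (P : Pred Carrier 0ℓ) → ∃ P → ∃ (UpperBound P) →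
                        ∃ (IsSupremum P)

  rawSemiring : RawSemiring 0ℓ 0ℓ
  rawSemiring = record
    { _≈_ = _≈_ ; _+_ = _+_ ; _*_ = _*_ ; 0# = 0# ; 1# = 1# }

  open SemiringDefs rawSemiring public using (sum) renaming (_×_ to _·_)

  fromℕ : ℕ → Carrier
  fromℕ n = n · 1#

module Analysis (em : ExcludedMiddle 0ℓ) (R : CompleteOrderedField) where

  module ℝ = CompleteOrderedField R

  ℝ : Set
  ℝ = ℝ.Carrier

  -- Some element satisfying P, or the given default when there is none.  It is
  -- only used for P with at most one solution up to equality, so that it reads
  -- "the x such that P x".

  the : {A : Set} → A → (A → Set) → A
  the default P with em {∃ P}
  ... | yes (x , _) = x
  ... | no  _       = default

  √ : ℝ → ℝ
  √ x = the ℝ.0# λ y → ℝ.0# ℝ.≤ y × y ℝ.* y ℝ.≈ x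

  infix 5 _+𝕚_

  record ℂ : Set where
    constructor _+𝕚_
    field
      re im : ℝ
  open ℂ public

  infix  4 _≈_
  infixl 6 _+_ _-_
  infixl 7 _*_

  record _≈_ (z w : ℂ) : Set where
    constructor _,_
    field
      re-≈ : re z ℝ.≈ re w
      im-≈ : im z ℝ.≈ im w

  ofReal : ℝ → ℂ
  ofReal x = x +𝕚 ℝ.0#

  0ᶜ 1ᶜ 𝕚 : ℂ
  0ᶜ = ofReal ℝ.0#
  1ᶜ = ofReal ℝ.1#
  𝕚  = ℝ.0# +𝕚 ℝ.1#

  _+_ _-_ _*_ : ℂ → ℂ → ℂ
  (a +𝕚 b) + (c +𝕚 d) = (a ℝ.+ c) +𝕚 (b ℝ.+ d)
  (a +𝕚 b) - (c +𝕚 d) = (a ℝ.+ ℝ.- c) +𝕚 (b ℝ.+ ℝ.- d)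
  (a +𝕚 b) * (c +𝕚 d) = (a ℝ.* c ℝ.+ ℝ.- (b ℝ.* d)) +𝕚 (a ℝ.* d ℝ.+ b ℝ.* c)

  conj : ℂ → ℂ
  conj (a +𝕚 b) = a +𝕚 (ℝ.- b)

  ∣_∣ : ℂ → ℝ
  ∣ a +𝕚 b ∣ = √ (a ℝ.* a ℝ.+ b ℝ.* b)

  ℂ-rawSemiring : RawSemiring 0ℓ 0ℓ
  ℂ-rawSemiring = record
    { _≈_ = _≈_ ; _+_ = _+_ ; _*_ = _*_ ; 0# = 0ᶜ ; 1# = 1ᶜ }

  open SemiringDefs ℂ-rawSemiring public using (sum; _^_)

  ConvergesTo : (ℕ → ℂ) → ℂ → Set
  ConvergesTo s l = ∀ ε → ℝ.0# ℝ.< ε →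
                    ∃[ N ] (∀ m → N ℕ.≤ m → ∣ s m - l ∣ ℝ.< ε)

  lim : (ℕ → ℂ) → ℂ
  lim s = the 0ᶜ (ConvergesTo s)

  1/_! : ℕ → ℂ
  1/ k ! = ofReal (ℝ.fromℕ (k ℕ.!) ℝ.⁻¹)

  exp : ℂ → ℂ
  exp z = lim λ N → sum {N} λ k → 1/ toℕ k ! * z ^ toℕ k

  Matrix : Set → ℕ → Set
  Matrix K n = Fin n → Fin n → K

  module _ {n : ℕ} where

    infix  4 _≈ᵛ_
    infixl 5 _-ᵛ_
    infixr 6 _•_ _•ᵐ_ _*ᵥ_
    infixl 7 _*ᵐ_
    infix  7 _ᵀ·_

    _≈ᵛ_ : Rel (Vector ℂ n) 0ℓ
    x ≈ᵛ y = ∀ j → x j ≈ y j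

    0ᵛ : Vector ℂ n
    0ᵛ _ = 0ᶜ

    _-ᵛ_ : Vector ℂ n → Vector ℂ n → Vector ℂ n
    (x -ᵛ y) j = x j - y j

    _•_ : ℂ → Vector ℂ n → Vector ℂ n
    (c • x) j = c * x j

    _ᵀ·_ : Vector ℂ n → Vector ℂ n → ℂ
    x ᵀ· y = sum λ j → x j * y j

    ⟨_,_⟩ : Vector ℂ n → Vector ℂ n → ℂ
    ⟨ x , y ⟩ = sum λ j → conj (x j) * y j

    𝐞 : Fin n → Vector ℂ n
    𝐞 u j = if does (j ≟ u) then 1ᶜ else 0ᶜ

    Unimodular : Vector ℂ n → Set
    Unimodular x = ∀ j → ∣ x j ∣ ℝ.≈ ℝ.1#

    _*ᵥ_ : Matrix ℂ n → Vector ℂ n → Vector ℂ n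
    (P *ᵥ x) j = sum λ l → P j l * x l

    _•ᵐ_ : ℂ → Matrix ℂ n → Matrix ℂ n
    (c •ᵐ P) j l = c * P j l

    _*ᵐ_ : Matrix ℂ n → Matrix ℂ n → Matrix ℂ n
    (P *ᵐ S) j l = sum λ k → P j k * S k l

  matrixRawSemiring : ℕ → RawSemiring 0ℓ 0ℓ
  matrixRawSemiring n = record
    { Carrier = Matrix ℂ n
    ; _≈_     = λ P S → ∀ j l → P j l ≈ S j l
    ; _+_     = λ P S j l → P j l + S j l
    ; _*_     = _*ᵐ_
    ; 0#      = λ _ _ → 0ᶜ
    ; 1#      = λ j l → if does (j ≟ l) then 1ᶜ else 0ᶜ
    }

  module _ {n : ℕ} where

    open SemiringDefs (matrixRawSemiring n) using () renaming (_^_ to _^ᵐ_)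

    expᵐ : Matrix ℂ n → Matrix ℂ n
    expᵐ P j l = lim λ N → sum {N} λ k → 1/ toℕ k ! * (P ^ᵐ toℕ k) j l

    InEigenspace : Matrix ℂ n → ℂ → Vector ℂ n → Set
    InEigenspace M θ v = M *ᵥ v ≈ᵛ θ • v

    Eigenpair : Matrix ℂ n → Vector ℂ n → ℂ → Set
    Eigenpair M v θ = ¬ (v ≈ᵛ 0ᵛ) × InEigenspace M θ v

    Spec : Matrix ℂ n → Pred ℂ 0ℓ
    Spec M θ = ∃[ v ] Eigenpair M v θ

    IsOrthogonalProjection : Pred (Vector ℂ n) 0ℓ → Matrix ℂ n → Set
    IsOrthogonalProjection W P =
      ∀ x → P *ᵥ x ∈ W × (∀ w → w ∈ W → ⟨ w , x -ᵛ P *ᵥ x ⟩ ≈ 0ᶜ)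

    E : Matrix ℂ n → ℂ → Matrix ℂ n
    E M θ = the (λ _ _ → 0ᶜ) (IsOrthogonalProjection (InEigenspace M θ))

    Φ : Matrix ℂ n → Vector ℂ n → Pred ℂ 0ℓ
    Φ M x θ = θ ∈ Spec M × ¬ (E M θ *ᵥ x ≈ᵛ 0ᵛ)

    U : Matrix ℂ n → ℝ → Matrix ℂ n
    U M t = expᵐ ((𝕚 * ofReal t) •ᵐ M)

  √ℕ : ℕ → ℝ
  √ℕ n = √ (ℝ.fromℕ n)

  LocalUniformMixing : ∀ {n} → Matrix ℂ n → Fin n → ℝ → Set
  LocalUniformMixing {n} M u τ = ∀ j → ∣ U M τ j u ∣ ℝ.≈ √ℕ n ℝ.⁻¹

  -- The weights of non-adjacent pairs are never used.

  record WeightedGraph (n : ℕ) : Set₁ where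
    field
      _~_        : Rel (Fin n) 0ℓ
      _~?_       : Decidable _~_
      ~-sym      : Symmetric _~_
      ~-irrefl   : Irreflexive _≡_ _~_
      connected  : ∀ i j → Star _~_ i j
      weight     : Fin n → Fin n → ℝ
      weight-sym : ∀ {i j} → i ~ j → weight i j ℝ.≈ weight j i
      weight-pos : ∀ {i j} → i ~ j → ℝ.0# ℝ.< weight i j

    adjacency : Matrix ℝ n
    adjacency i j = if does (i ~? j) then weight i j else ℝ.0#

    degree : Fin n → ℝ
    degree i = ℝ.sum (adjacency i)

    degreeMatrix : Matrix ℝ n
    degreeMatrix i j = if does (i ≟ j) then degree i else ℝ.0#

    laplacian signlessLaplacian : Matrix ℝ n
    laplacian         i j = degreeMatrix i j ℝ.+ (ℝ.- adjacency i j)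
    signlessLaplacian i j = degreeMatrix i j ℝ.+ adjacency i j

  data MatrixKind : Set where
    A L Q : MatrixKind

  realMatrix : ∀ {n} → MatrixKind → WeightedGraph n → Matrix ℝ n
  realMatrix A X = WeightedGraph.adjacency X
  realMatrix L X = WeightedGraph.laplacian X
  realMatrix Q X = WeightedGraph.signlessLaplacian X

  matrix : ∀ {n} → MatrixKind → WeightedGraph n → Matrix ℂ n
  matrix κ X i j = ofReal (realMatrix κ X i j)

{-# OPTIONS --safe #-}
module Submission where

-- The real matrix M has a real orthonormal eigenbasis v₁, …, vₙ: its smallest eigenvalue is the largest λ for which
-- M - λ is positive semidefinite, and a reflection splits off the eigenvector. In this basis U(τ) has eigenvalues
-- exp (i τ λₖ), of modulus 1 by Mertens' theorem applied to exp z and exp (- z), and vᵀ U(τ) = exp (i τ λ) vᵀ for every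
-- eigenpair (v, λ). Writing y = √n U(τ) eᵤ, this gives (2) ⇒ (3), while vᵀ x = vᵀ E_λ x gives the equivalence of the two
-- forms of (3). For (3) ⇒ (2), each coefficient vₖᵀ y is zero or equal to vₖᵀ μ, so ∥μ - y∥² = ∥μ∥² - ∥y∥² = n - n = 0.

-- All limits and eigenvalues come from the least upper bound property. The supremum that gives the
-- smallest eigenvalue is attained thanks to a dichotomy: a positive semidefinite form has a nonzero
-- null vector or is at least ε ∥x∥² for some ε > 0. Gaussian elimination proves it, in place of
-- compactness of the unit sphere.
--
-- `√`, `exp`, `U` and `E` are selected by `the`, so nothing can be said about their values before
-- existence is proved: roots, convergence of the series and the projection onto each eigenspace
-- come first, and equality of limits goes through uniqueness.
--
-- Two pairings meet in the statement: `v ᵀ· x` for eigenpairs, whose vectors may be complex, and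
-- the Hermitian `⟨_,_⟩` that defines a projection. They are reconciled by the reality of the
-- eigenvalues, which makes eigenspaces closed under conjugation.
--
-- Of the addition law for `exp` only exp z * conj (exp z) = 1 for imaginary z is proved: there the
-- conjugated terms of exp z are the terms of exp (- z), and the Cauchy product can be summed
-- exactly.

open import Defs
open import Algebra.Bundles using (CommutativeRing)
import Algebra.Definitions.RawSemiring as SemiringDefs
open import Axiom.ExcludedMiddle using (ExcludedMiddle)
open import Data.Bool.Base using (if_then_else_)
open import Data.Bool.Properties using (if-float)
open import Data.Empty using (⊥-elim)
open import Data.Fin.Base using (Fin; zero; suc; toℕ)
open import Data.Fin.Properties using (_≟_)
open import Data.Integer.Base as ℤ using (ℤ; +_; -[1+_]; _⊖_)
import Data.Integer.Properties as ℤ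
open import Data.Maybe.Base using (Maybe; just; nothing)
open import Data.Nat.Base as ℕ using (ℕ; zero; suc; _!)
import Data.Nat.Properties as ℕ
open import Data.Product.Base using (∃; ∃-syntax; _×_; _,_; proj₁; proj₂)
open import Data.Sum.Base as Sum using (_⊎_; inj₁; inj₂)
open import Data.Vec.Functional using (Vector; _∷_)
open import Function.Bundles using (_⇔_; mk⇔)
open import Level using (0ℓ)
open import Relation.Binary.Bundles using (Poset)
open import Relation.Binary.PropositionalEquality.Core as ≡ using (_≡_)
open import Relation.Binary.Structures using (IsTotalOrder)
open import Relation.Nullary.Decidable.Core using (Dec; does; yes; no)
open import Relation.Nullary.Negation.Core using (¬_)
open import Relation.Unary using (_∈_)

-- A ring solver with integer coefficients

module IntegerCoefficients (R : CommutativeRing 0ℓ 0ℓ) where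

  open import Algebra.Solver.Ring.AlmostCommutativeRing
  open CommutativeRing R hiding (zero)
  open import Algebra.Properties.Ring ring
  open import Algebra.Properties.AbelianGroup +-abelianGroup using (⁻¹-∙-comm)
  open import Algebra.Properties.Semiring.Mult.TCOptimised semiring renaming (_×_ to _·_)
  open import Relation.Binary.Reasoning.Setoid setoid

  private
    -- The optimised multiple makes `1 · x` reduce to `x`, so `con (+ 0)` and `con (+ 1)` evaluate
    -- to `0#` and `1#` themselves and solver equations match the goals directly.
    ⟦_⟧ : ℤ → Carrier
    ⟦ + n ⟧      = n · 1#
    ⟦ -[1+ n ] ⟧ = - (suc n · 1#)

    cancel-1# : ∀ a b → (1# + a) + - (1# + b) ≈ a + - b
    cancel-1# a b = begin
      (1# + a) + - (1# + b)     ≈⟨ +-cong (+-comm 1# a) (sym (⁻¹-∙-comm 1# b)) ⟩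
      (a + 1#) + (- 1# + - b)   ≈⟨ +-assoc a 1# _ ⟩
      a + (1# + (- 1# + - b))   ≈⟨ +-congˡ (+-assoc 1# (- 1#) (- b)) ⟨
      a + ((1# + - 1#) + - b)   ≈⟨ +-congˡ (+-congʳ (-‿inverseʳ 1#)) ⟩
      a + (0# + - b)            ≈⟨ +-congˡ (+-identityˡ (- b)) ⟩
      a + - b                   ∎

    ⟦⊖⟧ : ∀ m n → ⟦ m ⊖ n ⟧ ≈ m · 1# + - (n · 1#)
    ⟦⊖⟧ zero    zero    = sym (-‿inverseʳ 0#)
    ⟦⊖⟧ zero    (suc n) = sym (+-identityˡ _)
    ⟦⊖⟧ (suc m) zero    = sym (trans (+-congˡ -0#≈0#) (+-identityʳ _))
    ⟦⊖⟧ (suc m) (suc n) = begin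
      ⟦ suc m ⊖ suc n ⟧                  ≡⟨ ≡.cong ⟦_⟧ (ℤ.[1+m]⊖[1+n]≡m⊖n m n) ⟩
      ⟦ m ⊖ n ⟧                          ≈⟨ ⟦⊖⟧ m n ⟩
      m · 1# + - (n · 1#)                ≈⟨ cancel-1# _ _ ⟨
      (1# + m · 1#) + - (1# + n · 1#)    ≈⟨ +-cong (1+× m 1#) (-‿cong (1+× n 1#)) ⟨
      suc m · 1# + - (suc n · 1#)        ∎

    ⟦+⟧ : ∀ i j → ⟦ i ℤ.+ j ⟧ ≈ ⟦ i ⟧ + ⟦ j ⟧
    ⟦+⟧ (+ m)      (+ n)      = ×-homo-+ 1# m n
    ⟦+⟧ (+ m)      (-[1+ n ]) = ⟦⊖⟧ m (suc n)
    ⟦+⟧ (-[1+ m ]) (+ n)      = trans (⟦⊖⟧ n (suc m)) (+-comm _ _)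
    ⟦+⟧ (-[1+ m ]) (-[1+ n ]) = begin
      - (suc (suc (m ℕ.+ n)) · 1#)        ≡⟨ ≡.cong (λ k → - (suc k · 1#)) (ℕ.+-suc m n) ⟨
      - ((suc m ℕ.+ suc n) · 1#)          ≈⟨ -‿cong (×-homo-+ 1# (suc m) (suc n)) ⟩
      - (suc m · 1# + suc n · 1#)         ≈⟨ ⁻¹-∙-comm _ _ ⟨
      - (suc m · 1#) + - (suc n · 1#)     ∎

    ⟦-⟧ : ∀ i → ⟦ ℤ.- i ⟧ ≈ - ⟦ i ⟧
    ⟦-⟧ (+ zero)     = sym -0#≈0#
    ⟦-⟧ (+ (suc n))  = refl
    ⟦-⟧ (-[1+ n ])   = sym (-‿involutive _)

    ⟦+*⟧ : ∀ m j → ⟦ + m ℤ.* j ⟧ ≈ (m · 1#) * ⟦ j ⟧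
    ⟦+*⟧ m (+ n) = begin
      ⟦ + m ℤ.* + n ⟧           ≡⟨ ≡.cong ⟦_⟧ (ℤ.pos-* m n) ⟨
      (m ℕ.* n) · 1#            ≈⟨ ×1-homo-* m n ⟩
      (m · 1#) * (n · 1#)       ∎
    ⟦+*⟧ m (-[1+ n ]) = begin
      ⟦ + m ℤ.* -[1+ n ] ⟧             ≡⟨ ≡.cong ⟦_⟧ (ℤ.neg-distribʳ-* (+ m) (+ suc n)) ⟨
      ⟦ ℤ.- (+ m ℤ.* + suc n) ⟧        ≈⟨ ⟦-⟧ (+ m ℤ.* + suc n) ⟩
      - ⟦ + m ℤ.* + suc n ⟧            ≈⟨ -‿cong (⟦+*⟧ m (+ suc n)) ⟩
      - ((m · 1#) * (suc n · 1#))      ≈⟨ -‿distribʳ-* _ _ ⟩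
      (m · 1#) * - (suc n · 1#)        ∎

    ⟦*⟧ : ∀ i j → ⟦ i ℤ.* j ⟧ ≈ ⟦ i ⟧ * ⟦ j ⟧
    ⟦*⟧ (+ m)      j = ⟦+*⟧ m j
    ⟦*⟧ (-[1+ m ]) j = begin
      ⟦ -[1+ m ] ℤ.* j ⟧               ≡⟨ ≡.cong ⟦_⟧ (ℤ.neg-distribˡ-* (+ suc m) j) ⟨
      ⟦ ℤ.- (+ suc m ℤ.* j) ⟧          ≈⟨ ⟦-⟧ (+ suc m ℤ.* j) ⟩
      - ⟦ + suc m ℤ.* j ⟧              ≈⟨ -‿cong (⟦+*⟧ (suc m) j) ⟩
      - ((suc m · 1#) * ⟦ j ⟧)         ≈⟨ -‿distribˡ-* _ _ ⟩
      - (suc m · 1#) * ⟦ j ⟧           ∎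

    morphism : CommutativeRing.rawRing ℤ.+-*-commutativeRing
               -Raw-AlmostCommutative⟶ fromCommutativeRing R
    morphism = record
      { ⟦_⟧    = ⟦_⟧
      ; +-homo = ⟦+⟧
      ; *-homo = ⟦*⟧
      ; -‿homo = ⟦-⟧
      ; 0-homo = refl
      ; 1-homo = refl
      }

    coeff≟ : ∀ i j → Maybe (⟦ i ⟧ ≈ ⟦ j ⟧)
    coeff≟ i j with i ℤ.≟ j
    ... | yes ≡.refl = just refl
    ... | no  _      = nothing

  open import Algebra.Solver.Ring _ (fromCommutativeRing R) morphism coeff≟ public
    using (solve; con; _:+_; _:*_; _:-_; :-_; _:=_)

-- Ordered fields

module OrderedField (em : ExcludedMiddle 0ℓ) (R : CompleteOrderedField) where

  open CompleteOrderedField R public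

  commutativeRing : CommutativeRing 0ℓ 0ℓ
  commutativeRing = record { isCommutativeRing = isCommutativeRing }

  open CommutativeRing commutativeRing public
    using ( setoid; semiring; refl; sym; trans; +-cong; +-congˡ; +-congʳ
          ; *-cong; *-congˡ; *-congʳ; -‿cong; +-identityˡ; +-identityʳ
          ; *-identityˡ; *-identityʳ; zeroˡ; zeroʳ; *-comm; *-assoc; +-comm; _-_)
  open IntegerCoefficients commutativeRing public
  open IsTotalOrder ≤-isTotalOrder public
    using (total; antisym; ≤-respˡ-≈; ≤-respʳ-≈)
    renaming (refl to ≤-refl; reflexive to ≤-reflexive; trans to ≤-trans)

  poset : Poset 0ℓ 0ℓ 0ℓ
  poset = record { isPartialOrder = IsTotalOrder.isPartialOrder ≤-isTotalOrder }

  module ≤-Reasoning where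
    open import Relation.Binary.Reasoning.PartialOrder poset public

  import Relation.Binary.Construct.NonStrictToStrict _≈_ _≤_ as ToStrict

  <-≤-trans : ∀ {x y z} → x < y → y ≤ z → x < z
  <-≤-trans = ToStrict.<-≤-trans sym ≤-trans antisym ≤-respʳ-≈

  ≤-<-trans : ∀ {x y z} → x ≤ y → y < z → x < z
  ≤-<-trans = ToStrict.≤-<-trans ≤-trans antisym ≤-respˡ-≈

  ≰⇒> : ∀ {x y} → ¬ (x ≤ y) → y < x
  ≰⇒> {x} {y} x≰y with total x y
  ... | inj₁ x≤y = ⊥-elim (x≰y x≤y)
  ... | inj₂ y≤x = y≤x , λ y≈x → x≰y (≤-reflexive (sym y≈x))

  <⇒≱ : ∀ {x y} → x < y → ¬ (y ≤ x)
  <⇒≱ (x≤y , x≉y) y≤x = x≉y (antisym x≤y y≤x)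

  x≤y⇒0≤y-x : ∀ {x y} → x ≤ y → 0# ≤ y - x
  x≤y⇒0≤y-x {x} {y} x≤y = ≤-respˡ-≈ (solve 1 (λ x → x :- x := con (+ 0)) refl x) (+-monoˡ-≤ (- x) x≤y)

  -- Reduces an inequality to a ring identity: `d` is the difference of the two sides in a visibly
  -- nonnegative form, often a square, and the solver checks the equation.
  ≤-via : ∀ {x y} d → 0# ≤ d → x + d ≈ y → x ≤ y
  ≤-via {x} {y} d 0≤d eq = ≤-respˡ-≈ (+-identityˡ x) (≤-respʳ-≈ (trans (+-comm d x) eq) (+-monoˡ-≤ x 0≤d))

  0≤y-x⇒x≤y : ∀ {x y} → 0# ≤ y - x → x ≤ y
  0≤y-x⇒x≤y {x} {y} 0≤ = ≤-via (y - x) 0≤ (solve 2 (λ x y → x :+ (y :- x) := y) refl x y)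

  x<y⇒0<y-x : ∀ {x y} → x < y → 0# < y - x
  x<y⇒0<y-x {x} {y} (x≤y , x≉y) = x≤y⇒0≤y-x x≤y , λ 0≈ → x≉y (begin
    x              ≈⟨ +-identityʳ x ⟨
    x + 0#         ≈⟨ +-congˡ 0≈ ⟩
    x + (y - x)    ≈⟨ solve 2 (λ x y → x :+ (y :- x) := y) refl x y ⟩
    y              ∎)
    where open import Relation.Binary.Reasoning.Setoid setoid

  <-via : ∀ {x y} d → 0# < d → x + d ≈ y → x < y
  <-via {x} {y} d (0≤d , 0≉d) eq = ≤-via d 0≤d eq , λ x≈y → 0≉d (begin
    0#             ≈⟨ solve 1 (λ x → x :- x := con (+ 0)) refl x ⟨
    x - x          ≈⟨ +-congʳ (trans x≈y (sym eq)) ⟩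
    (x + d) - x    ≈⟨ solve 2 (λ x d → (x :+ d) :- x := d) refl x d ⟩
    d              ∎)
    where open import Relation.Binary.Reasoning.Setoid setoid

  +-mono-≤ : ∀ {x y u v} → x ≤ y → u ≤ v → x + u ≤ y + v
  +-mono-≤ {x} {y} {u} {v} x≤y u≤v =
    ≤-trans (+-monoˡ-≤ u x≤y) (≤-respˡ-≈ (+-comm u y) (≤-respʳ-≈ (+-comm v y) (+-monoˡ-≤ y u≤v)))

  +-nonNegative : ∀ {x y} → 0# ≤ x → 0# ≤ y → 0# ≤ x + y
  +-nonNegative 0≤x 0≤y = ≤-respˡ-≈ (+-identityˡ 0#) (+-mono-≤ 0≤x 0≤y)

  -‿anti-≤ : ∀ {x y} → x ≤ y → - y ≤ - x
  -‿anti-≤ {x} {y} x≤y = ≤-via (y - x) (x≤y⇒0≤y-x x≤y) (solve 2 (λ x y → :- y :+ (y :- x) := :- x) refl x y)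

  *-monoˡ-≤ : ∀ {x y} c → 0# ≤ c → x ≤ y → c * x ≤ c * y
  *-monoˡ-≤ {x} {y} c 0≤c x≤y = ≤-via (c * (y - x)) (*-nonNegative 0≤c (x≤y⇒0≤y-x x≤y))
    (solve 3 (λ c x y → c :* x :+ c :* (y :- x) := c :* y) refl c x y)

  *-mono-≤ : ∀ {x y u v} → 0# ≤ y → 0# ≤ u → x ≤ y → u ≤ v → x * u ≤ y * v
  *-mono-≤ {x} {y} {u} {v} 0≤y 0≤u x≤y u≤v = begin
    x * u ≈⟨ *-comm x u ⟩
    u * x ≤⟨ *-monoˡ-≤ u 0≤u x≤y ⟩
    u * y ≈⟨ *-comm u y ⟩
    y * u ≤⟨ *-monoˡ-≤ y 0≤y u≤v ⟩
    y * v ∎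
    where open ≤-Reasoning

  square-nonNegative : ∀ x → 0# ≤ x * x
  square-nonNegative x with total 0# x
  ... | inj₁ 0≤x = *-nonNegative 0≤x 0≤x
  ... | inj₂ x≤0 = ≤-respʳ-≈ (solve 1 (λ x → (con (+ 0) :- x) :* (con (+ 0) :- x) := x :* x) refl x)
                     (*-nonNegative (x≤y⇒0≤y-x x≤0) (x≤y⇒0≤y-x x≤0))

  0≤1 : 0# ≤ 1#
  0≤1 = ≤-respʳ-≈ (*-identityˡ 1#) (square-nonNegative 1#)

  0<1 : 0# < 1#
  0<1 = 0≤1 , 0≉1

  two : Carrier
  two = 1# + 1#

  0<two : 0# < two
  0<two = <-≤-trans 0<1 (≤-via 1# 0≤1 refl)

  0≤two : 0# ≤ two
  0≤two = proj₁ 0<two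

  0<⇒≉0 : ∀ {x} → 0# < x → x ≉ 0#
  0<⇒≉0 (_ , 0≉x) x≈0 = 0≉x (sym x≈0)

  ⁻¹-inverseʳ : ∀ {x} → x ≉ 0# → x * x ⁻¹ ≈ 1#
  ⁻¹-inverseʳ {x} x≉0 = trans (*-comm x (x ⁻¹)) (⁻¹-inverseˡ x≉0)

  *-cancelˡ-0 : ∀ {x y} → x ≉ 0# → x * y ≈ 0# → y ≈ 0#
  *-cancelˡ-0 {x} {y} x≉0 xy≈0 = begin
    y                  ≈⟨ *-identityˡ y ⟨
    1# * y             ≈⟨ *-congʳ (⁻¹-inverseˡ x≉0) ⟨
    x ⁻¹ * x * y       ≈⟨ *-assoc _ _ _ ⟩
    x ⁻¹ * (x * y)     ≈⟨ *-congˡ xy≈0 ⟩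
    x ⁻¹ * 0#          ≈⟨ zeroʳ _ ⟩
    0#                 ∎
    where open import Relation.Binary.Reasoning.Setoid setoid

  *-cancelˡ : ∀ {x y z} → x ≉ 0# → x * y ≈ x * z → y ≈ z
  *-cancelˡ {x} {y} {z} x≉0 xy≈xz = begin
    y            ≈⟨ solve 2 (λ y z → y := (y :- z) :+ z) refl y z ⟩
    (y - z) + z  ≈⟨ +-congʳ (*-cancelˡ-0 x≉0 (trans (solve 3 (λ x y z → x :* (y :- z) := x :* y :- x :* z) refl x y z) (trans (+-congʳ xy≈xz) (solve 1 (λ x → x :- x := con (+ 0)) refl _)))) ⟩
    0# + z       ≈⟨ +-identityˡ z ⟩
    z            ∎
    where open import Relation.Binary.Reasoning.Setoid setoid

  square≈0 : ∀ {x} → x * x ≈ 0# → x ≈ 0#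
  square≈0 {x} xx≈0 with em {x ≈ 0#}
  ... | yes x≈0 = x≈0
  ... | no  x≉0 = *-cancelˡ-0 x≉0 xx≈0

  0<x*y : ∀ {x y} → 0# < x → 0# < y → 0# < x * y
  0<x*y 0<x@(0≤x , _) (0≤y , 0≉y) =
    *-nonNegative 0≤x 0≤y , λ 0≈xy → 0≉y (sym (*-cancelˡ-0 (0<⇒≉0 0<x) (sym 0≈xy)))

  0<x⇒0<x⁻¹ : ∀ {x} → 0# < x → 0# < x ⁻¹
  0<x⇒0<x⁻¹ {x} 0<x = ≰⇒> λ x⁻¹≤0 → <⇒≱ 0<1 (begin
    1#          ≈⟨ ⁻¹-inverseʳ (0<⇒≉0 0<x) ⟨
    x * x ⁻¹    ≤⟨ *-monoˡ-≤ x (proj₁ 0<x) x⁻¹≤0 ⟩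
    x * 0#      ≈⟨ zeroʳ x ⟩
    0#          ∎)
    where open ≤-Reasoning

  *-cancelˡ-≤ : ∀ {x y c} → 0# < c → c * x ≤ c * y → x ≤ y
  *-cancelˡ-≤ {x} {y} {c} 0<c cx≤cy = begin
    x                  ≈⟨ eq x ⟨
    c ⁻¹ * (c * x)     ≤⟨ *-monoˡ-≤ _ (proj₁ (0<x⇒0<x⁻¹ 0<c)) cx≤cy ⟩
    c ⁻¹ * (c * y)     ≈⟨ eq y ⟩
    y                  ∎
    where
    open ≤-Reasoning
    eq : ∀ z → c ⁻¹ * (c * z) ≈ z
    eq z = trans (sym (*-assoc _ _ _)) (trans (*-congʳ (⁻¹-inverseˡ (0<⇒≉0 0<c))) (*-identityˡ z))

  *-monoˡ-< : ∀ {x y} c → 0# < c → x < y → c * x < c * y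
  *-monoˡ-< {x} {y} c 0<c x<y = <-via (c * (y - x)) (0<x*y 0<c (x<y⇒0<y-x x<y))
    (solve 3 (λ c x y → c :* x :+ c :* (y :- x) := c :* y) refl c x y)

  square-cancel-≤ : ∀ {x y} → 0# ≤ y → x * x ≤ y * y → x ≤ y
  square-cancel-≤ {x} {y} 0≤y xx≤yy with em {x ≤ y}
  ... | yes x≤y = x≤y
  ... | no  x≰y = ⊥-elim (<⇒≱ (begin-strict
    y * y   ≤⟨ *-monoˡ-≤ y 0≤y (proj₁ y<x) ⟩
    y * x   ≈⟨ *-comm y x ⟩
    x * y   <⟨ *-monoˡ-< x (≤-<-trans 0≤y y<x) y<x ⟩
    x * x   ∎) xx≤yy)
    where
    open ≤-Reasoning
    y<x = ≰⇒> x≰y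

  square-injective : ∀ {x y} → 0# ≤ x → 0# ≤ y → x * x ≈ y * y → x ≈ y
  square-injective 0≤x 0≤y eq =
    antisym (square-cancel-≤ 0≤y (≤-reflexive eq)) (square-cancel-≤ 0≤x (≤-reflexive (sym eq)))

  x+y≈0⇒x≈0 : ∀ {x y} → 0# ≤ x → 0# ≤ y → x + y ≈ 0# → x ≈ 0#
  x+y≈0⇒x≈0 {x} {y} 0≤x 0≤y eq = antisym (≤-via y 0≤y eq) 0≤x

  -- If all naturals stayed below x they would have a supremum s; since 1 + y is a natural whenever
  -- y is, s - 1 would be an upper bound as well.
  archimedean : ∀ x → ∃[ n ] x ≤ fromℕ n
  archimedean x with em {∃[ n ] x ≤ fromℕ n}
  ... | yes p = p
  ... | no ¬p = ⊥-elim (<⇒≱ s-1<s (s-least (s - 1#) bound))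
    where
    sup = supremum (λ y → ∃[ n ] y ≈ fromℕ n) (fromℕ 0 , 0 , refl)
            (x , λ { y (n , y≈n) → ≤-respˡ-≈ (sym y≈n) (proj₁ (≰⇒> λ x≤n → ¬p (n , x≤n))) })
    s = proj₁ sup
    s-upper = proj₁ (proj₂ sup)
    s-least = proj₂ (proj₂ sup)
    s-1<s : s - 1# < s
    s-1<s = <-via 1# 0<1 (solve 1 (λ s → s :- con (+ 1) :+ con (+ 1) := s) refl s)
    bound : UpperBound (λ y → ∃[ n ] y ≈ fromℕ n) (s - 1#)
    bound y (n , y≈n) = ≤-via (s - (1# + y)) (x≤y⇒0≤y-x (s-upper (1# + y) (suc n , +-congˡ y≈n)))
      (solve 2 (λ s y → y :+ (s :- (con (+ 1) :+ y)) := s :- con (+ 1)) refl s y)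

  fromℕ-nonNegative : ∀ n → 0# ≤ fromℕ n
  fromℕ-nonNegative zero    = ≤-refl
  fromℕ-nonNegative (suc n) = +-nonNegative 0≤1 (fromℕ-nonNegative n)

  fromℕ-positive : ∀ n → 0# < fromℕ (suc n)
  fromℕ-positive n = ≤-<-trans (fromℕ-nonNegative n) (<-via 1# 0<1 (+-comm _ _))

  fromℕ-mono : ∀ j m → fromℕ m ≤ fromℕ (j ℕ.+ m)
  fromℕ-mono zero    m = ≤-refl
  fromℕ-mono (suc j) m = ≤-trans (≤-via 1# 0≤1 (+-comm _ _)) (+-mono-≤ ≤-refl (fromℕ-mono j m))

  -- The supremum s of {y ≥ 0 | y² ≤ a} is compared with y = (b s + a)/(s + b), where b = a + 1:
  -- y - s has the sign of a - s², and y² - a = (b² - a)(s² - a)/(s + b)² has the sign of s² - a.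
  sqrt-exists : ∀ a → 0# ≤ a → ∃[ s ] 0# ≤ s × s * s ≈ a
  sqrt-exists a 0≤a = s , 0≤s , antisym ss≤a a≤ss
    where
    open ≤-Reasoning
    P : Carrier → Set
    P y = 0# ≤ y × y * y ≤ a
    b = a + 1#
    0<b : 0# < b
    0<b = ≤-<-trans 0≤a (<-via 1# 0<1 refl)
    P-bound : UpperBound P b
    P-bound y (_ , yy≤a) = square-cancel-≤ (proj₁ 0<b) (begin
      y * y   ≤⟨ yy≤a ⟩
      a       ≤⟨ ≤-via (a * a + a + 1#) (+-nonNegative (+-nonNegative (*-nonNegative 0≤a 0≤a) 0≤a) 0≤1)
                   (solve 1 (λ a → a :+ (a :* a :+ a :+ con (+ 1)) := (a :+ con (+ 1)) :* (a :+ con (+ 1))) refl a) ⟩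
      b * b   ∎)
    sup = supremum P (0# , ≤-refl , ≤-respˡ-≈ (sym (zeroˡ 0#)) 0≤a) (b , P-bound)
    s = proj₁ sup
    s-upper = proj₁ (proj₂ sup)
    s-least = proj₂ (proj₂ sup)
    0≤s : 0# ≤ s
    0≤s = s-upper 0# (≤-refl , ≤-respˡ-≈ (sym (zeroˡ 0#)) 0≤a)
    t = s + b
    0<t : 0# < t
    0<t = ≤-<-trans 0≤s (<-via b 0<b refl)
    0≤t⁻¹ = proj₁ (0<x⇒0<x⁻¹ 0<t)
    t*t⁻¹ : t * t ⁻¹ ≈ 1#
    t*t⁻¹ = ⁻¹-inverseʳ (0<⇒≉0 0<t)
    -- This is b² - a, the nonnegative factor in the formula for y² - a.
    c = a * a + a + 1#
    0≤c : 0# ≤ c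
    0≤c = +-nonNegative (+-nonNegative (*-nonNegative 0≤a 0≤a) 0≤a) 0≤1
    y = (b * s + a) * t ⁻¹
    0≤y : 0# ≤ y
    0≤y = *-nonNegative (+-nonNegative (*-nonNegative (proj₁ 0<b) 0≤s) 0≤a) 0≤t⁻¹
    ty : t * y ≈ b * s + a
    ty = trans (solve 3 (λ t u v → t :* (u :* v) := u :* (t :* v)) refl t (b * s + a) (t ⁻¹))
               (trans (*-congˡ t*t⁻¹) (*-identityʳ _))
    t[s-y] : t * s ≈ t * y + (s * s - a)
    t[s-y] = sym (trans (+-congʳ ty) (solve 2 (λ s a → (a :+ con (+ 1)) :* s :+ a :+ (s :* s :- a) := (s :+ (a :+ con (+ 1))) :* s) refl s a))
    tt[yy-a] : t * t * (y * y) ≈ t * t * a + c * (s * s - a)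
    tt[yy-a] = trans (solve 2 (λ t y → t :* t :* (y :* y) := (t :* y) :* (t :* y)) refl t y)
      (trans (*-cong ty ty) (solve 2 (λ s a → let b = a :+ con (+ 1) in
        (b :* s :+ a) :* (b :* s :+ a) := (s :+ b) :* (s :+ b) :* a :+ (a :* a :+ a :+ con (+ 1)) :* (s :* s :- a)) refl s a))
    0<tt = 0<x*y 0<t 0<t
    ss≤a : s * s ≤ a
    ss≤a with total (s * s) a
    ... | inj₁ p = p
    -- Here y² ≥ a makes y an upper bound of `P`, so s ≤ y, and t (y - s) = a - s² is nonnegative.
    -- In the other half y² ≤ a puts y into `P`, and the signs are reversed.
    ... | inj₂ a≤ss = 0≤y-x⇒x≤y (≤-respʳ-≈ (trans (+-congˡ (-‿cong t[s-y])) (solve 3 (λ u s a → u :- (u :+ (s :* s :- a)) := a :- s :* s) refl (t * y) s a))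
        (x≤y⇒0≤y-x (*-monoˡ-≤ t (proj₁ 0<t) s≤y)))
      where
      a≤yy : a ≤ y * y
      a≤yy = *-cancelˡ-≤ 0<tt (≤-via _ (*-nonNegative 0≤c (x≤y⇒0≤y-x a≤ss)) (sym tt[yy-a]))
      s≤y : s ≤ y
      s≤y = s-least y λ z z∈P → square-cancel-≤ 0≤y (≤-trans (proj₂ z∈P) a≤yy)
    a≤ss : a ≤ s * s
    a≤ss with total (s * s) a
    ... | inj₂ p = p
    ... | inj₁ ss≤a = 0≤y-x⇒x≤y (≤-respʳ-≈ (trans (+-congʳ t[s-y]) (solve 3 (λ u s a → (u :+ (s :* s :- a)) :- u := s :* s :- a) refl (t * y) s a))
        (x≤y⇒0≤y-x (*-monoˡ-≤ t (proj₁ 0<t) y≤s)))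
      where
      yy≤a : y * y ≤ a
      yy≤a = *-cancelˡ-≤ 0<tt (≤-via (c * (a - s * s)) (*-nonNegative 0≤c (x≤y⇒0≤y-x ss≤a))
        (trans (+-congʳ tt[yy-a]) (solve 4 (λ u c s a → u :+ c :* (s :* s :- a) :+ c :* (a :- s :* s) := u) refl (t * t * a) c s a)))
      y≤s : y ≤ s
      y≤s = s-upper y (0≤y , yy≤a)

-- The spectral theorem for real symmetric matrices

module LinearAlgebra (K : CommutativeRing 0ℓ 0ℓ) where

  open CommutativeRing K hiding (zero)
  open import Algebra.Properties.Semiring.Sum semiring public
    using (sum; sum-cong-≋; ∑-distrib-+; ∑-comm; *-distribˡ-sum; *-distribʳ-sum; sum-replicate; sum-replicate-zero)
  open import Relation.Binary.Reasoning.Setoid setoid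

  private variable
    m n : ℕ

  Symmetricᵐ : (Fin n → Vector Carrier n) → Set
  Symmetricᵐ M = ∀ i j → M i j ≈ M j i

  dot : Vector Carrier n → Vector Carrier n → Carrier
  dot x y = sum λ j → x j * y j

  app : (Fin m → Vector Carrier n) → Vector Carrier n → Vector Carrier m
  app M x j = dot (M j) x

  δ : Fin n → Vector Carrier n
  δ i j = if does (i ≟ j) then 1# else 0#

  dot-congʳ : (x : Vector Carrier n) {y y′ : Vector Carrier n} → (∀ i → y i ≈ y′ i) → dot x y ≈ dot x y′
  dot-congʳ x y≈ = sum-cong-≋ λ i → *-congˡ (y≈ i)

  dot-congˡ : {x x′ : Vector Carrier n} (y : Vector Carrier n) → (∀ i → x i ≈ x′ i) → dot x y ≈ dot x′ y
  dot-congˡ y x≈ = sum-cong-≋ λ i → *-congʳ (x≈ i)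

  dot-comm : (x y : Vector Carrier n) → dot x y ≈ dot y x
  dot-comm x y = sum-cong-≋ λ i → *-comm (x i) (y i)

  dot-∑ʳ : (x : Vector Carrier n) (f : Fin m → Vector Carrier n) →
           dot x (λ i → sum λ k → f k i) ≈ sum λ k → dot x (f k)
  dot-∑ʳ x f = begin
    sum (λ i → x i * sum λ k → f k i)     ≈⟨ sum-cong-≋ (λ i → *-distribˡ-sum (x i) (λ k → f k i)) ⟩
    sum (λ i → sum λ k → x i * f k i)     ≈⟨ ∑-comm (λ i k → x i * f k i) ⟩
    sum (λ k → sum λ i → x i * f k i)     ∎

  dot-*ʳ : ∀ (x : Vector Carrier n) c y → dot x (λ i → c * y i) ≈ c * dot x y
  dot-*ʳ x c y = begin
    sum (λ i → x i * (c * y i))   ≈⟨ sum-cong-≋ (λ i → trans (sym (*-assoc _ _ _)) (trans (*-congʳ (*-comm (x i) c)) (*-assoc _ _ _))) ⟩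
    sum (λ i → c * (x i * y i))   ≈⟨ *-distribˡ-sum c (λ i → x i * y i) ⟨
    c * dot x y                   ∎

  -- The shape y + c z is that of every perturbation below: spectral shifts, Schur complements,
  -- Householder reflections, and differences with c = -1.
  dot-linearʳ : ∀ (x y : Vector Carrier n) c z → dot x (λ i → y i + c * z i) ≈ dot x y + c * dot x z
  dot-linearʳ x y c z = begin
    sum (λ i → x i * (y i + c * z i))            ≈⟨ sum-cong-≋ (λ i → distribˡ (x i) (y i) (c * z i)) ⟩
    sum (λ i → x i * y i + x i * (c * z i))      ≈⟨ ∑-distrib-+ (λ i → x i * y i) (λ i → x i * (c * z i)) ⟩
    dot x y + dot x (λ i → c * z i)              ≈⟨ +-congˡ (dot-*ʳ x c z) ⟩
    dot x y + c * dot x z                        ∎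

  dot-linearˡ : ∀ (y : Vector Carrier n) c z x → dot (λ i → y i + c * z i) x ≈ dot y x + c * dot z x
  dot-linearˡ y c z x = trans (dot-comm _ x) (trans (dot-linearʳ x y c z) (+-cong (dot-comm x y) (*-congˡ (dot-comm x z))))

  sum-0 : (f : Vector Carrier n) → (∀ i → f i ≈ 0#) → sum f ≈ 0#
  sum-0 {n} f f≈0 = trans (sum-cong-≋ f≈0) (sum-replicate-zero n)

  dot-0ʳ : (x : Vector Carrier n) {y : Vector Carrier n} → (∀ i → y i ≈ 0#) → dot x y ≈ 0#
  dot-0ʳ x y≈0 = sum-0 _ λ i → trans (*-congˡ (y≈0 i)) (zeroʳ (x i))

  dot-δ : (i : Fin n) (x : Vector Carrier n) → dot (δ i) x ≈ x i
  dot-δ {suc n} zero x = begin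
    1# * x zero + sum (λ j → 0# * x (suc j))  ≈⟨ +-cong (*-identityˡ _) (sum-0 {n} _ (λ j → zeroˡ _)) ⟩
    x zero + 0#                               ≈⟨ +-identityʳ _ ⟩
    x zero                                    ∎
  dot-δ (suc i) x = trans (+-cong (zeroˡ _) (dot-δ i (λ j → x (suc j)))) (+-identityˡ _)

  δ-sym : (i j : Fin n) → δ i j ≡ δ j i
  δ-sym zero    zero    = ≡.refl
  δ-sym zero    (suc j) = ≡.refl
  δ-sym (suc i) zero    = ≡.refl
  δ-sym (suc i) (suc j) = δ-sym i j

  dot-app : (M : Fin m → Vector Carrier n) (x : Vector Carrier m) (y : Vector Carrier n) →
            dot x (app M y) ≈ dot (app (λ j i → M i j) x) y
  dot-app M x y = begin
    sum (λ i → x i * sum λ j → M i j * y j)       ≈⟨ dot-∑ʳ x (λ j i → M i j * y j) ⟩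
    sum (λ j → sum λ i → x i * (M i j * y j))     ≈⟨ sum-cong-≋ (λ j → trans
                                                       (sum-cong-≋ (λ i → trans (sym (*-assoc _ _ _)) (*-congʳ (*-comm (x i) (M i j)))))
                                                       (sym (*-distribʳ-sum (y j) (λ i → M i j * x i)))) ⟩
    sum (λ j → sum (λ i → M i j * x i) * y j)     ∎

  dot-app-sym : {M : Fin n → Vector Carrier n} → Symmetricᵐ M → ∀ x y → dot x (app M y) ≈ dot (app M x) y
  dot-app-sym {M = M} M-sym x y = trans (dot-app M x y)
    (dot-congˡ y (λ j → dot-congˡ x (λ i → M-sym i j)))

module SpectralTheorem (em : ExcludedMiddle 0ℓ) (R : CompleteOrderedField) where

  open OrderedField em R
  open LinearAlgebra commutativeRing hiding (sum)
  open ≤-Reasoning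

  private variable
    n : ℕ

  sum-nonNegative : (f : Vector Carrier n) → (∀ i → 0# ≤ f i) → 0# ≤ sum f
  sum-nonNegative {zero}  f 0≤f = ≤-refl
  sum-nonNegative {suc n} f 0≤f = +-nonNegative (0≤f zero) (sum-nonNegative (λ i → f (suc i)) (λ i → 0≤f (suc i)))

  sum-mono-≤ : (f g : Vector Carrier n) → (∀ i → f i ≤ g i) → sum f ≤ sum g
  sum-mono-≤ {zero}  f g f≤g = ≤-refl
  sum-mono-≤ {suc n} f g f≤g = +-mono-≤ (f≤g zero) (sum-mono-≤ (λ i → f (suc i)) (λ i → g (suc i)) (λ i → f≤g (suc i)))

  sum≈0⇒≈0 : (f : Vector Carrier n) → (∀ i → 0# ≤ f i) → sum f ≈ 0# → ∀ i → f i ≈ 0#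
  sum≈0⇒≈0 {suc n} f 0≤f eq = λ
    { zero    → x+y≈0⇒x≈0 (0≤f zero) 0≤∑ eq
    ; (suc i) → sum≈0⇒≈0 (λ i → f (suc i)) (λ i → 0≤f (suc i)) (x+y≈0⇒x≈0 0≤∑ (0≤f zero) (trans (+-comm _ _) eq)) i }
    where
    0≤∑ = sum-nonNegative (λ i → f (suc i)) (λ i → 0≤f (suc i))

  0≤dot : (x : Vector Carrier n) → 0# ≤ dot x x
  0≤dot x = sum-nonNegative _ λ i → square-nonNegative (x i)

  dot≈0⇒≈0 : (x : Vector Carrier n) → dot x x ≈ 0# → ∀ i → x i ≈ 0#
  dot≈0⇒≈0 x eq i = square≈0 (sum≈0⇒≈0 _ (λ i → square-nonNegative (x i)) eq i)

  -- A crude Cauchy-Schwarz inequality, by induction with (p + q)² ≤ 2 (p² + q²). The constant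
  -- doubles with each coordinate, but only its existence matters.
  dot-bounded : (b : Vector Carrier n) → ∃[ K ] 0# ≤ K × (∀ y → dot b y * dot b y ≤ K * dot y y)
  dot-bounded {zero}  b = 0# , ≤-refl , λ y → ≤-refl
  dot-bounded {suc n} b = K′ , 0≤K′ , bound
    where
    b₀ = b zero
    ih = dot-bounded (λ i → b (suc i))
    K = proj₁ ih
    0≤K = proj₁ (proj₂ ih)
    K′ = two * (b₀ * b₀ + K)
    0≤K′ : 0# ≤ K′
    0≤K′ = *-nonNegative 0≤two (+-nonNegative (square-nonNegative b₀) 0≤K)
    bound : ∀ y → dot b y * dot b y ≤ K′ * dot y y
    bound y = begin
      (b₀ * t + s) * (b₀ * t + s)
        ≤⟨ ≤-via ((b₀ * t - s) * (b₀ * t - s)) (square-nonNegative _)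
             (solve 3 (λ b t s → (b :* t :+ s) :* (b :* t :+ s) :+ (b :* t :- s) :* (b :* t :- s)
                              := (con (+ 1) :+ con (+ 1)) :* (b :* b :* (t :* t) :+ s :* s)) refl b₀ t s) ⟩
      two * (b₀ * b₀ * (t * t) + s * s)
        ≤⟨ *-monoˡ-≤ two 0≤two (+-mono-≤ ≤-refl (proj₂ (proj₂ ih) (λ i → y (suc i)))) ⟩
      two * (b₀ * b₀ * (t * t) + K * q)
        ≤⟨ ≤-via (two * (b₀ * b₀ * q + K * (t * t)))
             (*-nonNegative 0≤two (+-nonNegative (*-nonNegative (square-nonNegative b₀) (0≤dot (λ i → y (suc i)))) (*-nonNegative 0≤K (square-nonNegative t))))
             (solve 4 (λ b tt K q → let two = con (+ 1) :+ con (+ 1) in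
                two :* (b :* tt :+ K :* q) :+ two :* (b :* q :+ K :* tt)
                := (two :* (b :+ K)) :* (tt :+ q)) refl (b₀ * b₀) (t * t) K q) ⟩
      K′ * (t * t + q) ∎
      where
      t = y zero
      s = dot (λ i → b (suc i)) (λ i → y (suc i))
      q = dot (λ i → y (suc i)) (λ i → y (suc i))

  form-block : (N : Fin (suc n) → Vector Carrier (suc n)) → Symmetricᵐ N → (x : Vector Carrier (suc n)) →
    let s = dot (λ j → N zero (suc j)) (λ j → x (suc j)) in
    dot x (app N x) ≈ N zero zero * (x zero * x zero) + two * (x zero * s)
      + dot (λ j → x (suc j)) (app (λ i j → N (suc i) (suc j)) (λ j → x (suc j)))
  form-block N N-sym x = begin-equality
    x₀ * (a * x₀ + s) + sum (λ i → y i * (N (suc i) zero * x₀ + app C y i))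
      ≈⟨ +-congˡ (dot-congʳ y (λ i → trans (+-comm _ _) (+-congˡ (trans (*-comm _ _) (*-congˡ (N-sym (suc i) zero)))))) ⟩
    x₀ * (a * x₀ + s) + dot y (λ i → app C y i + x₀ * b i)
      ≈⟨ +-congˡ (trans (dot-linearʳ y (app C y) x₀ b) (+-congˡ (*-congˡ (dot-comm y b)))) ⟩
    x₀ * (a * x₀ + s) + (dot y (app C y) + x₀ * s)
      ≈⟨ solve 4 (λ a x s q → x :* (a :* x :+ s) :+ (q :+ x :* s) := a :* (x :* x) :+ (con (+ 1) :+ con (+ 1)) :* (x :* s) :+ q) refl a x₀ s (dot y (app C y)) ⟩
    a * (x₀ * x₀) + two * (x₀ * s) + dot y (app C y) ∎
    where
    x₀ = x zero
    y = λ j → x (suc j)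
    a = N zero zero
    b = λ j → N zero (suc j)
    C = λ i j → N (suc i) (suc j)
    s = dot b y

  -- Positive semidefinite forms: null vector or coercivity

  NonZeroᵛ : Vector Carrier n → Set
  NonZeroᵛ x = ∃[ i ] x i ≉ 0#

  PositiveSemidefinite : (Fin n → Vector Carrier n) → Set
  PositiveSemidefinite N = ∀ x → 0# ≤ dot x (app N x)

  Kernel : (Fin n → Vector Carrier n) → Vector Carrier n → Set
  Kernel N x = NonZeroᵛ x × (∀ i → app N x i ≈ 0#)

  -- Positive definiteness with a uniform margin ε: it is this margin that lets the form be lowered
  -- by ε ∥x∥² and remain semidefinite.
  Coercive : (Fin n → Vector Carrier n) → Carrier → Set
  Coercive N ε = 0# < ε × (∀ x → ε * dot x x ≤ dot x (app N x))

  module PivotConstant {a ε K : Carrier} (0<a : 0# < a) (0<ε : 0# < ε) (0≤K : 0# ≤ K) where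

    private
      0≤a⁻¹ : 0# ≤ a ⁻¹
      0≤a⁻¹ = proj₁ (0<x⇒0<x⁻¹ 0<a)

      0<ε⁻¹ : 0# < ε ⁻¹
      0<ε⁻¹ = 0<x⇒0<x⁻¹ 0<ε

      L X Y : Carrier
      L = two * (a ⁻¹ * a ⁻¹ * K) + 1#
      X = two * a ⁻¹
      Y = L * ε ⁻¹

      0<L : 0# < L
      0<L = ≤-<-trans (*-nonNegative 0≤two (*-nonNegative (*-nonNegative 0≤a⁻¹ 0≤a⁻¹) 0≤K)) (<-via 1# 0<1 refl)

      0≤X : 0# ≤ X
      0≤X = *-nonNegative 0≤two 0≤a⁻¹

      cancel : ∀ p q → q ≉ 0# → ∀ z → p * q ⁻¹ * (q * z) ≈ p * z
      cancel p q q≉0 z = trans (solve 4 (λ p q q′ z → p :* q′ :* (q :* z) := p :* (q :* q′) :* z) refl p q (q ⁻¹) z)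
        (*-congʳ (trans (*-congˡ (⁻¹-inverseʳ q≉0)) (*-identityʳ p)))

    constant : Carrier
    constant = X + Y

    constant-positive : 0# < constant
    constant-positive = <-≤-trans (0<x*y 0<L 0<ε⁻¹) (≤-via X 0≤X (+-comm Y X))

    -- With t = x + a⁻¹ s, the bound x² ≤ 2 t² + 2 a⁻² s² and s² ≤ K r give x² + r ≤ 2 t² + L r. The
    -- factors X = 2 / a and Y = L / ε rewrite this as X (a t²) + Y (ε r), which is at most (X + Y)
    -- (a t² + ε r). Thus coercivity passes from the Schur complement to the whole form.
    scale-bound : ∀ x s r q → s * s ≤ K * r → ε * r ≤ q → 0# ≤ r →
                  x * x + r ≤ constant * (a * ((x + a ⁻¹ * s) * (x + a ⁻¹ * s)) + q)
    scale-bound x s r q ss≤Kr εr≤q 0≤r = begin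
      x * x + r
        ≤⟨ ≤-via ((t + a ⁻¹ * s) * (t + a ⁻¹ * s)) (square-nonNegative _)
             (solve 4 (λ x c s r → x :* x :+ r :+ (x :+ c :* s :+ c :* s) :* (x :+ c :* s :+ c :* s)
                := (con (+ 1) :+ con (+ 1)) :* ((x :+ c :* s) :* (x :+ c :* s) :+ c :* c :* (s :* s)) :+ r) refl x (a ⁻¹) s r) ⟩
      two * (t * t + a ⁻¹ * a ⁻¹ * (s * s)) + r
        ≤⟨ +-monoˡ-≤ r (*-monoˡ-≤ two 0≤two (+-mono-≤ ≤-refl (*-monoˡ-≤ (a ⁻¹ * a ⁻¹) (*-nonNegative 0≤a⁻¹ 0≤a⁻¹) ss≤Kr))) ⟩
      two * (t * t + a ⁻¹ * a ⁻¹ * (K * r)) + r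
        ≈⟨ solve 4 (λ tt c K r → let two = con (+ 1) :+ con (+ 1) in
             two :* (tt :+ c :* (K :* r)) :+ r := two :* tt :+ (two :* (c :* K) :+ con (+ 1)) :* r)
             refl (t * t) (a ⁻¹ * a ⁻¹) K r ⟩
      two * (t * t) + L * r
        ≈⟨ +-cong (cancel two a (0<⇒≉0 0<a) (t * t)) (cancel L ε (0<⇒≉0 0<ε) r) ⟨
      X * A + Y * B
        ≤⟨ ≤-via (Y * A + X * B)
             (+-nonNegative (*-nonNegative (*-nonNegative (proj₁ 0<L) (proj₁ 0<ε⁻¹)) (*-nonNegative (proj₁ 0<a) (square-nonNegative t)))
                            (*-nonNegative 0≤X (*-nonNegative (proj₁ 0<ε) 0≤r)))
             (solve 4 (λ X Y A B → X :* A :+ Y :* B :+ (Y :* A :+ X :* B) := (X :+ Y) :* (A :+ B)) refl X Y A B) ⟩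
      constant * (A + B)
        ≤⟨ *-monoˡ-≤ constant (proj₁ constant-positive) (+-mono-≤ ≤-refl εr≤q) ⟩
      constant * (A + q) ∎
      where
      t = x + a ⁻¹ * s
      A = a * (t * t)
      B = ε * r

  module Pivot (N : Fin (suc n) → Vector Carrier (suc n)) (N-sym : Symmetricᵐ N) (N-psd : PositiveSemidefinite N) where

    a : Carrier
    a = N zero zero

    b : Vector Carrier n
    b j = N zero (suc j)

    C : Fin n → Vector Carrier n
    C i j = N (suc i) (suc j)

    e₀ : Vector Carrier (suc n)
    e₀ = 1# ∷ λ _ → 0#

    app-e₀ : ∀ i → app N e₀ i ≈ N i zero
    app-e₀ i = trans (+-cong (*-identityʳ _) (dot-0ʳ (λ j → N i (suc j)) (λ _ → refl))) (+-identityʳ _)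

    0≤a : 0# ≤ a
    0≤a = begin
      0#                  ≤⟨ N-psd e₀ ⟩
      dot e₀ (app N e₀)   ≈⟨ dot-congʳ e₀ app-e₀ ⟩
      1# * a + sum (λ i → 0# * N (suc i) zero)  ≈⟨ +-cong (*-identityˡ a) (sum-0 {n} _ (λ _ → zeroˡ _)) ⟩
      a + 0#              ≈⟨ +-identityʳ a ⟩
      a ∎

    form-∷ : ∀ t y → dot (t ∷ y) (app N (t ∷ y)) ≈ a * (t * t) + two * (t * dot b y) + dot y (app C y)
    form-∷ t y = form-block N N-sym (t ∷ y)

    C-psd : PositiveSemidefinite C
    C-psd y = begin
      0#                                        ≤⟨ N-psd (0# ∷ y) ⟩
      dot (0# ∷ y) (app N (0# ∷ y))             ≈⟨ form-∷ 0# y ⟩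
      a * (0# * 0#) + two * (0# * dot b y) + dot y (app C y)
        ≈⟨ solve 3 (λ a s q → a :* (con (+ 0) :* con (+ 0)) :+ (con (+ 1) :+ con (+ 1)) :* (con (+ 0) :* s) :+ q := q) refl a (dot b y) _ ⟩
      dot y (app C y) ∎

    -- When a vanishes the form at t ∷ b is 2 t (b · b) + q, which is linear in t and would take
    -- negative values if b were nonzero.
    a≈0⇒b≈0 : a ≈ 0# → ∀ i → b i ≈ 0#
    a≈0⇒b≈0 a≈0 with em {dot b b ≈ 0#}
    ... | yes bb≈0 = dot≈0⇒≈0 b bb≈0
    ... | no  bb≉0 = ⊥-elim (<⇒≱ neg (N-psd (t ∷ b)))
      where
      q = dot b (app C b)
      -- Chosen so that the form equals - 2 (q + 1) + q = - (q + 2), which is negative because q ≥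
      -- 0.
      t = - ((q + 1#) * dot b b ⁻¹)
      neg : dot (t ∷ b) (app N (t ∷ b)) < 0#
      neg = begin-strict
        dot (t ∷ b) (app N (t ∷ b))             ≈⟨ form-∷ t b ⟩
        a * (t * t) + two * (t * dot b b) + q   ≈⟨ +-congʳ (+-cong (trans (*-congʳ a≈0) (zeroˡ _))
                                                     (*-congˡ (trans (solve 3 (λ q u v → (:- (q :* u)) :* v := (:- q) :* (u :* v)) refl (q + 1#) (dot b b ⁻¹) (dot b b))
                                                       (trans (*-congˡ (⁻¹-inverseˡ bb≉0)) (*-identityʳ _))))) ⟩
        0# + two * (- (q + 1#)) + q             <⟨ <-via (q + two) (<-≤-trans 0<two (≤-via q (C-psd b) (+-comm _ _)))
                                                     (solve 1 (λ q → let two = con (+ 1) :+ con (+ 1) in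
                                                        con (+ 0) :+ two :* (:- (q :+ con (+ 1))) :+ q :+ (q :+ two) := con (+ 0)) refl q) ⟩
        0#                                      ∎

    e₀-kernel : a ≈ 0# → Kernel N e₀
    e₀-kernel a≈0 = (zero , λ 1≈0 → 0≉1 (sym 1≈0)) , λ
      { zero    → trans (app-e₀ zero) a≈0
      ; (suc i) → trans (app-e₀ (suc i)) (trans (N-sym (suc i) zero) (a≈0⇒b≈0 a≈0 i)) }

    -- The Schur complement C - a⁻¹ b bᵀ of the pivot a, with each row written as a row of C plus a
    -- multiple of b.
    schur : Fin n → Vector Carrier n
    schur i j = C i j + (- (a ⁻¹) * b i) * b j

    schur-sym : Symmetricᵐ schur
    schur-sym i j = +-cong (N-sym (suc i) (suc j))
      (solve 3 (λ c x y → c :* x :* y := c :* y :* x) refl (- (a ⁻¹)) (b i) (b j))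

    app-schur : ∀ y i → app schur y i ≈ app C y i + (- (a ⁻¹) * dot b y) * b i
    app-schur y i = trans (dot-linearˡ (C i) _ b y)
      (+-congˡ (solve 3 (λ c x y → c :* x :* y := c :* y :* x) refl (- (a ⁻¹)) (b i) (dot b y)))

    form-schur : ∀ y → dot y (app schur y) ≈ dot y (app C y) - a ⁻¹ * (dot b y * dot b y)
    form-schur y = begin-equality
      dot y (app schur y)                                        ≈⟨ dot-congʳ y (app-schur y) ⟩
      dot y (λ i → app C y i + (- (a ⁻¹) * dot b y) * b i)       ≈⟨ dot-linearʳ y (app C y) _ b ⟩
      dot y (app C y) + (- (a ⁻¹) * dot b y) * dot y b           ≈⟨ +-congˡ (*-congˡ (dot-comm y b)) ⟩
      dot y (app C y) + (- (a ⁻¹) * dot b y) * dot b y           ≈⟨ solve 3 (λ q c s → q :+ (:- c :* s) :* s := q :- c :* (s :* s)) refl _ _ _ ⟩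
      dot y (app C y) - a ⁻¹ * (dot b y * dot b y)               ∎

    module _ (a≉0 : a ≉ 0#) where

      0<a : 0# < a
      0<a = 0≤a , λ 0≈a → a≉0 (sym 0≈a)

      complete-square : ∀ x → let s = dot b (λ j → x (suc j)) ; t = x zero + a ⁻¹ * s in
        dot x (app N x) ≈ a * (t * t) + dot (λ j → x (suc j)) (app schur (λ j → x (suc j)))
      complete-square x = begin-equality
        dot x (app N x)                              ≈⟨ form-block N N-sym x ⟩
        -- The solver treats a and a⁻¹ as independent variables, so the products a a⁻¹ are inserted
        -- here and removed after the polynomial identity.
        a * (x₀ * x₀) + two * (x₀ * s) + q           ≈⟨ +-congʳ (+-cong refl (*-congˡ (*-congˡ (trans (*-congʳ (⁻¹-inverseʳ a≉0)) (*-identityˡ s))))) ⟨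
        a * (x₀ * x₀) + two * (x₀ * (a * a ⁻¹ * s)) + q
          ≈⟨ solve 5 (λ a c x s q → a :* (x :* x) :+ (con (+ 1) :+ con (+ 1)) :* (x :* (a :* c :* s)) :+ q
                                  := a :* ((x :+ c :* s) :* (x :+ c :* s)) :+ (q :- a :* c :* (c :* (s :* s)))) refl a (a ⁻¹) x₀ s q ⟩
        a * (t * t) + (q - a * a ⁻¹ * (a ⁻¹ * (s * s)))  ≈⟨ +-congˡ (+-congˡ (-‿cong (trans (*-congʳ (⁻¹-inverseʳ a≉0)) (*-identityˡ _)))) ⟩
        a * (t * t) + (q - a ⁻¹ * (s * s))           ≈⟨ +-congˡ (form-schur y) ⟨
        a * (t * t) + dot y (app schur y)            ∎
        where
        x₀ = x zero
        y = λ j → x (suc j)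
        s = dot b y
        t = x₀ + a ⁻¹ * s
        q = dot y (app C y)

      -- The first coordinate minimises the form among all extensions of y: it makes the completed
      -- square vanish, so that the form at `lift y` is that of the Schur complement at y.
      lift : Vector Carrier n → Vector Carrier (suc n)
      lift y = (- (a ⁻¹) * dot b y) ∷ y

      schur-psd : PositiveSemidefinite schur
      schur-psd y = begin
        0#                                       ≤⟨ N-psd (lift y) ⟩
        dot (lift y) (app N (lift y))            ≈⟨ complete-square (lift y) ⟩
        a * (t * t) + dot y (app schur y)        ≈⟨ solve 4 (λ a c s q → a :* ((:- c :* s :+ c :* s) :* (:- c :* s :+ c :* s)) :+ q := q) refl a (a ⁻¹) (dot b y) (dot y (app schur y)) ⟩
        dot y (app schur y)                      ∎
        where
        t = - (a ⁻¹) * dot b y + a ⁻¹ * dot b y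

      lift-kernel : ∀ {y} → Kernel schur y → Kernel N (lift y)
      lift-kernel {y} ((i , yi≉0) , Sy≈0) = (suc i , yi≉0) , λ
        { zero → begin-equality
            a * (- (a ⁻¹) * dot b y) + dot b y   ≈⟨ solve 3 (λ a c s → a :* (:- c :* s) :+ s := s :- (a :* c) :* s) refl a (a ⁻¹) (dot b y) ⟩
            dot b y - a * a ⁻¹ * dot b y         ≈⟨ +-congˡ (-‿cong (*-congʳ (⁻¹-inverseʳ a≉0))) ⟩
            dot b y - 1# * dot b y               ≈⟨ solve 1 (λ s → s :- con (+ 1) :* s := con (+ 0)) refl (dot b y) ⟩
            0#                                   ∎
        ; (suc i) → begin-equality
            N (suc i) zero * (- (a ⁻¹) * dot b y) + app C y i   ≈⟨ +-congʳ (*-congʳ (N-sym (suc i) zero)) ⟩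
            b i * (- (a ⁻¹) * dot b y) + app C y i              ≈⟨ trans (+-comm _ _) (+-congˡ (*-comm _ _)) ⟩
            app C y i + (- (a ⁻¹) * dot b y) * b i              ≈⟨ app-schur y i ⟨
            app schur y i                                       ≈⟨ Sy≈0 i ⟩
            0#                                                  ∎ }

      lift-coercive : ∀ {ε} → Coercive schur ε → ∃ (Coercive N)
      lift-coercive {ε} (0<ε , coercive) = D ⁻¹ , 0<x⇒0<x⁻¹ 0<D , λ x →
        *-cancelˡ-≤ 0<D (begin
          D * (D ⁻¹ * dot x x)     ≈⟨ *-assoc D (D ⁻¹) (dot x x) ⟨
          D * D ⁻¹ * dot x x       ≈⟨ trans (*-congʳ (⁻¹-inverseʳ (0<⇒≉0 0<D))) (*-identityˡ (dot x x)) ⟩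
          dot x x                  ≤⟨ scale-bound _ _ _ _ (K-bound (λ j → x (suc j))) (coercive (λ j → x (suc j))) (0≤dot (λ j → x (suc j))) ⟩
          D * (a * ((x zero + a ⁻¹ * dot b (λ j → x (suc j))) * (x zero + a ⁻¹ * dot b (λ j → x (suc j))))
               + dot (λ j → x (suc j)) (app schur (λ j → x (suc j))))
                                   ≈⟨ *-congˡ (complete-square x) ⟨
          D * dot x (app N x)      ∎)
        where
        K = proj₁ (dot-bounded b)
        K-bound = proj₂ (proj₂ (dot-bounded b))
        open PivotConstant 0<a 0<ε (proj₁ (proj₂ (dot-bounded b))) renaming (constant to D; constant-positive to 0<D)

  -- Elimination of one coordinate at a time: a zero pivot gives the null vector e₀, and at a
  -- nonzero pivot either outcome for the Schur complement lifts to N. In dimension 0 every form is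
  -- coercive.
  kernel-or-coercive : (N : Fin n → Vector Carrier n) → Symmetricᵐ N → PositiveSemidefinite N →
                       ∃ (Kernel N) ⊎ ∃ (Coercive N)
  kernel-or-coercive {zero}  N N-sym N-psd = inj₂ (1# , 0<1 , λ x → ≤-reflexive (zeroʳ 1#))
  kernel-or-coercive {suc n} N N-sym N-psd = pivot em
    where
    open Pivot N N-sym N-psd
    pivot : Dec (a ≈ 0#) → ∃ (Kernel N) ⊎ ∃ (Coercive N)
    pivot (yes a≈0) = inj₁ (e₀ , e₀-kernel a≈0)
    pivot (no  a≉0) = Sum.map (λ (y , k) → lift a≉0 y , lift-kernel a≉0 k) (λ (_ , c) → lift-coercive a≉0 c)
                        (kernel-or-coercive schur schur-sym (schur-psd a≉0))

  -- Expanding ∥x + M x∥² ≥ 0 gives 2 xᵀM x ≥ - (∥x∥² + ∥M x∥²), and `dot-bounded` applied to each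
  -- row bounds ∥M x∥² by a multiple of ∥x∥². This makes the set whose supremum is the smallest
  -- eigenvalue nonempty.
  form-bounded-below : (M : Fin n → Vector Carrier n) → ∃[ B ] (∀ x → - B * dot x x ≤ dot x (app M x))
  form-bounded-below {n} M = B , λ x → *-cancelˡ-≤ 0<two (bound x)
    where
    K : Fin n → Carrier
    K i = proj₁ (dot-bounded (M i))
    B = 1# + sum K
    0≤B : 0# ≤ B
    0≤B = +-nonNegative 0≤1 (sum-nonNegative K (λ i → proj₁ (proj₂ (dot-bounded (M i)))))
    app-bound : ∀ x → dot (app M x) (app M x) ≤ sum K * dot x x
    app-bound x = ≤-respʳ-≈ (sym (*-distribʳ-sum (dot x x) K))
      (sum-mono-≤ _ _ (λ i → proj₂ (proj₂ (dot-bounded (M i))) x))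
    bound : ∀ x → two * (- B * dot x x) ≤ two * dot x (app M x)
    bound x = begin
      two * (- B * r)
        ≤⟨ ≤-via (B * r) (*-nonNegative 0≤B (0≤dot x))
             (solve 2 (λ B r → (con (+ 1) :+ con (+ 1)) :* (:- B :* r) :+ B :* r := :- (B :* r)) refl B r) ⟩
      - (B * r)
        ≈⟨ solve 2 (λ k r → :- ((con (+ 1) :+ k) :* r) := :- (r :+ k :* r)) refl (sum K) r ⟩
      - (r + sum K * r)
        ≤⟨ -‿anti-≤ (+-mono-≤ ≤-refl (app-bound x)) ⟩
      - (r + dot Mx Mx)
        ≤⟨ ≤-via (dot (λ i → x i + 1# * Mx i) (λ i → x i + 1# * Mx i)) (0≤dot (λ i → x i + 1# * Mx i))
             (trans (+-congˡ expand) (solve 3 (λ r m p → :- (r :+ m) :+ (r :+ p :+ (p :+ m)) := (con (+ 1) :+ con (+ 1)) :* p) refl r (dot Mx Mx) (dot x Mx))) ⟩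
      two * dot x Mx ∎
      where
      Mx = app M x
      r = dot x x
      expand : dot (λ i → x i + 1# * Mx i) (λ i → x i + 1# * Mx i) ≈ (r + dot x Mx) + (dot x Mx + dot Mx Mx)
      expand = trans (dot-linearˡ x 1# Mx _) (+-cong
        (trans (dot-linearʳ x x 1# Mx) (+-congˡ (*-identityˡ _)))
        (trans (*-identityˡ _) (trans (dot-linearʳ Mx x 1# Mx) (+-cong (dot-comm Mx x) (*-identityˡ _)))))

  app-shift : (M : Fin n → Vector Carrier n) (c : Carrier) → ∀ x i →
              app (λ i j → M i j + c * δ i j) x i ≈ app M x i + c * x i
  app-shift M c x i = trans (dot-linearˡ (M i) c (δ i) x) (+-congˡ (*-congˡ (dot-δ i x)))

  form-shift : (M : Fin n → Vector Carrier n) (c : Carrier) → ∀ x →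
               dot x (app (λ i j → M i j + c * δ i j) x) ≈ dot x (app M x) + c * dot x x
  form-shift M c x = trans (dot-congʳ x (app-shift M c x)) (dot-linearʳ x (app M x) c x)

  -- Existence of an eigenvector

  Eigenvector : (Fin n → Vector Carrier n) → Carrier → Vector Carrier n → Set
  Eigenvector M θ v = ∀ i → app M v i ≈ θ * v i

  -- The eigenvalue is the largest λ for which M - λ is positive semidefinite: for it, M - λ cannot be coercive.
  eigenvalue : (M : Fin (suc n) → Vector Carrier (suc n)) → Symmetricᵐ M →
               ∃[ θ ] ∃[ v ] NonZeroᵛ v × Eigenvector M θ v
  eigenvalue {n} M M-sym = θ , conclude (kernel-or-coercive N N-sym N-psd)
    where
    P : Carrier → Set
    P d = ∀ x → d * dot x x ≤ dot x (app M x)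
    e₀ : Vector Carrier (suc n)
    e₀ = δ zero
    d≤ : ∀ {d r q} → 0# < r → d * r ≤ q → d ≤ r ⁻¹ * q
    d≤ {d} {r} {q} 0<r dr≤q = *-cancelˡ-≤ 0<r (begin
      r * d            ≈⟨ *-comm r d ⟩
      d * r            ≤⟨ dr≤q ⟩
      q                ≈⟨ trans (sym (*-assoc _ _ _)) (trans (*-congʳ (⁻¹-inverseʳ (0<⇒≉0 0<r))) (*-identityˡ q)) ⟨
      r * (r ⁻¹ * q)   ∎)
    0<e₀e₀ : 0# < dot e₀ e₀
    0<e₀e₀ = <-≤-trans 0<1 (≤-reflexive (sym (dot-δ zero e₀)))
    -- The upper bound is the Rayleigh quotient of `e₀`.
    sup = supremum P (_ , proj₂ (form-bounded-below M)) (_ , λ d d∈P → d≤ 0<e₀e₀ (d∈P e₀))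
    θ = proj₁ sup
    N : Fin (suc n) → Vector Carrier (suc n)
    N i j = M i j + - θ * δ i j
    N-sym : Symmetricᵐ N
    N-sym i j = +-cong (M-sym i j) (*-congˡ (reflexive (δ-sym i j)))
      where open CommutativeRing commutativeRing using (reflexive)
    N-psd : PositiveSemidefinite N
    N-psd x = psd em
      where
      r = dot x x
      q = dot x (app M x)
      psd : Dec (r ≈ 0#) → 0# ≤ dot x (app N x)
      psd (yes r≈0) = ≤-reflexive (sym (dot-zeroˡ (dot≈0⇒≈0 x r≈0)))
        where
        dot-zeroˡ : (∀ i → x i ≈ 0#) → dot x (app N x) ≈ 0#
        dot-zeroˡ x≈0 = trans (dot-comm x (app N x)) (dot-0ʳ (app N x) x≈0)
      psd (no r≉0) = begin
        0#                 ≤⟨ x≤y⇒0≤y-x θr≤q ⟩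
        q - θ * r          ≈⟨ solve 3 (λ q θ r → q :- θ :* r := q :+ (:- θ) :* r) refl q θ r ⟩
        q + - θ * r        ≈⟨ form-shift M (- θ) x ⟨
        dot x (app N x)    ∎
        where
        0<r : 0# < r
        0<r = 0≤dot x , λ 0≈r → r≉0 (sym 0≈r)
        -- The Rayleigh quotient q / r of x is an upper bound of `P`, hence at least the least one.
        θr≤q : θ * r ≤ q
        θr≤q = begin
          θ * r            ≈⟨ *-comm θ r ⟩
          r * θ            ≤⟨ *-monoˡ-≤ r (proj₁ 0<r) (proj₂ (proj₂ sup) (r ⁻¹ * q) (λ d d∈P → d≤ 0<r (d∈P x))) ⟩
          r * (r ⁻¹ * q)   ≈⟨ trans (sym (*-assoc _ _ _)) (trans (*-congʳ (⁻¹-inverseʳ r≉0)) (*-identityˡ q)) ⟩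
          q                ∎
    conclude : ∃ (Kernel N) ⊎ ∃ (Coercive N) → ∃[ v ] NonZeroᵛ v × Eigenvector M θ v
    conclude (inj₁ (v , v≉0 , Nv≈0)) = v , v≉0 , λ i → begin-equality
      app M v i                              ≈⟨ solve 3 (λ m θ v → m := (m :+ :- θ :* v) :+ θ :* v) refl (app M v i) θ (v i) ⟩
      (app M v i + - θ * v i) + θ * v i      ≈⟨ +-congʳ (trans (sym (app-shift M (- θ) v i)) (Nv≈0 i)) ⟩
      0# + θ * v i                           ≈⟨ +-identityˡ _ ⟩
      θ * v i                                ∎
    conclude (inj₂ (ε , 0<ε , coercive)) = ⊥-elim (<⇒≱ (<-via ε 0<ε refl) (proj₁ (proj₂ sup) (θ + ε) λ x → begin
      (θ + ε) * dot x x                      ≈⟨ solve 3 (λ θ ε r → (θ :+ ε) :* r := ε :* r :+ θ :* r) refl θ ε (dot x x) ⟩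
      ε * dot x x + θ * dot x x              ≤⟨ +-monoˡ-≤ _ (coercive x) ⟩
      dot x (app N x) + θ * dot x x          ≈⟨ +-congʳ (form-shift M (- θ) x) ⟩
      dot x (app M x) + - θ * dot x x + θ * dot x x
        ≈⟨ solve 3 (λ q θ r → q :+ :- θ :* r :+ θ :* r := q) refl (dot x (app M x)) θ (dot x x) ⟩
      dot x (app M x)                        ∎))

  normalise : ∀ (M : Fin n → Vector Carrier n) {θ v} → NonZeroᵛ v → Eigenvector M θ v →
              ∃[ v ] dot v v ≈ 1# × Eigenvector M θ v
  normalise M {θ} {v} (i , vi≉0) eigen = (λ j → s ⁻¹ * v j) , unit , eigen′
    where
    r≉0 : dot v v ≉ 0#
    r≉0 r≈0 = vi≉0 (dot≈0⇒≈0 v r≈0 i)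
    root = sqrt-exists (dot v v) (0≤dot v)
    s = proj₁ root
    ss≈r = proj₂ (proj₂ root)
    s≉0 : s ≉ 0#
    s≉0 s≈0 = r≉0 (trans (sym ss≈r) (trans (*-congʳ s≈0) (zeroˡ s)))
    unit : dot (λ j → s ⁻¹ * v j) (λ j → s ⁻¹ * v j) ≈ 1#
    unit = begin-equality
      dot (λ j → s ⁻¹ * v j) (λ j → s ⁻¹ * v j)   ≈⟨ dot-*ʳ _ (s ⁻¹) v ⟩
      s ⁻¹ * dot (λ j → s ⁻¹ * v j) v             ≈⟨ *-congˡ (trans (dot-comm _ v) (dot-*ʳ v (s ⁻¹) v)) ⟩
      s ⁻¹ * (s ⁻¹ * dot v v)                     ≈⟨ *-congˡ (*-congˡ ss≈r) ⟨
      s ⁻¹ * (s ⁻¹ * (s * s))                     ≈⟨ solve 2 (λ s t → t :* (t :* (s :* s)) := (t :* s) :* (t :* s)) refl s (s ⁻¹) ⟩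
      (s ⁻¹ * s) * (s ⁻¹ * s)                     ≈⟨ trans (*-cong (⁻¹-inverseˡ s≉0) (⁻¹-inverseˡ s≉0)) (*-identityˡ 1#) ⟩
      1#                                          ∎
    eigen′ : Eigenvector M θ (λ j → s ⁻¹ * v j)
    eigen′ j = begin-equality
      app M (λ j → s ⁻¹ * v j) j    ≈⟨ dot-*ʳ (M j) (s ⁻¹) v ⟩
      s ⁻¹ * app M v j              ≈⟨ *-congˡ (eigen j) ⟩
      s ⁻¹ * (θ * v j)              ≈⟨ solve 3 (λ t θ v → t :* (θ :* v) := θ :* (t :* v)) refl (s ⁻¹) θ (v j) ⟩
      θ * (s ⁻¹ * v j)              ∎

  unit-eigenvector : (M : Fin (suc n) → Vector Carrier (suc n)) → Symmetricᵐ M →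
                     ∃[ θ ] ∃[ v ] dot v v ≈ 1# × Eigenvector M θ v
  unit-eigenvector M M-sym = let (θ , v , v≉0 , eigen) = eigenvalue M M-sym in
    θ , normalise M v≉0 eigen

  -- Householder reflections and deflation

  record Reflection (x y : Vector Carrier n) : Set where
    field
      H          : Fin n → Vector Carrier n
      H-sym      : Symmetricᵐ H
      involutive : ∀ z i → app H (app H z) i ≈ z i
      maps       : ∀ i → app H x i ≈ y i

  -- Householder's reflection 1 - κ w wᵀ in the hyperplane orthogonal to w = y - x, where κ = 2 / wᵀw.
  reflection : (x y : Vector Carrier n) → dot x x ≈ dot y y → Reflection x y
  reflection {n} x y xx≈yy = construct em
    where
    w : Vector Carrier n
    w i = y i + - 1# * x i
    ww = dot w w

    -- The equality of the norms enters here. It yields κ wᵀx = -1 for κ = 2 / wᵀw, so the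
    -- reflection moves x by exactly w.
    ww≈ : ww ≈ two * - dot w x
    ww≈ = begin-equality
      ww                                   ≈⟨ dot-linearʳ w y (- 1#) x ⟩
      dot w y + - 1# * dot w x             ≈⟨ +-congʳ (dot-linearˡ y (- 1#) x y) ⟩
      (dot y y + - 1# * dot x y) + - 1# * dot w x
                                           ≈⟨ +-congʳ (+-cong xx≈yy (*-congˡ (dot-comm y x))) ⟨
      (dot x x + - 1# * dot y x) + - 1# * dot w x
        ≈⟨ solve 3 (λ a b c → (a :+ :- con (+ 1) :* b) :+ :- con (+ 1) :* c := :- (b :+ :- con (+ 1) :* a) :+ :- c) refl (dot x x) (dot y x) (dot w x) ⟩
      - (dot y x + - 1# * dot x x) + - dot w x
        ≈⟨ +-congʳ (-‿cong (dot-linearˡ y (- 1#) x x)) ⟨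
      - dot w x + - dot w x                ≈⟨ solve 1 (λ a → a :+ a := (con (+ 1) :+ con (+ 1)) :* a) refl (- dot w x) ⟩
      two * - dot w x                      ∎

    module _ (κ : Carrier) where
      H : Fin n → Vector Carrier n
      H i j = δ i j + (- κ * w i) * w j

      app-H : ∀ z i → app H z i ≈ z i + (- κ * dot w z) * w i
      app-H z i = trans (dot-linearˡ (δ i) _ w z) (+-cong (dot-δ i z)
        (solve 3 (λ k u v → :- k :* u :* v := :- k :* v :* u) refl κ (w i) (dot w z)))

      H-sym : Symmetricᵐ H
      H-sym i j = +-cong (reflexive (δ-sym i j)) (solve 3 (λ k u v → :- k :* u :* v := :- k :* v :* u) refl κ (w i) (w j))
        where open CommutativeRing commutativeRing using (reflexive)

      -- Multiplying κ wᵀw = 2 by κ admits κ = 0 as well, so that the degenerate case w = 0, where H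
      -- is the identity, needs no separate proof of involutivity.
      module _ (κκww≈ : κ * (κ * ww) ≈ two * κ) where
        H-involutive : ∀ z i → app H (app H z) i ≈ z i
        H-involutive z i = begin-equality
          app H (app H z) i                                     ≈⟨ app-H (app H z) i ⟩
          app H z i + (- κ * dot w (app H z)) * w i             ≈⟨ +-cong (app-H z i) (*-congʳ (*-congˡ
                                                                     (trans (dot-congʳ w (app-H z)) (dot-linearʳ w z _ w)))) ⟩
          z i + (- κ * s) * w i + (- κ * (s + (- κ * s) * ww)) * w i
            ≈⟨ solve 5 (λ z k s w ww → z :+ (:- k :* s) :* w :+ (:- k :* (s :+ (:- k :* s) :* ww)) :* w
                  := z :+ (k :* (k :* ww) :- (con (+ 1) :+ con (+ 1)) :* k) :* (s :* w)) refl (z i) κ s (w i) ww ⟩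
          z i + (κ * (κ * ww) - two * κ) * (s * w i)            ≈⟨ +-congˡ (*-congʳ (+-congʳ κκww≈)) ⟩
          z i + (two * κ - two * κ) * (s * w i)                 ≈⟨ solve 3 (λ z k u → z :+ (k :- k) :* u := z) refl (z i) (two * κ) (s * w i) ⟩
          z i                                                   ∎
          where s = dot w z

        from-maps : (∀ i → app H x i ≈ y i) → Reflection x y
        from-maps maps = record { H = H ; H-sym = H-sym ; involutive = H-involutive ; maps = maps }

    construct : Dec (ww ≈ 0#) → Reflection x y
    construct (yes ww≈0) = from-maps 0# (trans (zeroˡ _) (sym (zeroʳ two))) λ i → begin-equality
      app (H 0#) x i                         ≈⟨ app-H 0# x i ⟩
      x i + (- 0# * dot w x) * w i           ≈⟨ solve 3 (λ x s w → x :+ (:- con (+ 0) :* s) :* w := x) refl (x i) (dot w x) (w i) ⟩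
      x i                                    ≈⟨ +-identityˡ _ ⟨
      0# + x i                               ≈⟨ +-congʳ (dot≈0⇒≈0 w ww≈0 i) ⟨
      w i + x i                              ≈⟨ solve 2 (λ x y → y :+ :- con (+ 1) :* x :+ x := y) refl (x i) (y i) ⟩
      y i                                    ∎
    construct (no ww≉0) = from-maps κ (trans (*-congˡ κww≈two) (*-comm κ two)) λ i → begin-equality
      app (H κ) x i                          ≈⟨ app-H κ x i ⟩
      x i + (- κ * dot w x) * w i            ≈⟨ +-congˡ (*-congʳ (trans (solve 2 (λ k s → :- k :* s := k :* :- s) refl κ (dot w x)) κ[-wx]≈1)) ⟩
      x i + 1# * w i                         ≈⟨ solve 2 (λ x y → x :+ con (+ 1) :* (y :+ :- con (+ 1) :* x) := y) refl (x i) (y i) ⟩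
      y i                                    ∎
      where
      κ = two * ww ⁻¹
      κww≈two : κ * ww ≈ two
      κww≈two = trans (*-assoc _ _ _) (trans (*-congˡ (⁻¹-inverseˡ ww≉0)) (*-identityʳ two))
      κ[-wx]≈1 : κ * - dot w x ≈ 1#
      κ[-wx]≈1 = *-cancelˡ (0<⇒≉0 0<two) (begin-equality
        two * (κ * - dot w x)    ≈⟨ solve 3 (λ t k u → t :* (k :* u) := k :* (t :* u)) refl two κ (- dot w x) ⟩
        κ * (two * - dot w x)    ≈⟨ *-congˡ ww≈ ⟨
        κ * ww                   ≈⟨ κww≈two ⟩
        two                      ≈⟨ *-identityʳ two ⟨
        two * 1#                 ∎)

  -- Completeness is recorded as the polarised Parseval identity: this form expands dot products and
  -- norms at once, and it passes through an isometry without a dimension count.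
  record Eigenbasis (M : Fin n → Vector Carrier n) : Set where
    field
      eigenvalueOf : Fin n → Carrier
      basis        : Fin n → Vector Carrier n
      eigenvector  : ∀ k → Eigenvector M (eigenvalueOf k) (basis k)
      unit         : ∀ k → dot (basis k) (basis k) ≈ 1#
      parseval     : ∀ x y → sum (λ k → dot (basis k) x * dot (basis k) y) ≈ dot x y

  module Deflation (M : Fin (suc n) → Vector Carrier (suc n)) (M-sym : Symmetricᵐ M)
                   (θ : Carrier) (v : Vector Carrier (suc n)) (v-unit : dot v v ≈ 1#) (v-eigen : Eigenvector M θ v)
                   (reflection : Reflection (δ zero) v) where
    open Reflection reflection

    -- The conjugate H M H, with its entries written as values of the bilinear form of M on rows of
    -- the symmetric matrix H.
    M″ : Fin (suc n) → Vector Carrier (suc n)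
    M″ i j = dot (H i) (app M (H j))

    app-M″ : ∀ x i → app M″ x i ≈ app H (app M (app H x)) i
    app-M″ x i = begin-equality
      sum (λ j → dot (H i) (app M (H j)) * x j)
        ≈⟨ dot-congˡ x (λ j → trans (dot-app-sym M-sym (H i) (H j)) (dot-comm (app M (H i)) (H j))) ⟩
      dot (app H (app M (H i))) x          ≈⟨ dot-app-sym H-sym (app M (H i)) x ⟨
      dot (app M (H i)) (app H x)          ≈⟨ dot-app-sym M-sym (H i) (app H x) ⟨
      dot (H i) (app M (app H x))          ∎

    M″-sym : Symmetricᵐ M″
    M″-sym i j = trans (dot-app-sym M-sym (H i) (H j)) (dot-comm (app M (H i)) (H j))

    -- H exchanges e₀ and v, so e₀ is an eigenvector of H M H for θ. By symmetry the first row has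
    -- the same shape, which leaves `M′` as the remaining diagonal block.
    M″-column : ∀ i → M″ i zero ≈ θ * δ zero i
    M″-column i = begin-equality
      M″ i zero                                ≈⟨ dot-δ zero (M″ i) ⟨
      dot (δ zero) (M″ i)                      ≈⟨ dot-comm (δ zero) (M″ i) ⟩
      app M″ (δ zero) i                        ≈⟨ app-M″ (δ zero) i ⟩
      app H (app M (app H (δ zero))) i         ≈⟨ dot-congʳ (H i) (λ j → trans (dot-congʳ (M j) maps) (v-eigen j)) ⟩
      app H (λ j → θ * v j) i                  ≈⟨ dot-*ʳ (H i) θ v ⟩
      θ * app H v i                            ≈⟨ *-congˡ (dot-congʳ (H i) maps) ⟨
      θ * app H (app H (δ zero)) i             ≈⟨ *-congˡ (involutive (δ zero) i) ⟩
      θ * δ zero i                             ∎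

    M′ : Fin n → Vector Carrier n
    M′ i j = M″ (suc i) (suc j)

    M′-sym : Symmetricᵐ M′
    M′-sym i j = M″-sym (suc i) (suc j)

    tail : Vector Carrier (suc n) → Vector Carrier n
    tail x j = x (suc j)

    M″-block : ∀ {μ y} → Eigenvector M′ μ y → Eigenvector M″ μ (0# ∷ y)
    M″-block {μ} {y} y-eigen zero = begin-equality
      M″ zero zero * 0# + dot (tail (M″ zero)) y   ≈⟨ +-cong (zeroʳ _) (trans (dot-comm _ y)
                                                        (dot-0ʳ y (λ j → trans (M″-sym zero (suc j)) (trans (M″-column (suc j)) (zeroʳ θ))))) ⟩
      0# + 0#                                      ≈⟨ +-identityˡ 0# ⟩
      0#                                           ≈⟨ zeroʳ μ ⟨
      μ * 0#                                       ∎
    M″-block {μ} {y} y-eigen (suc i) = trans (+-congʳ (zeroʳ _)) (trans (+-identityˡ _) (y-eigen i))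

    lift-eigenvector : ∀ {μ y} → Eigenvector M′ μ y → Eigenvector M μ (app H (0# ∷ y))
    lift-eigenvector {μ} {y} y-eigen i = begin-equality
      app M (app H z) i                    ≈⟨ involutive (app M (app H z)) i ⟨
      app H (app H (app M (app H z))) i    ≈⟨ dot-congʳ (H i) (λ j → trans (sym (app-M″ z j)) (M″-block y-eigen j)) ⟩
      app H (λ j → μ * z j) i              ≈⟨ dot-*ʳ (H i) μ z ⟩
      μ * app H z i                        ∎
      where
      z : Vector Carrier (suc n)
      z = 0# ∷ y

    isometry : ∀ x y → dot (app H x) (app H y) ≈ dot x y
    isometry x y = trans (sym (dot-app-sym H-sym x (app H y))) (dot-congʳ x (involutive y))

    dot-lift : ∀ y x → dot (app H (0# ∷ y)) x ≈ dot y (tail (app H x))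
    dot-lift y x = trans (sym (dot-app-sym H-sym (0# ∷ y) x)) (trans (+-congʳ (zeroˡ _)) (+-identityˡ _))

    dot-v : ∀ x → dot v x ≈ app H x zero
    dot-v x = begin-equality
      dot v x                       ≈⟨ dot-congˡ x maps ⟨
      dot (app H (δ zero)) x        ≈⟨ dot-app-sym H-sym (δ zero) x ⟨
      dot (δ zero) (app H x)        ≈⟨ dot-δ zero (app H x) ⟩
      app H x zero                  ∎

    extend : Eigenbasis M′ → Eigenbasis M
    extend B′ = record
      { eigenvalueOf = θ ∷ B′.eigenvalueOf
      ; basis        = v ∷ λ k → app H (0# ∷ B′.basis k)
      ; eigenvector  = λ { zero → v-eigen ; (suc k) → lift-eigenvector (B′.eigenvector k) }
      ; unit         = λ
        { zero    → v-unit
        ; (suc k) → trans (isometry (0# ∷ B′.basis k) (0# ∷ B′.basis k))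
                      (trans (+-congʳ (zeroˡ _)) (trans (+-identityˡ _) (B′.unit k))) }
      -- Coefficients along the new basis are computed after reflection: v reads off coordinate zero
      -- of `app H x`, the lifted vectors see only its tail, and H preserves the dot product.
      ; parseval     = λ x y → begin-equality
          dot v x * dot v y + sum (λ k → dot (app H (0# ∷ B′.basis k)) x * dot (app H (0# ∷ B′.basis k)) y)
            ≈⟨ +-cong (*-cong (dot-v x) (dot-v y)) (sum-cong-≋ (λ k → *-cong (dot-lift (B′.basis k) x) (dot-lift (B′.basis k) y))) ⟩
          app H x zero * app H y zero + sum (λ k → dot (B′.basis k) (tail (app H x)) * dot (B′.basis k) (tail (app H y)))
            ≈⟨ +-congˡ (B′.parseval (tail (app H x)) (tail (app H y))) ⟩
          dot (app H x) (app H y)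
            ≈⟨ isometry x y ⟩
          dot x y ∎
      }
      where module B′ = Eigenbasis B′

  deflate : (∀ (M : Fin n → Vector Carrier n) → Symmetricᵐ M → Eigenbasis M) →
            (M : Fin (suc n) → Vector Carrier (suc n)) → Symmetricᵐ M → Eigenbasis M
  deflate {n} ih M M-sym = let (θ , v , v-unit , v-eigen) = unit-eigenvector M M-sym in
    deflate-along θ v v-unit v-eigen (reflection (δ zero) v (trans (dot-δ zero (δ (zero {n}))) (sym v-unit)))
    where
    deflate-along : ∀ θ v → dot v v ≈ 1# → Eigenvector M θ v → Reflection (δ zero) v → Eigenbasis M
    deflate-along θ v v-unit v-eigen H = extend (ih M′ M′-sym)
      where open Deflation M M-sym θ v v-unit v-eigen H

  eigenbasis : (M : Fin n → Vector Carrier n) → Symmetricᵐ M → Eigenbasis M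
  eigenbasis {zero}  M M-sym = record
    { eigenvalueOf = λ () ; basis = λ () ; eigenvector = λ () ; unit = λ () ; parseval = λ x y → refl }
  eigenbasis {suc n} = deflate eigenbasis

-- Complex numbers and limits

module ComplexNumbers (em : ExcludedMiddle 0ℓ) (R : CompleteOrderedField) where

  open Analysis em R public hiding (module ℝ; _≈_; _,_; sum; A; L; Q)
  open Analysis em R using (_≈_; _,_)
  module ℝ = OrderedField em R

  neg : ℂ → ℂ
  neg (a +𝕚 b) = (ℝ.- a) +𝕚 (ℝ.- b)

  ℂ-commutativeRing : CommutativeRing 0ℓ 0ℓ
  ℂ-commutativeRing = record
    { Carrier = ℂ ; _≈_ = _≈_ ; _+_ = _+_ ; _*_ = _*_ ; -_ = neg ; 0# = 0ᶜ ; 1# = 1ᶜ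
    ; isCommutativeRing = record
      { isRing = record
        { +-isAbelianGroup = record
          { isGroup = record
            { isMonoid = record
              { isSemigroup = record
                { isMagma = record
                  { isEquivalence = record
                    { refl  = ℝ.refl , ℝ.refl
                    ; sym   = λ (p , q) → ℝ.sym p , ℝ.sym q
                    ; trans = λ (p , q) (p′ , q′) → ℝ.trans p p′ , ℝ.trans q q′
                    }
                  ; ∙-cong = λ (p , q) (p′ , q′) → ℝ.+-cong p p′ , ℝ.+-cong q q′
                  }
                ; assoc = λ x y z → R.+-assoc (re x) (re y) (re z) , R.+-assoc (im x) (im y) (im z)
                }
              ; identity = (λ x → ℝ.+-identityˡ (re x) , ℝ.+-identityˡ (im x)) ,
                           (λ x → ℝ.+-identityʳ (re x) , ℝ.+-identityʳ (im x))
              }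
            ; inverse = (λ x → R.-‿inverseˡ (re x) , R.-‿inverseˡ (im x)) ,
                        (λ x → R.-‿inverseʳ (re x) , R.-‿inverseʳ (im x))
            ; ⁻¹-cong = λ (p , q) → ℝ.-‿cong p , ℝ.-‿cong q
            }
          ; comm = λ x y → ℝ.+-comm (re x) (re y) , ℝ.+-comm (im x) (im y)
          }
        ; *-cong = λ (p , q) (p′ , q′) →
            ℝ.+-cong (ℝ.*-cong p p′) (ℝ.-‿cong (ℝ.*-cong q q′)) , ℝ.+-cong (ℝ.*-cong p q′) (ℝ.*-cong q p′)
        ; *-assoc = λ (a +𝕚 b) (c +𝕚 d) (e +𝕚 f) →
            solve 6 (λ a b c d e f → (a :* c :- b :* d) :* e :- (a :* d :+ b :* c) :* f
                                  := a :* (c :* e :- d :* f) :- b :* (c :* f :+ d :* e)) ℝ.refl a b c d e f ,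
            solve 6 (λ a b c d e f → (a :* c :- b :* d) :* f :+ (a :* d :+ b :* c) :* e
                                  := a :* (c :* f :+ d :* e) :+ b :* (c :* e :- d :* f)) ℝ.refl a b c d e f
        ; *-identity =
            (λ (a +𝕚 b) → solve 2 (λ a b → con (+ 1) :* a :- con (+ 0) :* b := a) ℝ.refl a b ,
                          solve 2 (λ a b → con (+ 1) :* b :+ con (+ 0) :* a := b) ℝ.refl a b) ,
            (λ (a +𝕚 b) → solve 2 (λ a b → a :* con (+ 1) :- b :* con (+ 0) := a) ℝ.refl a b ,
                          solve 2 (λ a b → a :* con (+ 0) :+ b :* con (+ 1) := b) ℝ.refl a b)
        ; distrib =
            (λ (a +𝕚 b) (c +𝕚 d) (e +𝕚 f) →
              solve 6 (λ a b c d e f → a :* (c :+ e) :- b :* (d :+ f) := (a :* c :- b :* d) :+ (a :* e :- b :* f)) ℝ.refl a b c d e f ,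
              solve 6 (λ a b c d e f → a :* (d :+ f) :+ b :* (c :+ e) := (a :* d :+ b :* c) :+ (a :* f :+ b :* e)) ℝ.refl a b c d e f) ,
            (λ (a +𝕚 b) (c +𝕚 d) (e +𝕚 f) →
              solve 6 (λ a b c d e f → (c :+ e) :* a :- (d :+ f) :* b := (c :* a :- d :* b) :+ (e :* a :- f :* b)) ℝ.refl a b c d e f ,
              solve 6 (λ a b c d e f → (c :+ e) :* b :+ (d :+ f) :* a := (c :* b :+ d :* a) :+ (e :* b :+ f :* a)) ℝ.refl a b c d e f)
        }
      ; *-comm = λ (a +𝕚 b) (c +𝕚 d) →
          solve 4 (λ a b c d → a :* c :- b :* d := c :* a :- d :* b) ℝ.refl a b c d ,
          solve 4 (λ a b c d → a :* d :+ b :* c := c :* b :+ d :* a) ℝ.refl a b c d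
      }
    }
    where
    module R = CommutativeRing ℝ.commutativeRing
    open ℝ using (solve; con; _:+_; _:*_; _:-_; _:=_)

-- The modulus of a complex number

module Modulus (em : ExcludedMiddle 0ℓ) (R : CompleteOrderedField) where

  open ComplexNumbers em R
  open Analysis em R using (_≈_; _,_)
  open ℝ using (solve; con; _:+_; _:*_; _:-_; :-_; _:=_)
  open ℝ.≤-Reasoning

  -- A witness rules out the default branch. Every property of a quantity defined by `the` is
  -- obtained through this lemma from an existence proof.
  the-satisfies : ∀ {A : Set} (default : A) (P : A → Set) → ∃ P → P (the default P)
  the-satisfies default P (x , Px) with em {∃ P}
  ... | yes (_ , Py) = Py
  ... | no  ¬∃       = ⊥-elim (¬∃ (x , Px))

  √-satisfies : ∀ {x} → ℝ.0# ℝ.≤ x → ℝ.0# ℝ.≤ √ x × √ x ℝ.* √ x ℝ.≈ x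
  √-satisfies {x} 0≤x = the-satisfies ℝ.0# (λ y → ℝ.0# ℝ.≤ y × y ℝ.* y ℝ.≈ x) (ℝ.sqrt-exists x 0≤x)

  -- Polynomial in the two parts, hence within reach of the ring solver; statements about the
  -- modulus are reduced to it by squaring.
  ∣_∣² : ℂ → ℝ
  ∣ z ∣² = re z ℝ.* re z ℝ.+ im z ℝ.* im z

  0≤∣z∣² : ∀ z → ℝ.0# ℝ.≤ ∣ z ∣²
  0≤∣z∣² z = ℝ.+-nonNegative (ℝ.square-nonNegative (re z)) (ℝ.square-nonNegative (im z))

  0≤∣z∣ : ∀ z → ℝ.0# ℝ.≤ ∣ z ∣
  0≤∣z∣ z = proj₁ (√-satisfies (0≤∣z∣² z))

  ∣z∣*∣z∣ : ∀ z → ∣ z ∣ ℝ.* ∣ z ∣ ℝ.≈ ∣ z ∣²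
  ∣z∣*∣z∣ z = proj₂ (√-satisfies (0≤∣z∣² z))

  ∣∣²-cong : ∀ {z w} → z ≈ w → ∣ z ∣² ℝ.≈ ∣ w ∣²
  ∣∣²-cong (p , q) = ℝ.+-cong (ℝ.*-cong p p) (ℝ.*-cong q q)

  ∣∣-unique : ∀ {z r} → ℝ.0# ℝ.≤ r → r ℝ.* r ℝ.≈ ∣ z ∣² → ∣ z ∣ ℝ.≈ r
  ∣∣-unique {z} 0≤r rr≈ = ℝ.square-injective (0≤∣z∣ z) 0≤r (ℝ.trans (∣z∣*∣z∣ z) (ℝ.sym rr≈))

  ∣∣-cong : ∀ {z w} → z ≈ w → ∣ z ∣ ℝ.≈ ∣ w ∣
  ∣∣-cong {z} {w} z≈w = ∣∣-unique (0≤∣z∣ w) (ℝ.trans (∣z∣*∣z∣ w) (∣∣²-cong (ℝ.sym (_≈_.re-≈ z≈w) , ℝ.sym (_≈_.im-≈ z≈w))))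

  ∣∣²-* : ∀ z w → ∣ z * w ∣² ℝ.≈ ∣ z ∣² ℝ.* ∣ w ∣²
  ∣∣²-* (a +𝕚 b) (c +𝕚 d) = solve 4 (λ a b c d →
    (a :* c :- b :* d) :* (a :* c :- b :* d) :+ (a :* d :+ b :* c) :* (a :* d :+ b :* c)
    := (a :* a :+ b :* b) :* (c :* c :+ d :* d)) ℝ.refl a b c d

  ∣∣-* : ∀ z w → ∣ z * w ∣ ℝ.≈ ∣ z ∣ ℝ.* ∣ w ∣
  ∣∣-* z w = ∣∣-unique (ℝ.*-nonNegative (0≤∣z∣ z) (0≤∣z∣ w)) (begin-equality
    ∣ z ∣ ℝ.* ∣ w ∣ ℝ.* (∣ z ∣ ℝ.* ∣ w ∣)       ≈⟨ solve 2 (λ z w → z :* w :* (z :* w) := z :* z :* (w :* w)) ℝ.refl ∣ z ∣ ∣ w ∣ ⟩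
    ∣ z ∣ ℝ.* ∣ z ∣ ℝ.* (∣ w ∣ ℝ.* ∣ w ∣)       ≈⟨ ℝ.*-cong (∣z∣*∣z∣ z) (∣z∣*∣z∣ w) ⟩
    ∣ z ∣² ℝ.* ∣ w ∣²                           ≈⟨ ∣∣²-* z w ⟨
    ∣ z * w ∣²                                  ∎)

  ∣∣-triangle : ∀ z w → ∣ z + w ∣ ℝ.≤ ∣ z ∣ ℝ.+ ∣ w ∣
  ∣∣-triangle z@(a +𝕚 b) w@(c +𝕚 d) = ℝ.square-cancel-≤ (ℝ.+-nonNegative (0≤∣z∣ z) (0≤∣z∣ w)) (begin
    ∣ z + w ∣ ℝ.* ∣ z + w ∣                     ≈⟨ ∣z∣*∣z∣ (z + w) ⟩
    ∣ z + w ∣²                                  ≈⟨ solve 4 (λ a b c d → (a :+ c) :* (a :+ c) :+ (b :+ d) :* (b :+ d)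
                                                     := (a :* a :+ b :* b) :+ (c :* c :+ d :* d) :+ (a :* c :+ b :* d :+ (a :* c :+ b :* d))) ℝ.refl a b c d ⟩
    ∣ z ∣² ℝ.+ ∣ w ∣² ℝ.+ (p ℝ.+ p)             ≤⟨ ℝ.+-mono-≤ (ℝ.≤-reflexive (ℝ.sym (ℝ.+-cong (∣z∣*∣z∣ z) (∣z∣*∣z∣ w)))) (ℝ.+-mono-≤ p≤ p≤) ⟩
    Z ℝ.* Z ℝ.+ W ℝ.* W ℝ.+ (Z ℝ.* W ℝ.+ Z ℝ.* W)   ≈⟨ solve 2 (λ z w → z :* z :+ w :* w :+ (z :* w :+ z :* w) := (z :+ w) :* (z :+ w)) ℝ.refl Z W ⟩
    (Z ℝ.+ W) ℝ.* (Z ℝ.+ W)                     ∎)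
    where
    Z = ∣ z ∣
    W = ∣ w ∣
    p = a ℝ.* c ℝ.+ b ℝ.* d
    p≤ : p ℝ.≤ Z ℝ.* W
    -- Cauchy-Schwarz in the plane by Lagrange's identity: the two squares differ by (ad - bc)².
    p≤ = ℝ.square-cancel-≤ (ℝ.*-nonNegative (0≤∣z∣ z) (0≤∣z∣ w)) (begin
      p ℝ.* p                                   ≤⟨ ℝ.≤-via ((a ℝ.* d ℝ.- b ℝ.* c) ℝ.* (a ℝ.* d ℝ.- b ℝ.* c)) (ℝ.square-nonNegative _)
                                                     (solve 4 (λ a b c d → (a :* c :+ b :* d) :* (a :* c :+ b :* d) :+ (a :* d :- b :* c) :* (a :* d :- b :* c)
                                                       := (a :* a :+ b :* b) :* (c :* c :+ d :* d)) ℝ.refl a b c d) ⟩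
      ∣ z ∣² ℝ.* ∣ w ∣²                         ≈⟨ ℝ.*-cong (∣z∣*∣z∣ z) (∣z∣*∣z∣ w) ⟨
      Z ℝ.* Z ℝ.* (W ℝ.* W)                     ≈⟨ solve 2 (λ z w → z :* z :* (w :* w) := z :* w :* (z :* w)) ℝ.refl Z W ⟩
      Z ℝ.* W ℝ.* (Z ℝ.* W)                     ∎)

  ∣conj∣ : ∀ z → ∣ conj z ∣ ℝ.≈ ∣ z ∣
  ∣conj∣ z = ∣∣-unique (0≤∣z∣ z) (ℝ.trans (∣z∣*∣z∣ z)
    (solve 2 (λ a b → a :* a :+ b :* b := a :* a :+ :- b :* :- b) ℝ.refl (re z) (im z)))

  ∣neg∣ : ∀ z → ∣ neg z ∣ ℝ.≈ ∣ z ∣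
  ∣neg∣ z = ∣∣-unique (0≤∣z∣ z) (ℝ.trans (∣z∣*∣z∣ z)
    (solve 2 (λ a b → a :* a :+ b :* b := :- a :* :- a :+ :- b :* :- b) ℝ.refl (re z) (im z)))

  ∣ofReal∣ : ∀ {x} → ℝ.0# ℝ.≤ x → ∣ ofReal x ∣ ℝ.≈ x
  ∣ofReal∣ {x} 0≤x = ∣∣-unique 0≤x (solve 1 (λ x → x :* x := x :* x :+ con (+ 0) :* con (+ 0)) ℝ.refl x)

  ∣∣²≈0⇒≈0 : ∀ {z} → ∣ z ∣² ℝ.≈ ℝ.0# → z ≈ 0ᶜ
  ∣∣²≈0⇒≈0 {z} eq = ℝ.square≈0 (ℝ.x+y≈0⇒x≈0 (ℝ.square-nonNegative (re z)) (ℝ.square-nonNegative (im z)) eq)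
                  , ℝ.square≈0 (ℝ.x+y≈0⇒x≈0 (ℝ.square-nonNegative (im z)) (ℝ.square-nonNegative (re z)) (ℝ.trans (ℝ.+-comm _ _) eq))

  ∣∣≈0⇒≈0 : ∀ {z} → ∣ z ∣ ℝ.≈ ℝ.0# → z ≈ 0ᶜ
  ∣∣≈0⇒≈0 {z} eq = ∣∣²≈0⇒≈0 (ℝ.trans (ℝ.sym (∣z∣*∣z∣ z)) (ℝ.trans (ℝ.*-congʳ eq) (ℝ.zeroˡ _)))

  Within : ℝ → ℝ → Set
  Within b x = ℝ.- b ℝ.≤ x × x ℝ.≤ b

  within-square : ∀ {b x} → ℝ.0# ℝ.≤ b → x ℝ.* x ℝ.≤ b ℝ.* b → Within b x
  within-square {b} {x} 0≤b xx≤bb =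
    ℝ.≤-respʳ-≈ (solve 1 (λ x → :- (:- x) := x) ℝ.refl x)
      (ℝ.-‿anti-≤ (ℝ.square-cancel-≤ 0≤b (ℝ.≤-respˡ-≈ (solve 1 (λ x → x :* x := :- x :* :- x) ℝ.refl x) xx≤bb)))
    , ℝ.square-cancel-≤ 0≤b xx≤bb

  square-within : ∀ {b x} → Within b x → x ℝ.* x ℝ.≤ b ℝ.* b
  square-within {b} {x} (-b≤x , x≤b) = ℝ.≤-via ((x ℝ.- ℝ.- b) ℝ.* (b ℝ.- x))
    (ℝ.*-nonNegative (ℝ.x≤y⇒0≤y-x -b≤x) (ℝ.x≤y⇒0≤y-x x≤b))
    (solve 2 (λ x b → x :* x :+ (x :- (:- b)) :* (b :- x) := b :* b) ℝ.refl x b)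

  re-within : ∀ z → Within ∣ z ∣ (re z)
  re-within z = within-square (0≤∣z∣ z) (ℝ.≤-via (im z ℝ.* im z) (ℝ.square-nonNegative (im z)) (ℝ.sym (∣z∣*∣z∣ z)))

  im-within : ∀ z → Within ∣ z ∣ (im z)
  im-within z = within-square (0≤∣z∣ z) (ℝ.≤-via (re z ℝ.* re z) (ℝ.square-nonNegative (re z)) (ℝ.trans (ℝ.+-comm _ _) (ℝ.sym (∣z∣*∣z∣ z))))

  -- The sharp factor √2 is relaxed to 2, which keeps the bound rational. This is the origin of the
  -- factor `two` in the truncation bounds for `exp`.
  within⇒∣∣≤ : ∀ {b z} → ℝ.0# ℝ.≤ b → Within b (re z) → Within b (im z) → ∣ z ∣ ℝ.≤ b ℝ.+ b
  within⇒∣∣≤ {b} {z} 0≤b re≤ im≤ = ℝ.square-cancel-≤ (ℝ.+-nonNegative 0≤b 0≤b) (begin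
    ∣ z ∣ ℝ.* ∣ z ∣           ≈⟨ ∣z∣*∣z∣ z ⟩
    ∣ z ∣²                    ≤⟨ ℝ.+-mono-≤ (square-within re≤) (square-within im≤) ⟩
    b ℝ.* b ℝ.+ b ℝ.* b       ≤⟨ ℝ.≤-via (b ℝ.* b ℝ.+ b ℝ.* b) (ℝ.+-nonNegative (ℝ.*-nonNegative 0≤b 0≤b) (ℝ.*-nonNegative 0≤b 0≤b))
                                   (solve 1 (λ b → b :* b :+ b :* b :+ (b :* b :+ b :* b) := (b :+ b) :* (b :+ b)) ℝ.refl b) ⟩
    (b ℝ.+ b) ℝ.* (b ℝ.+ b)   ∎)

-- Convergence of complex sequences

module Limits (em : ExcludedMiddle 0ℓ) (R : CompleteOrderedField) where

  open ComplexNumbers em R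
  open Modulus em R
  open CommutativeRing ℂ-commutativeRing using (_≈_; refl; sym; trans; +-cong)
  open IntegerCoefficients ℂ-commutativeRing
  open ℝ using (two; 0≤two)
  open ℝ.≤-Reasoning

  shrink : ∀ K {ε} → ℝ.0# ℝ.≤ K → ℝ.0# ℝ.< ε → ∃[ ε′ ] ℝ.0# ℝ.< ε′ × K ℝ.* ε′ ℝ.< ε
  shrink K {ε} 0≤K 0<ε = ε′ , 0<ε′ , ℝ.<-via ε′ 0<ε′ (begin-equality
    K ℝ.* ε′ ℝ.+ ε′                       ≈⟨ ℝ.solve 2 (λ K e → K ℝ.:* e ℝ.:+ e ℝ.:= (K ℝ.:+ ℝ.con (+ 1)) ℝ.:* e) ℝ.refl K ε′ ⟩
    (K ℝ.+ ℝ.1#) ℝ.* ε′                   ≈⟨ ℝ.*-assoc _ _ _ ⟨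
    (K ℝ.+ ℝ.1#) ℝ.* (K ℝ.+ ℝ.1#) ℝ.⁻¹ ℝ.* ε   ≈⟨ ℝ.trans (ℝ.*-congʳ (ℝ.⁻¹-inverseʳ (ℝ.0<⇒≉0 0<K+1))) (ℝ.*-identityˡ ε) ⟩
    ε                                     ∎)
    where
    0<K+1 : ℝ.0# ℝ.< K ℝ.+ ℝ.1#
    0<K+1 = ℝ.≤-<-trans 0≤K (ℝ.<-via ℝ.1# ℝ.0<1 ℝ.refl)
    -- Dividing by K + 1 covers K = 0 and leaves the margin ε′ that makes the inequality strict.
    ε′ = (K ℝ.+ ℝ.1#) ℝ.⁻¹ ℝ.* ε
    0<ε′ = ℝ.0<x*y (ℝ.0<x⇒0<x⁻¹ 0<K+1) 0<ε

  arbitrarily-small⇒≈0 : ∀ K {x} → ℝ.0# ℝ.≤ K → ℝ.0# ℝ.≤ x → (∀ ε → ℝ.0# ℝ.< ε → x ℝ.≤ K ℝ.* ε) → x ℝ.≈ ℝ.0#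
  arbitrarily-small⇒≈0 K {x} 0≤K 0≤x small = case em
    where
    case : Dec (x ℝ.≈ ℝ.0#) → x ℝ.≈ ℝ.0#
    case (yes x≈0) = x≈0
    case (no x≉0) = let (ε , 0<ε , Kε<x) = shrink K 0≤K (0≤x , λ 0≈x → x≉0 (ℝ.sym 0≈x)) in
      ⊥-elim (ℝ.<⇒≱ Kε<x (small ε 0<ε))

  -- Absorbs constant factors, and weak inequalities in place of strict ones, so that later
  -- estimates need not divide ε in advance.
  conv-scaled : ∀ {s l} K → ℝ.0# ℝ.≤ K →
    (∀ ε → ℝ.0# ℝ.< ε → ∃[ N ] (∀ m → N ℕ.≤ m → ∣ s m - l ∣ ℝ.≤ K ℝ.* ε)) → ConvergesTo s l
  conv-scaled K 0≤K bound ε 0<ε =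
    let (ε′ , 0<ε′ , Kε′<ε) = shrink K 0≤K 0<ε ; (N , below) = bound ε′ 0<ε′ in
    N , λ m N≤m → ℝ.≤-<-trans (below m N≤m) Kε′<ε

  conv-cong : ∀ {s t l m} → (∀ k → s k ≈ t k) → l ≈ m → ConvergesTo s l → ConvergesTo t m
  conv-cong {s} {t} {l} {m} s≈t l≈m s→l ε 0<ε = let (N , below) = s→l ε 0<ε in
    N , λ k N≤k → ℝ.≤-<-trans (ℝ.≤-reflexive (∣∣-cong (+-cong (sym (s≈t k)) (-‿cong (sym l≈m))))) (below k N≤k)
    where open CommutativeRing ℂ-commutativeRing using (-‿cong)

  conv-unique : ∀ {s l m} → ConvergesTo s l → ConvergesTo s m → l ≈ m
  conv-unique {s} {l} {m} s→l s→m =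
    trans (solve 2 (λ l m → l := (l :- m) :+ m) refl l m) (trans (+-cong (∣∣≈0⇒≈0 ∣l-m∣≈0) refl) (solve 1 (λ m → con (+ 0) :+ m := m) refl m))
    where
    ∣l-m∣≈0 : ∣ l - m ∣ ℝ.≈ ℝ.0#
    ∣l-m∣≈0 = arbitrarily-small⇒≈0 two 0≤two (0≤∣z∣ (l - m)) λ ε 0<ε →
      let (N , belowˡ) = s→l ε 0<ε ; (N′ , belowᵐ) = s→m ε 0<ε ; k = N ℕ.+ N′ in begin
      ∣ l - m ∣                             ≈⟨ ∣∣-cong (solve 3 (λ l m s → l :- m := (:- (s :- l)) :+ (s :- m)) refl l m (s k)) ⟩
      ∣ neg (s k - l) + (s k - m) ∣         ≤⟨ ∣∣-triangle (neg (s k - l)) (s k - m) ⟩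
      ∣ neg (s k - l) ∣ ℝ.+ ∣ s k - m ∣     ≈⟨ ℝ.+-congʳ (∣neg∣ (s k - l)) ⟩
      ∣ s k - l ∣ ℝ.+ ∣ s k - m ∣           ≤⟨ ℝ.+-mono-≤ (proj₁ (belowˡ k (ℕ.m≤m+n N N′))) (proj₁ (belowᵐ k (ℕ.m≤n+m N′ N))) ⟩
      ε ℝ.+ ε                               ≈⟨ ℝ.solve 1 (λ e → e ℝ.:+ e ℝ.:= (ℝ.con (+ 1) ℝ.:+ ℝ.con (+ 1)) ℝ.:* e) ℝ.refl ε ⟩
      two ℝ.* ε                             ∎

  conv-const : ∀ c → ConvergesTo (λ _ → c) c
  conv-const c ε 0<ε = 0 , λ m _ → ℝ.≤-<-trans (ℝ.≤-reflexive (ℝ.trans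
    (∣∣-cong (solve 1 (λ c → c :- c := con (+ 0)) refl c)) (∣ofReal∣ ℝ.≤-refl))) 0<ε

  conv-+ : ∀ {s t l m} → ConvergesTo s l → ConvergesTo t m → ConvergesTo (λ k → s k + t k) (l + m)
  conv-+ {s} {t} {l} {m} s→l t→m = conv-scaled two 0≤two λ ε 0<ε →
    let (N , belowˡ) = s→l ε 0<ε ; (N′ , belowᵐ) = t→m ε 0<ε in
    N ℕ.+ N′ , λ k N+N′≤k → begin
      ∣ (s k + t k) - (l + m) ∣             ≈⟨ ∣∣-cong (solve 4 (λ s t l m → (s :+ t) :- (l :+ m) := (s :- l) :+ (t :- m)) refl (s k) (t k) l m) ⟩
      ∣ (s k - l) + (t k - m) ∣             ≤⟨ ∣∣-triangle (s k - l) (t k - m) ⟩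
      ∣ s k - l ∣ ℝ.+ ∣ t k - m ∣           ≤⟨ ℝ.+-mono-≤ (proj₁ (belowˡ k (ℕ.≤-trans (ℕ.m≤m+n N N′) N+N′≤k)))
                                                          (proj₁ (belowᵐ k (ℕ.≤-trans (ℕ.m≤n+m N′ N) N+N′≤k))) ⟩
      ε ℝ.+ ε                               ≈⟨ ℝ.solve 1 (λ e → e ℝ.:+ e ℝ.:= (ℝ.con (+ 1) ℝ.:+ ℝ.con (+ 1)) ℝ.:* e) ℝ.refl ε ⟩
      two ℝ.* ε                             ∎

  conv-* : ∀ {s l} c → ConvergesTo s l → ConvergesTo (λ k → s k * c) (l * c)
  conv-* {s} {l} c s→l = conv-scaled ∣ c ∣ (0≤∣z∣ c) λ ε 0<ε →
    let (N , below) = s→l ε 0<ε in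
    N , λ k N≤k → begin
      ∣ s k * c - l * c ∣                   ≈⟨ ∣∣-cong (solve 3 (λ s l c → s :* c :- l :* c := c :* (s :- l)) refl (s k) l c) ⟩
      ∣ c * (s k - l) ∣                     ≈⟨ ∣∣-* c (s k - l) ⟩
      ∣ c ∣ ℝ.* ∣ s k - l ∣                 ≤⟨ ℝ.*-monoˡ-≤ ∣ c ∣ (0≤∣z∣ c) (proj₁ (below k N≤k)) ⟩
      ∣ c ∣ ℝ.* ε                           ∎

  open LinearAlgebra ℂ-commutativeRing using (sum)

  conv-sum : ∀ {n} (s : Fin n → ℕ → ℂ) l → (∀ i → ConvergesTo (s i) (l i)) → ConvergesTo (λ k → sum λ i → s i k) (sum l)
  conv-sum {zero}  s l s→l = conv-const 0ᶜ
  conv-sum {suc n} s l s→l = conv-+ (s→l zero) (conv-sum (λ i → s (suc i)) (λ i → l (suc i)) (λ i → s→l (suc i)))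

  conv-subsequence : ∀ {s l} (φ : ℕ → ℕ) → (∀ k → k ℕ.≤ φ k) → ConvergesTo s l → ConvergesTo (λ k → s (φ k)) l
  conv-subsequence φ k≤φk s→l ε 0<ε = let (N , below) = s→l ε 0<ε in
    N , λ k N≤k → below (φ k) (ℕ.≤-trans N≤k (k≤φk k))

  -- A known limit excludes the default value of `lim`; the selected value is then a limit too, and
  -- limits are unique.
  lim-≈ : ∀ {s l} → ConvergesTo s l → lim s ≈ l
  lim-≈ {s} {l} s→l = conv-unique {s} (the-satisfies 0ᶜ (ConvergesTo s) (l , s→l)) s→l

  -- For an antitone b, being small at one index means being small at all later ones.
  conv-squeeze : ∀ {s l} (b : ℕ → ℝ) → (∀ j N → b (j ℕ.+ N) ℝ.≤ b N) → (∀ ε → ℝ.0# ℝ.< ε → ∃[ N ] b N ℝ.≤ ε) →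
                 ∀ K → ℝ.0# ℝ.≤ K → (∀ N → ∣ s N - l ∣ ℝ.≤ K ℝ.* b N) → ConvergesTo s l
  conv-squeeze {s} {l} b b-antitone b→0 K 0≤K bound = conv-scaled K 0≤K λ ε 0<ε → let (N , bN≤ε) = b→0 ε 0<ε in
    N , λ m N≤m → ℝ.≤-trans (bound m) (ℝ.*-monoˡ-≤ K 0≤K
      (ℝ.≤-trans (≡.subst (λ k → b k ℝ.≤ b N) (ℕ.m∸n+n≡m N≤m) (b-antitone (m ℕ.∸ N) N)) bN≤ε))

  -- The limit is the supremum of the lower estimates s M - b M. Each of them lies below every upper
  -- estimate s N + b N, as comparison with the common term of index M + N shows, so the supremum is
  -- within b N of s N.
  cauchy-limit : (s b : ℕ → ℝ) → (∀ j N → Within (b N) (s (j ℕ.+ N) ℝ.- s N)) →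
                 ∃[ l ] (∀ N → Within (b N) (s N ℝ.- l))
  cauchy-limit s b cauchy = l , λ N →
      ℝ.0≤y-x⇒x≤y (ℝ.≤-respʳ-≈ (ℝ.solve 3 (λ s b l → (s ℝ.:+ b) ℝ.:- l ℝ.:= (s ℝ.:- l) ℝ.:- (ℝ.:- b)) ℝ.refl (s N) (b N) l)
        (ℝ.x≤y⇒0≤y-x (l-least (s N ℝ.+ b N) (λ x (M , x≈) → ℝ.≤-respˡ-≈ (ℝ.sym x≈) (crossing M N)))))
    , ℝ.0≤y-x⇒x≤y (ℝ.≤-respʳ-≈ (ℝ.solve 3 (λ s b l → l ℝ.:- (s ℝ.:- b) ℝ.:= b ℝ.:- (s ℝ.:- l)) ℝ.refl (s N) (b N) l)
        (ℝ.x≤y⇒0≤y-x (l-upper (s N ℝ.- b N) (N , ℝ.refl))))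
    where
    crossing : ∀ M N → s M ℝ.- b M ℝ.≤ s N ℝ.+ b N
    crossing M N = begin
      s M ℝ.- b M           ≤⟨ ℝ.≤-via _ (ℝ.x≤y⇒0≤y-x (proj₁ (cauchy N M)))
                                 (ℝ.solve 3 (λ s b t → (s ℝ.:- b) ℝ.:+ ((t ℝ.:- s) ℝ.:- (ℝ.:- b)) ℝ.:= t) ℝ.refl (s M) (b M) (s (N ℕ.+ M))) ⟩
      s (N ℕ.+ M)           ≡⟨ ≡.cong s (ℕ.+-comm N M) ⟩
      s (M ℕ.+ N)           ≤⟨ ℝ.≤-via _ (ℝ.x≤y⇒0≤y-x (proj₂ (cauchy M N)))
                                 (ℝ.solve 3 (λ s b t → t ℝ.:+ (b ℝ.:- (t ℝ.:- s)) ℝ.:= s ℝ.:+ b) ℝ.refl (s N) (b N) (s (M ℕ.+ N))) ⟩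
      s N ℝ.+ b N           ∎
    sup = ℝ.supremum (λ x → ∃[ M ] x ℝ.≈ s M ℝ.- b M) (_ , 0 , ℝ.refl)
            (s 0 ℝ.+ b 0 , λ x (M , x≈) → ℝ.≤-respˡ-≈ (ℝ.sym x≈) (crossing M 0))
    l = proj₁ sup
    l-upper = proj₁ (proj₂ sup)
    l-least = proj₂ (proj₂ sup)

  -- Besides convergence the explicit rate is kept, since Mertens' estimate requires a bound for
  -- each truncation error.
  conv-cauchy : (s : ℕ → ℂ) (b : ℕ → ℝ) → (∀ j N → b (j ℕ.+ N) ℝ.≤ b N) → (∀ ε → ℝ.0# ℝ.< ε → ∃[ N ] b N ℝ.≤ ε) →
                (∀ j N → ∣ s (j ℕ.+ N) - s N ∣ ℝ.≤ b N) → ∃[ l ] ConvergesTo s l × (∀ N → ∣ s N - l ∣ ℝ.≤ two ℝ.* b N)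
  conv-cauchy s b b-antitone b→0 cauchy = l , conv-squeeze b b-antitone b→0 two 0≤two close , close
    where
    widen : ∀ {b c x} → b ℝ.≤ c → Within b x → Within c x
    widen b≤c (lower , upper) = ℝ.≤-trans (ℝ.-‿anti-≤ b≤c) lower , ℝ.≤-trans upper b≤c
    re-limit = cauchy-limit (λ N → re (s N)) b (λ j N → widen (cauchy j N) (re-within (s (j ℕ.+ N) - s N)))
    im-limit = cauchy-limit (λ N → im (s N)) b (λ j N → widen (cauchy j N) (im-within (s (j ℕ.+ N) - s N)))
    l = proj₁ re-limit +𝕚 proj₁ im-limit
    close : ∀ N → ∣ s N - l ∣ ℝ.≤ two ℝ.* b N
    close N = ℝ.≤-respʳ-≈ (ℝ.solve 1 (λ b → b ℝ.:+ b ℝ.:= (ℝ.con (+ 1) ℝ.:+ ℝ.con (+ 1)) ℝ.:* b) ℝ.refl (b N))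
      (within⇒∣∣≤ (ℝ.≤-trans (0≤∣z∣ (s (0 ℕ.+ N) - s N)) (cauchy 0 N)) (proj₂ re-limit N) (proj₂ im-limit N))

-- The exponential series

module Series (K : CommutativeRing 0ℓ 0ℓ) where

  open CommutativeRing K hiding (zero)
  open import Algebra.Properties.Semiring.Sum semiring using (sum)

  -- Written with `sum` over `Fin` so as to unfold to the partial sums in the definition of `exp`.
  ∑< : ℕ → (ℕ → Carrier) → Carrier
  ∑< N f = sum {N} λ k → f (toℕ k)

  ∑<-split : ∀ m k f → ∑< (m ℕ.+ k) f ≈ ∑< m f + ∑< k (λ j → f (m ℕ.+ j))
  ∑<-split zero    k f = sym (+-identityˡ _)
  ∑<-split (suc m) k f = trans (+-congˡ (∑<-split m k (λ j → f (suc j)))) (sym (+-assoc _ _ _))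

  ∑<-last : ∀ N f → ∑< (suc N) f ≈ ∑< N f + f N
  ∑<-last zero    f = +-comm _ _
  ∑<-last (suc N) f = trans (+-congˡ (∑<-last N (λ j → f (suc j)))) (sym (+-assoc _ _ _))

-- Cauchy products

module Convolution (K : CommutativeRing 0ℓ 0ℓ) where

  open CommutativeRing K hiding (zero)
  open IntegerCoefficients K
  open Series K
  open import Relation.Binary.Reasoning.Setoid setoid

  tail : (ℕ → Carrier) → ℕ → Carrier
  tail e k = e (suc k)

  -- diagonal e f m = ∑ e j * f k over j + k = m, and triangle e f N is the same sum over j + k < N.
  diagonal triangle : (e f : ℕ → Carrier) → ℕ → Carrier
  diagonal e f zero    = e 0 * f 0
  diagonal e f (suc m) = e 0 * f (suc m) + diagonal (tail e) f m
  triangle e f zero    = 0#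
  triangle e f (suc N) = e 0 * ∑< (suc N) f + triangle (tail e) f N

  -- The triangle is defined row by row, each row being e j times a partial sum of f; this slices it
  -- by antidiagonals instead.
  triangle-last : ∀ N e f → triangle e f (suc N) ≈ triangle e f N + diagonal e f N
  triangle-last zero    e f = solve 2 (λ e f → e :* (f :+ con (+ 0)) :+ con (+ 0) := con (+ 0) :+ e :* f) refl (e 0) (f 0)
  triangle-last (suc N) e f = begin
    e 0 * ∑< (suc (suc N)) f + triangle (tail e) f (suc N)
      ≈⟨ +-cong (*-congˡ (∑<-last (suc N) f)) (triangle-last N (tail e) f) ⟩
    e 0 * (∑< (suc N) f + f (suc N)) + (triangle (tail e) f N + diagonal (tail e) f N)
      ≈⟨ solve 5 (λ e s f t d → e :* (s :+ f) :+ (t :+ d) := (e :* s :+ t) :+ (e :* f :+ d)) refl (e 0) (∑< (suc N) f) (f (suc N)) _ _ ⟩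
    triangle e f (suc N) + diagonal e f (suc N) ∎

  -- If e and f are the coefficients of exp z and exp (- z), the case w = 0 says that the
  -- diagonals after the first vanish; a shift of e by w indices leaves the boundary term on the right.
  diagonal-telescopes : ∀ (ν : ℕ → Carrier) z f → (∀ n → ν (suc n) ≈ 1# + ν n) → ν 0 ≈ 0# →
    (∀ k → ν (suc k) * f (suc k) ≈ - z * f k) →
    ∀ m e w → (∀ k → (ν (suc k) + w) * e (suc k) ≈ z * e k) →
    (ν (suc m) + w) * diagonal e f (suc m) ≈ w * (e 0 * f (suc m))
  diagonal-telescopes ν z f ν-suc ν-zero f-rec = go
    where
    cancel-z : ∀ e w f′ f → f′ ≈ - z * f → w + e * f′ + z * e * f ≈ w
    cancel-z e w f′ f f′≈ = trans (+-congʳ (+-congˡ (*-congˡ f′≈)))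
      (solve 4 (λ e w f z → w :+ e :* (:- z :* f) :+ z :* e :* f := w) refl e w f z)
    go : ∀ m e w → (∀ k → (ν (suc k) + w) * e (suc k) ≈ z * e k) →
         (ν (suc m) + w) * diagonal e f (suc m) ≈ w * (e 0 * f (suc m))
    go zero e w e-rec = begin
      (ν 1 + w) * (e 0 * f 1 + e 1 * f 0)
        ≈⟨ solve 6 (λ n w e f e′ f′ → (n :+ w) :* (e :* f′ :+ e′ :* f) := w :* (e :* f′) :+ e :* (n :* f′) :+ ((n :+ w) :* e′) :* f)
             refl (ν 1) w (e 0) (f 0) (e 1) (f 1) ⟩
      w * (e 0 * f 1) + e 0 * (ν 1 * f 1) + ((ν 1 + w) * e 1) * f 0
        ≈⟨ +-congˡ (*-congʳ (e-rec 0)) ⟩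
      w * (e 0 * f 1) + e 0 * (ν 1 * f 1) + z * e 0 * f 0
        ≈⟨ cancel-z (e 0) _ _ (f 0) (f-rec 0) ⟩
      w * (e 0 * f 1) ∎
    go (suc m) e w e-rec = begin
      (N + w) * (e 0 * F + D)
        ≈⟨ solve 5 (λ n w e f d → (n :+ w) :* (e :* f :+ d) := w :* (e :* f) :+ e :* (n :* f) :+ (n :+ w) :* d) refl N w (e 0) F D ⟩
      w * (e 0 * F) + e 0 * (N * F) + (N + w) * D
        ≈⟨ +-congˡ D≈ ⟩
      w * (e 0 * F) + e 0 * (N * F) + z * e 0 * f (suc m)
        ≈⟨ cancel-z (e 0) _ _ (f (suc m)) (f-rec (suc m)) ⟩
      w * (e 0 * F) ∎
      where
      N = ν (suc (suc m))
      F = f (suc (suc m))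
      D = diagonal (tail e) f (suc m)
      -- The tail of `e` obeys the same recursion with every index one higher, that is, with w
      -- replaced by 1 + w. This is why the induction needs arbitrary w.
      shift-weight : ∀ k → ν (suc k) + (1# + w) ≈ ν (suc (suc k)) + w
      shift-weight k = trans (solve 2 (λ n w → n :+ (con (+ 1) :+ w) := (con (+ 1) :+ n) :+ w) refl (ν (suc k)) w) (+-congʳ (sym (ν-suc (suc k))))
      D≈ : (N + w) * D ≈ z * e 0 * f (suc m)
      D≈ = begin
        (N + w) * D                           ≈⟨ *-congʳ (shift-weight m) ⟨
        (ν (suc m) + (1# + w)) * D            ≈⟨ go m (tail e) (1# + w) (λ k → trans (*-congʳ (shift-weight k)) (e-rec (suc k))) ⟩
        (1# + w) * (e 1 * f (suc m))          ≈⟨ *-assoc _ _ _ ⟨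
        -- Since ν 1 = 1, the recursion turns the boundary term of the tail into z * e 0 * f (suc
        -- m), which cancels the contribution of e 0 * F.
        (1# + w) * e 1 * f (suc m)            ≈⟨ *-congʳ (*-congʳ (+-congʳ (trans (ν-suc 0) (trans (+-congˡ ν-zero) (+-identityʳ 1#))))) ⟨
        (ν 1 + w) * e 1 * f (suc m)           ≈⟨ *-congʳ (e-rec 0) ⟩
        z * e 0 * f (suc m)                   ∎

module Exponential (em : ExcludedMiddle 0ℓ) (R : CompleteOrderedField) where

  open ComplexNumbers em R
  open Modulus em R
  open Limits em R
  open CommutativeRing ℂ-commutativeRing
    using ( _≈_; refl; sym; trans; +-cong; +-congˡ; +-congʳ; *-cong; *-congˡ; *-congʳ; -‿cong
          ; *-assoc; *-identityˡ; *-identityʳ; zeroʳ)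
  open Analysis em R using (_,_)
  open IntegerCoefficients ℂ-commutativeRing
  open Series ℂ-commutativeRing
  open Convolution ℂ-commutativeRing
  open ℝ using (two; 0≤two)
  open ℝ.≤-Reasoning
  open import Algebra.Properties.Semiring.Mult ℝ.semiring using (×1-homo-*)
  module ℝΣ = Series ℝ.commutativeRing

  ofReal-* : ∀ x y → ofReal (x ℝ.* y) ≈ ofReal x * ofReal y
  ofReal-* x y = ℝ.solve 2 (λ x y → x ℝ.:* y ℝ.:= x ℝ.:* y ℝ.:- ℝ.con (+ 0) ℝ.:* ℝ.con (+ 0)) ℝ.refl x y
               , ℝ.solve 2 (λ x y → ℝ.con (+ 0) ℝ.:= x ℝ.:* ℝ.con (+ 0) ℝ.:+ ℝ.con (+ 0) ℝ.:* y) ℝ.refl x y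

  ofReal-+ : ∀ x y → ofReal (x ℝ.+ y) ≈ ofReal x + ofReal y
  ofReal-+ x y = ℝ.refl , ℝ.sym (ℝ.+-identityˡ ℝ.0#)

  ofReal-cong : ∀ {x y} → x ℝ.≈ y → ofReal x ≈ ofReal y
  ofReal-cong x≈y = x≈y , ℝ.refl

  conj-cong : ∀ {z w} → z ≈ w → conj z ≈ conj w
  conj-cong (p , q) = p , ℝ.-‿cong q

  conj-+ : ∀ z w → conj (z + w) ≈ conj z + conj w
  conj-+ z w = ℝ.refl , ℝ.solve 2 (λ x y → ℝ.:- (x ℝ.:+ y) ℝ.:= ℝ.:- x ℝ.:+ ℝ.:- y) ℝ.refl (im z) (im w)

  conj-* : ∀ z w → conj (z * w) ≈ conj z * conj w
  conj-* z w = ℝ.solve 4 (λ a b c d → a ℝ.:* c ℝ.:- b ℝ.:* d ℝ.:= a ℝ.:* c ℝ.:- ℝ.:- b ℝ.:* ℝ.:- d) ℝ.refl (re z) (im z) (re w) (im w)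
             , ℝ.solve 4 (λ a b c d → ℝ.:- (a ℝ.:* d ℝ.:+ b ℝ.:* c) ℝ.:= a ℝ.:* ℝ.:- d ℝ.:+ ℝ.:- b ℝ.:* c) ℝ.refl (re z) (im z) (re w) (im w)

  conj-ofReal : ∀ x → conj (ofReal x) ≈ ofReal x
  conj-ofReal x = ℝ.refl , ℝ.solve 0 (ℝ.:- ℝ.con (+ 0) ℝ.:= ℝ.con (+ 0)) ℝ.refl

  conj-∑< : ∀ N f → conj (∑< N f) ≈ ∑< N (λ k → conj (f k))
  conj-∑< zero    f = conj-ofReal ℝ.0#
  conj-∑< (suc N) f = trans (conj-+ (f 0) _) (+-congˡ (conj-∑< N (λ k → f (suc k))))

  ∣∣²-conj : ∀ z → z * conj z ≈ ofReal ∣ z ∣²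
  ∣∣²-conj z = ℝ.solve 2 (λ a b → a ℝ.:* a ℝ.:- b ℝ.:* ℝ.:- b ℝ.:= a ℝ.:* a ℝ.:+ b ℝ.:* b) ℝ.refl (re z) (im z)
             , ℝ.solve 2 (λ a b → a ℝ.:* ℝ.:- b ℝ.:+ b ℝ.:* a ℝ.:= ℝ.con (+ 0)) ℝ.refl (re z) (im z)

  ν : ℕ → ℂ
  ν n = ofReal (ℝ.fromℕ n)

  fromℕ-! : ∀ k → ℝ.fromℕ (suc k !) ℝ.≈ ℝ.fromℕ (suc k) ℝ.* ℝ.fromℕ (k !)
  fromℕ-! k = ×1-homo-* (suc k) (k !)

  0<fromℕ-! : ∀ k → ℝ.0# ℝ.< ℝ.fromℕ (k !)
  0<fromℕ-! zero    = ℝ.fromℕ-positive 0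
  0<fromℕ-! (suc k) = ℝ.<-≤-trans (ℝ.0<x*y (ℝ.fromℕ-positive k) (0<fromℕ-! k)) (ℝ.≤-reflexive (ℝ.sym (fromℕ-! k)))

  ν-1/! : ∀ k → ν (suc k) * 1/ suc k ! ≈ 1/ k !
  ν-1/! k = trans (sym (ofReal-* _ _)) (ofReal-cong (ℝ.*-cancelˡ f≉0 (begin-equality
    f ℝ.* (g ℝ.* F ℝ.⁻¹)     ≈⟨ ℝ.solve 3 (λ f g h → f ℝ.:* (g ℝ.:* h) ℝ.:= g ℝ.:* f ℝ.:* h) ℝ.refl f g (F ℝ.⁻¹) ⟩
    g ℝ.* f ℝ.* F ℝ.⁻¹       ≈⟨ ℝ.*-congʳ (fromℕ-! k) ⟨
    F ℝ.* F ℝ.⁻¹             ≈⟨ ℝ.⁻¹-inverseʳ (ℝ.0<⇒≉0 (0<fromℕ-! (suc k))) ⟩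
    ℝ.1#                     ≈⟨ ℝ.⁻¹-inverseʳ f≉0 ⟨
    f ℝ.* f ℝ.⁻¹             ∎)))
    where
    f = ℝ.fromℕ (k !)
    g = ℝ.fromℕ (suc k)
    F = ℝ.fromℕ (suc k !)
    f≉0 = ℝ.0<⇒≉0 (0<fromℕ-! k)

  module _ (z : ℂ) where

    term : ℕ → ℂ
    term k = 1/ k ! * z ^ k

    -- The differential equation of t ↦ exp (t z), read on coefficients and free of division. Both
    -- the ratio estimate and the telescoping of the antidiagonals start from it.
    term-suc : ∀ k → ν (suc k) * term (suc k) ≈ z * term k
    term-suc k = trans (solve 4 (λ n f z p → n :* (f :* (z :* p)) := (n :* f) :* (z :* p)) refl (ν (suc k)) (1/ suc k !) z (z ^ k))
      (trans (*-congʳ (ν-1/! k)) (solve 3 (λ f z p → f :* (z :* p) := z :* (f :* p)) refl (1/ k !) z (z ^ k)))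

    term-zero : term 0 ≈ 1ᶜ
    -- `ℝ.fromℕ (0 !)` is `1# + 0#`, so its inverse has to be identified by cancellation.
    term-zero = trans (*-identityʳ _) (ofReal-cong (ℝ.*-cancelˡ (ℝ.0<⇒≉0 (ℝ.fromℕ-positive 0))
      (ℝ.trans (ℝ.⁻¹-inverseʳ (ℝ.0<⇒≉0 (ℝ.fromℕ-positive 0))) (ℝ.sym (ℝ.trans (ℝ.*-identityʳ _) (ℝ.+-identityʳ _))))))

    a : ℕ → ℝ
    a k = ∣ term k ∣

    a-suc : ∀ k → ℝ.fromℕ (suc k) ℝ.* a (suc k) ℝ.≈ ∣ z ∣ ℝ.* a k
    a-suc k = begin-equality
      ℝ.fromℕ (suc k) ℝ.* a (suc k)         ≈⟨ ℝ.*-congʳ (∣ofReal∣ (ℝ.fromℕ-nonNegative (suc k))) ⟨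
      ∣ ν (suc k) ∣ ℝ.* a (suc k)           ≈⟨ ∣∣-* (ν (suc k)) (term (suc k)) ⟨
      ∣ ν (suc k) * term (suc k) ∣          ≈⟨ ∣∣-cong (term-suc k) ⟩
      ∣ z * term k ∣                        ≈⟨ ∣∣-* z (term k) ⟩
      ∣ z ∣ ℝ.* a k                         ∎

    T : ℕ → ℝ
    T N = ℝΣ.∑< N a

    T-suc : ∀ N → T (suc N) ℝ.≈ T N ℝ.+ a N
    T-suc N = ℝΣ.∑<-last N a

    T-mono : ∀ j N → T N ℝ.≤ T (j ℕ.+ N)
    T-mono zero    N = ℝ.≤-refl
    T-mono (suc j) N = ℝ.≤-trans (T-mono j N) (ℝ.≤-via (a (j ℕ.+ N)) (0≤∣z∣ (term (j ℕ.+ N))) (ℝ.sym (T-suc (j ℕ.+ N))))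

    -- Beyond K ≥ 2|z| the terms at least halve, so T N + 2 a N is antitone.
    T-bounded : ∃[ B ] (∀ N → T N ℝ.≤ B)
    T-bounded = T K ℝ.+ two ℝ.* a K , λ N → begin
      T N                                              ≤⟨ T-mono K N ⟩
      T (K ℕ.+ N)                                      ≡⟨ ≡.cong T (ℕ.+-comm K N) ⟩
      T (N ℕ.+ K)                                      ≤⟨ ℝ.≤-via (two ℝ.* a (N ℕ.+ K)) (ℝ.*-nonNegative 0≤two (0≤∣z∣ (term (N ℕ.+ K)))) ℝ.refl ⟩
      T (N ℕ.+ K) ℝ.+ two ℝ.* a (N ℕ.+ K)              ≤⟨ antitone N ⟩
      T K ℝ.+ two ℝ.* a K                              ∎
      where
      K = proj₁ (ℝ.archimedean (two ℝ.* ∣ z ∣))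
      2∣z∣≤K = proj₂ (ℝ.archimedean (two ℝ.* ∣ z ∣))
      halves : ∀ j → two ℝ.* a (suc (j ℕ.+ K)) ℝ.≤ a (j ℕ.+ K)
      halves j = ℝ.*-cancelˡ-≤ (ℝ.fromℕ-positive (j ℕ.+ K)) (begin
        n ℝ.* (two ℝ.* a (suc (j ℕ.+ K)))              ≈⟨ ℝ.solve 3 (λ n t a → n ℝ.:* (t ℝ.:* a) ℝ.:= t ℝ.:* (n ℝ.:* a)) ℝ.refl n two (a (suc (j ℕ.+ K))) ⟩
        two ℝ.* (n ℝ.* a (suc (j ℕ.+ K)))              ≈⟨ ℝ.*-congˡ (a-suc (j ℕ.+ K)) ⟩
        two ℝ.* (∣ z ∣ ℝ.* a (j ℕ.+ K))                ≈⟨ ℝ.*-assoc _ _ _ ⟨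
        two ℝ.* ∣ z ∣ ℝ.* a (j ℕ.+ K)                  ≤⟨ ℝ.*-mono-≤ (ℝ.fromℕ-nonNegative (suc (j ℕ.+ K))) (0≤∣z∣ (term (j ℕ.+ K)))
                                                            (ℝ.≤-trans 2∣z∣≤K (ℝ.fromℕ-mono (suc j) K)) ℝ.≤-refl ⟩
        n ℝ.* a (j ℕ.+ K)                              ∎)
        where n = ℝ.fromℕ (suc (j ℕ.+ K))
      antitone : ∀ j → T (j ℕ.+ K) ℝ.+ two ℝ.* a (j ℕ.+ K) ℝ.≤ T K ℝ.+ two ℝ.* a K
      antitone zero    = ℝ.≤-refl
      antitone (suc j) = begin
        T (suc j ℕ.+ K) ℝ.+ two ℝ.* a (suc j ℕ.+ K)    ≤⟨ ℝ.+-mono-≤ (ℝ.≤-reflexive (T-suc (j ℕ.+ K))) (halves j) ⟩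
        T (j ℕ.+ K) ℝ.+ a (j ℕ.+ K) ℝ.+ a (j ℕ.+ K)    ≈⟨ ℝ.solve 2 (λ t a → t ℝ.:+ a ℝ.:+ a ℝ.:= t ℝ.:+ (ℝ.con (+ 1) ℝ.:+ ℝ.con (+ 1)) ℝ.:* a) ℝ.refl (T (j ℕ.+ K)) (a (j ℕ.+ K)) ⟩
        T (j ℕ.+ K) ℝ.+ two ℝ.* a (j ℕ.+ K)            ≤⟨ antitone j ⟩
        T K ℝ.+ two ℝ.* a K                            ∎

    private
      T-sup = ℝ.supremum (λ x → ∃[ N ] x ℝ.≈ T N) (T 0 , 0 , ℝ.refl)
        (proj₁ T-bounded , λ x (N , x≈) → ℝ.≤-respˡ-≈ (ℝ.sym x≈) (proj₂ T-bounded N))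

    S : ℝ
    S = proj₁ T-sup

    T≤S : ∀ N → T N ℝ.≤ S
    T≤S N = proj₁ (proj₂ T-sup) (T N) (N , ℝ.refl)

    0≤S : ℝ.0# ℝ.≤ S
    0≤S = T≤S 0

    -- The tail of the series of moduli, which dominates every truncation error of the exponential
    -- series.
    tailBound : ℕ → ℝ
    tailBound N = S ℝ.- T N

    tailBound-antitone : ∀ j N → tailBound (j ℕ.+ N) ℝ.≤ tailBound N
    tailBound-antitone j N = ℝ.+-mono-≤ ℝ.≤-refl (ℝ.-‿anti-≤ (T-mono j N))

    tailBound≤S : ∀ N → tailBound N ℝ.≤ S
    tailBound≤S N = ≡.subst (λ k → tailBound k ℝ.≤ S) (ℕ.+-identityʳ N)
      (ℝ.≤-trans (tailBound-antitone N 0) (ℝ.≤-reflexive (ℝ.solve 1 (λ s → s ℝ.:- ℝ.con (+ 0) ℝ.:= s) ℝ.refl S)))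

    0≤tailBound : ∀ N → ℝ.0# ℝ.≤ tailBound N
    0≤tailBound N = ℝ.x≤y⇒0≤y-x (T≤S N)

    -- If every tail exceeded ε, the smaller number S - ε would still bound all partial sums.
    tailBound→0 : ∀ ε → ℝ.0# ℝ.< ε → ∃[ N ] tailBound N ℝ.≤ ε
    tailBound→0 ε 0<ε = case em
      where
      case : Dec (∃[ N ] tailBound N ℝ.≤ ε) → ∃[ N ] tailBound N ℝ.≤ ε
      case (yes p) = p
      case (no ¬p) = ⊥-elim (ℝ.<⇒≱ (ℝ.<-via ε 0<ε (ℝ.solve 2 (λ s e → s ℝ.:- e ℝ.:+ e ℝ.:= s) ℝ.refl S ε))
        (proj₂ (proj₂ T-sup) (S ℝ.- ε) λ x (N , x≈) → ℝ.≤-respˡ-≈ (ℝ.sym x≈)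
          (ℝ.≤-via (tailBound N ℝ.- ε) (ℝ.x≤y⇒0≤y-x (proj₁ (ℝ.≰⇒> λ below → ¬p (N , below))))
            (ℝ.solve 3 (λ t s e → t ℝ.:+ (s ℝ.:- t ℝ.:- e) ℝ.:= s ℝ.:- e) ℝ.refl (T N) S ε))))

    partial : ℕ → ℂ
    partial N = ∑< N term

    partial-increment : ∀ j N → ∣ partial (j ℕ.+ N) - partial N ∣ ℝ.≤ T (j ℕ.+ N) ℝ.- T N
    partial-increment zero    N = ℝ.≤-reflexive (ℝ.trans (∣∣-cong (solve 1 (λ p → p :- p := con (+ 0)) refl (partial N)))
      (ℝ.trans (∣ofReal∣ ℝ.≤-refl) (ℝ.solve 1 (λ t → ℝ.con (+ 0) ℝ.:= t ℝ.:- t) ℝ.refl (T N))))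
    partial-increment (suc j) N = begin
      ∣ partial (suc k) - partial N ∣              ≈⟨ ∣∣-cong (trans (+-congʳ (∑<-last k term))
                                                        (solve 3 (λ p e q → (p :+ e) :- q := (p :- q) :+ e) refl (partial k) (term k) (partial N))) ⟩
      ∣ (partial k - partial N) + term k ∣         ≤⟨ ∣∣-triangle (partial k - partial N) (term k) ⟩
      ∣ partial k - partial N ∣ ℝ.+ a k            ≤⟨ ℝ.+-monoˡ-≤ (a k) (partial-increment j N) ⟩
      T k ℝ.- T N ℝ.+ a k                          ≈⟨ ℝ.solve 3 (λ t u a → t ℝ.:- u ℝ.:+ a ℝ.:= (t ℝ.:+ a) ℝ.:- u) ℝ.refl (T k) (T N) (a k) ⟩
      (T k ℝ.+ a k) ℝ.- T N                        ≈⟨ ℝ.+-congʳ (T-suc k) ⟨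
      T (suc k) ℝ.- T N                            ∎
      where k = j ℕ.+ N

    private
      partial-limit = conv-cauchy partial tailBound tailBound-antitone tailBound→0
        (λ j N → ℝ.≤-trans (partial-increment j N) (ℝ.+-monoˡ-≤ (ℝ.- T N) (T≤S (j ℕ.+ N))))

      limit≈exp : proj₁ partial-limit ≈ exp z
      limit≈exp = sym (lim-≈ (proj₁ (proj₂ partial-limit)))

    partial→exp : ConvergesTo partial (exp z)
    partial→exp = conv-cong (λ _ → refl) limit≈exp (proj₁ (proj₂ partial-limit))

    partial-close : ∀ N → ∣ partial N - exp z ∣ ℝ.≤ two ℝ.* tailBound N
    partial-close N = ℝ.≤-respˡ-≈ (∣∣-cong (+-congˡ (-‿cong limit≈exp))) (proj₂ (proj₂ partial-limit) N)

  -- The selection in `lim` need not respect pointwise equality of sequences, so the two values are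
  -- compared as limits.
  exp-cong : ∀ {z w} → z ≈ w → exp z ≈ exp w
  exp-cong {z} {w} z≈w = conv-unique (partial→exp z) (conv-cong (λ N → sum-cong-≋ {N} (λ k → *-congˡ (^-cong (toℕ k)))) refl (partial→exp w))
    where
    open LinearAlgebra ℂ-commutativeRing using (sum-cong-≋)
    ^-cong : ∀ k → w ^ k ≈ z ^ k
    ^-cong zero    = refl
    ^-cong (suc k) = *-cong (sym z≈w) (^-cong k)

  module Mertens (f : ℕ → ℂ) (Q : ℂ) (β : ℕ → ℝ) (B : ℝ) (Q-close : ∀ k → ∣ Q - ∑< k f ∣ ℝ.≤ β k)
                 (β-antitone : ∀ j k → β (j ℕ.+ k) ℝ.≤ β k) (β≤B : ∀ k → β k ℝ.≤ B) where

    -- error e N = ∑ e j * (Q - ∑< (N - j) f) over j < N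
    error : (ℕ → ℂ) → ℕ → ℂ
    error e N = ∑< N e * Q - triangle e f N

    ∣error∣-suc : ∀ e N {c} → β (suc N) ℝ.≤ c → ∣ error e (suc N) ∣ ℝ.≤ c ℝ.* ∣ e 0 ∣ ℝ.+ ∣ error (tail e) N ∣
    ∣error∣-suc e N {c} β≤c = begin
      ∣ error e (suc N) ∣
        ≈⟨ ∣∣-cong (solve 5 (λ e p Q q t → (e :+ p) :* Q :- (e :* q :+ t) := e :* (Q :- q) :+ (p :* Q :- t)) refl
             (e 0) (∑< N (tail e)) Q (∑< (suc N) f) (triangle (tail e) f N)) ⟩
      ∣ e 0 * (Q - ∑< (suc N) f) + error (tail e) N ∣
        ≤⟨ ∣∣-triangle (e 0 * (Q - ∑< (suc N) f)) (error (tail e) N) ⟩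
      ∣ e 0 * (Q - ∑< (suc N) f) ∣ ℝ.+ ∣ error (tail e) N ∣
        ≤⟨ ℝ.+-monoˡ-≤ _ (begin
             ∣ e 0 * (Q - ∑< (suc N) f) ∣            ≈⟨ ∣∣-* (e 0) (Q - ∑< (suc N) f) ⟩
             ∣ e 0 ∣ ℝ.* ∣ Q - ∑< (suc N) f ∣        ≤⟨ ℝ.*-monoˡ-≤ ∣ e 0 ∣ (0≤∣z∣ (e 0)) (ℝ.≤-trans (Q-close (suc N)) β≤c) ⟩
             ∣ e 0 ∣ ℝ.* c                           ≈⟨ ℝ.*-comm _ _ ⟩
             c ℝ.* ∣ e 0 ∣                           ∎) ⟩
      c ℝ.* ∣ e 0 ∣ ℝ.+ ∣ error (tail e) N ∣ ∎

    ∣error∣-crude : ∀ L e → ∣ error e L ∣ ℝ.≤ B ℝ.* ℝΣ.∑< L (λ k → ∣ e k ∣)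
    ∣error∣-crude zero    e = ℝ.≤-reflexive (ℝ.trans (∣∣-cong (solve 1 (λ Q → con (+ 0) :* Q :- con (+ 0) := con (+ 0)) refl Q))
      (ℝ.trans (∣ofReal∣ ℝ.≤-refl) (ℝ.sym (ℝ.zeroʳ B))))
    ∣error∣-crude (suc L) e = ℝ.≤-trans (∣error∣-suc e L (β≤B (suc L)))
      (ℝ.≤-respʳ-≈ (ℝ.solve 3 (λ B a s → B ℝ.:* a ℝ.:+ B ℝ.:* s ℝ.:= B ℝ.:* (a ℝ.:+ s)) ℝ.refl B ∣ e 0 ∣ _)
        (ℝ.+-mono-≤ ℝ.≤-refl (∣error∣-crude L (tail e))))

    -- Mertens' splitting. A row j < M pairs e j with a remainder of length M + L - j > L, at most β
    -- L in modulus; in the last L rows the remainder is only bounded by B, but there the moduli of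
    -- e add up to a tail.
    ∣error∣≤ : ∀ M L e → ∣ error e (M ℕ.+ L) ∣ ℝ.≤ β L ℝ.* ℝΣ.∑< M (λ k → ∣ e k ∣) ℝ.+ B ℝ.* ℝΣ.∑< L (λ k → ∣ e (M ℕ.+ k) ∣)
    ∣error∣≤ zero    L e = ℝ.≤-trans (∣error∣-crude L e) (ℝ.≤-reflexive (ℝ.solve 2 (λ b x → x ℝ.:= b ℝ.:* ℝ.con (+ 0) ℝ.:+ x) ℝ.refl (β L) _))
    ∣error∣≤ (suc M) L e = ℝ.≤-trans (∣error∣-suc e (M ℕ.+ L) (β-antitone (suc M) L))
      (ℝ.≤-respʳ-≈ (ℝ.solve 4 (λ b a s x → b ℝ.:* a ℝ.:+ (b ℝ.:* s ℝ.:+ x) ℝ.:= b ℝ.:* (a ℝ.:+ s) ℝ.:+ x) ℝ.refl (β L) ∣ e 0 ∣ _ _)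
        (ℝ.+-mono-≤ ℝ.≤-refl (∣error∣≤ M L (tail e))))

  ν-cancel : ∀ n {w} → ν (suc n) * w ≈ 0ᶜ → w ≈ 0ᶜ
  ν-cancel n {w} eq = trans (sym (*-identityˡ w)) (trans (*-congʳ (sym inverse)) (trans (*-assoc _ _ _) (trans (*-congˡ eq) (zeroʳ _))))
    where
    inverse : ofReal (ℝ.fromℕ (suc n) ℝ.⁻¹) * ν (suc n) ≈ 1ᶜ
    inverse = trans (sym (ofReal-* _ _)) (ofReal-cong (ℝ.⁻¹-inverseˡ (ℝ.0<⇒≉0 (ℝ.fromℕ-positive n))))

  module _ {z : ℂ} (imaginary : conj z ≈ neg z) where

    private
      e f : ℕ → ℂ
      e = term z
      f k = conj (e k)

      -- Conjugation turns the recursion for z into one for conj z, which is - z; thus f consists of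
      -- the terms of exp (- z).
      f-suc : ∀ k → ν (suc k) * f (suc k) ≈ neg z * f k
      f-suc k = trans (*-congʳ (sym (conj-ofReal _))) (trans (sym (conj-* (ν (suc k)) (e (suc k))))
        (trans (conj-cong (term-suc z k)) (trans (conj-* z (e k)) (*-congʳ imaginary))))

      diagonal-vanishes : ∀ m → diagonal e f (suc m) ≈ 0ᶜ
      diagonal-vanishes m = ν-cancel m (trans (*-congʳ (solve 1 (λ n → n := n :+ con (+ 0)) refl (ν (suc m))))
        (trans (diagonal-telescopes ν z f (λ n → ofReal-+ ℝ.1# (ℝ.fromℕ n)) refl f-suc m e 0ᶜ
                 (λ k → trans (*-congʳ (solve 1 (λ n → n :+ con (+ 0) := n) refl (ν (suc k)))) (term-suc z k)))
          (solve 1 (λ x → con (+ 0) :* x := con (+ 0)) refl (e 0 * f (suc m)))))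

      -- Of all antidiagonals only the one of index zero survives, with the value 1.
      triangle≈1 : ∀ N → triangle e f (suc N) ≈ 1ᶜ
      triangle≈1 zero    = trans (solve 2 (λ e f → e :* (f :+ con (+ 0)) :+ con (+ 0) := e :* f) refl (e 0) (f 0))
        (trans (*-cong (term-zero z) (trans (conj-cong (term-zero z)) (conj-ofReal ℝ.1#))) (*-identityˡ 1ᶜ))
      triangle≈1 (suc N) = trans (triangle-last (suc N) e f) (trans (+-cong (triangle≈1 N) (diagonal-vanishes N))
        (solve 0 (con (+ 1) :+ con (+ 0) := con (+ 1)) refl))

      P Q : ℂ
      P = exp z
      Q = conj P

      β : ℕ → ℝ
      β N = two ℝ.* tailBound z N

      Q-close : ∀ N → ∣ Q - ∑< N f ∣ ℝ.≤ β N
      Q-close N = begin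
        ∣ Q - ∑< N f ∣                   ≈⟨ ∣∣-cong (+-congˡ (-‿cong (sym (conj-∑< N e)))) ⟩
        ∣ conj P - conj (partial z N) ∣  ≈⟨ ∣∣-cong (ℝ.refl , ℝ.solve 2 (λ p q → ℝ.:- p ℝ.:- ℝ.:- q ℝ.:= ℝ.:- (p ℝ.:- q)) ℝ.refl (im P) (im (partial z N))) ⟩
        ∣ conj (P - partial z N) ∣       ≈⟨ ∣conj∣ (P - partial z N) ⟩
        ∣ P - partial z N ∣              ≈⟨ ∣∣-cong (solve 2 (λ p q → p :- q := :- (q :- p)) refl P (partial z N)) ⟩
        ∣ neg (partial z N - P) ∣        ≈⟨ ∣neg∣ (partial z N - P) ⟩
        ∣ partial z N - P ∣              ≤⟨ partial-close z N ⟩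
        β N                              ∎

      open Mertens f Q β (two ℝ.* S z) Q-close
        (λ j k → ℝ.*-monoˡ-≤ two 0≤two (tailBound-antitone z j k)) (λ k → ℝ.*-monoˡ-≤ two 0≤two (tailBound≤S z k))

      error-bound : ∀ N → ∣ error e (suc N ℕ.+ suc N) ∣ ℝ.≤ two ℝ.* two ℝ.* S z ℝ.* tailBound z N
      error-bound N = begin
        ∣ error e (suc N ℕ.+ suc N) ∣
          ≤⟨ ∣error∣≤ (suc N) (suc N) e ⟩
        β (suc N) ℝ.* T z (suc N) ℝ.+ two ℝ.* S z ℝ.* rest
          ≤⟨ ℝ.+-mono-≤ (ℝ.*-monoˡ-≤ (β (suc N)) (ℝ.*-nonNegative 0≤two (0≤tailBound z (suc N))) (T≤S z (suc N)))
                        (ℝ.*-monoˡ-≤ (two ℝ.* S z) (ℝ.*-nonNegative 0≤two (0≤S z)) rest≤) ⟩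
        β (suc N) ℝ.* S z ℝ.+ two ℝ.* S z ℝ.* tailBound z (suc N)
          ≈⟨ ℝ.solve 2 (λ b s → let two = ℝ.con (+ 1) ℝ.:+ ℝ.con (+ 1) in
               two ℝ.:* b ℝ.:* s ℝ.:+ two ℝ.:* s ℝ.:* b ℝ.:= two ℝ.:* two ℝ.:* s ℝ.:* b) ℝ.refl (tailBound z (suc N)) (S z) ⟩
        two ℝ.* two ℝ.* S z ℝ.* tailBound z (suc N)
          ≤⟨ ℝ.*-monoˡ-≤ _ (ℝ.*-nonNegative (ℝ.*-nonNegative 0≤two 0≤two) (0≤S z)) (tailBound-antitone z 1 N) ⟩
        two ℝ.* two ℝ.* S z ℝ.* tailBound z N ∎
        where
        rest = ℝΣ.∑< (suc N) (λ k → ∣ e (suc N ℕ.+ k) ∣)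
        rest≤ : rest ℝ.≤ tailBound z (suc N)
        rest≤ = begin
          rest                                     ≈⟨ ℝ.solve 2 (λ t r → r ℝ.:= (t ℝ.:+ r) ℝ.:- t) ℝ.refl (T z (suc N)) rest ⟩
          (T z (suc N) ℝ.+ rest) ℝ.- T z (suc N)   ≈⟨ ℝ.+-congʳ (ℝΣ.∑<-split (suc N) (suc N) (a z)) ⟨
          T z (suc N ℕ.+ suc N) ℝ.- T z (suc N)    ≤⟨ ℝ.+-monoˡ-≤ (ℝ.- T z (suc N)) (T≤S z (suc N ℕ.+ suc N)) ⟩
          tailBound z (suc N)                      ∎

      -- Even lengths split into M = L = N + 1, so that both parts of the error are controlled by a
      -- tail. A subsequence is enough, because the partial sums times Q converge anyway.
      double : ℕ → ℕ
      double N = suc N ℕ.+ suc N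

      -- As the triangle equals 1, the error is a partial sum times Q, minus 1. Hence these products
      -- tend both to P * Q and to 1.
      PQ≈1 : P * Q ≈ 1ᶜ
      PQ≈1 = conv-unique (conv-subsequence double (λ N → ℕ.≤-trans (ℕ.n≤1+n N) (ℕ.m≤m+n (suc N) (suc N))) (conv-* Q (partial→exp z)))
        (conv-squeeze (tailBound z) (tailBound-antitone z) (tailBound→0 z) (two ℝ.* two ℝ.* S z) (ℝ.*-nonNegative (ℝ.*-nonNegative 0≤two 0≤two) (0≤S z))
          (λ N → ℝ.≤-respˡ-≈ (∣∣-cong (+-congˡ (-‿cong (triangle≈1 (N ℕ.+ suc N))))) (error-bound N)))

    ∣exp∣²≈1 : ∣ exp z ∣² ℝ.≈ ℝ.1#
    ∣exp∣²≈1 = re-≈ (trans (sym (∣∣²-conj P)) PQ≈1)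
      where open Analysis._≈_

-- Spectral calculus of a real symmetric matrix

module SymmetricMatrix (em : ExcludedMiddle 0ℓ) (R : CompleteOrderedField) where

  open ComplexNumbers em R
  open Modulus em R
  open Limits em R
  open Exponential em R
  open SpectralTheorem em R using (Eigenbasis)
  open CommutativeRing ℂ-commutativeRing
    using (_≈_; refl; sym; trans; reflexive; +-cong; +-congˡ; +-congʳ; *-cong; *-congˡ; *-congʳ
          ; *-assoc; *-comm; *-identityˡ; zeroʳ; zeroˡ; setoid)
  open Analysis em R using (_,_)
  open IntegerCoefficients ℂ-commutativeRing
  open LinearAlgebra ℂ-commutativeRing
  module ℝL = LinearAlgebra ℝ.commutativeRing
  open import Relation.Binary.Reasoning.Setoid setoid

  private variable
    n : ℕ

  ofReal-sum : (f : Vector ℝ n) → ofReal (ℝ.sum f) ≈ sum (λ i → ofReal (f i))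
  ofReal-sum {zero}  f = refl
  ofReal-sum {suc n} f = trans (ofReal-+ (f zero) _) (+-congˡ (ofReal-sum (λ i → f (suc i))))

  ofReal-δ : (i j : Fin n) → ofReal (ℝL.δ i j) ≈ δ i j
  ofReal-δ i j = reflexive (if-float ofReal (does (i ≟ j)))

  re-dot : (b : Vector ℝ n) (x : Vector ℂ n) → re ((λ j → ofReal (b j)) ᵀ· x) ℝ.≈ ℝL.dot b (λ j → re (x j))
  re-dot {zero}  b x = ℝ.refl
  re-dot {suc n} b x = ℝ.+-cong
    (ℝ.solve 3 (λ b x y → b ℝ.:* x ℝ.:- ℝ.con (+ 0) ℝ.:* y ℝ.:= b ℝ.:* x) ℝ.refl (b zero) (re (x zero)) (im (x zero)))
    (re-dot (λ j → b (suc j)) (λ j → x (suc j)))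

  im-dot : (b : Vector ℝ n) (x : Vector ℂ n) → im ((λ j → ofReal (b j)) ᵀ· x) ℝ.≈ ℝL.dot b (λ j → im (x j))
  im-dot {zero}  b x = ℝ.refl
  im-dot {suc n} b x = ℝ.+-cong
    (ℝ.solve 3 (λ b x y → b ℝ.:* y ℝ.:+ ℝ.con (+ 0) ℝ.:* x ℝ.:= b ℝ.:* y) ℝ.refl (b zero) (re (x zero)) (im (x zero)))
    (im-dot (λ j → b (suc j)) (λ j → x (suc j)))

  conj-dot : (x y : Vector ℂ n) → conj (x ᵀ· y) ≈ (λ j → conj (x j)) ᵀ· (λ j → conj (y j))
  conj-dot {zero}  x y = conj-ofReal ℝ.0#
  conj-dot {suc n} x y = trans (conj-+ (x zero * y zero) _)
    (+-cong (conj-* (x zero) (y zero)) (conj-dot (λ j → x (suc j)) (λ j → y (suc j))))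

  conj-conj : ∀ z → conj (conj z) ≈ z
  conj-conj z = ℝ.refl , ℝ.solve 1 (λ x → ℝ.:- (ℝ.:- x) ℝ.:= x) ℝ.refl (im z)

  dot-minusʳ : (a x y : Vector ℂ n) → a ᵀ· (x -ᵛ y) ≈ a ᵀ· x - a ᵀ· y
  dot-minusʳ a x y = begin
    a ᵀ· (x -ᵛ y)                           ≈⟨ dot-congʳ a {x -ᵛ y} (λ j → solve 2 (λ x y → x :- y := x :+ (:- con (+ 1)) :* y) refl (x j) (y j)) ⟩
    a ᵀ· (λ j → x j + neg 1ᶜ * y j)         ≈⟨ dot-linearʳ a x (neg 1ᶜ) y ⟩
    a ᵀ· x + neg 1ᶜ * (a ᵀ· y)              ≈⟨ solve 2 (λ x y → x :+ (:- con (+ 1)) :* y := x :- y) refl (a ᵀ· x) (a ᵀ· y) ⟩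
    a ᵀ· x - a ᵀ· y                         ∎

  zero-product : ∀ {z w} → z * w ≈ 0ᶜ → ¬ (w ≈ 0ᶜ) → z ≈ 0ᶜ
  zero-product {z} {w} zw≈0 w≉0 = ∣∣²≈0⇒≈0 (ℝ.*-cancelˡ-0 (λ ∣w∣²≈0 → w≉0 (∣∣²≈0⇒≈0 ∣w∣²≈0))
    (ℝ.trans (ℝ.*-comm ∣ w ∣² ∣ z ∣²) (ℝ.trans (ℝ.sym (∣∣²-* z w)) (ℝ.trans (∣∣²-cong zw≈0)
      (ℝ.solve 0 (ℝ.con (+ 0) ℝ.:* ℝ.con (+ 0) ℝ.:+ ℝ.con (+ 0) ℝ.:* ℝ.con (+ 0) ℝ.:= ℝ.con (+ 0)) ℝ.refl)))))

  minus≈0⇒≈ : ∀ {z w} → z - w ≈ 0ᶜ → z ≈ w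
  minus≈0⇒≈ {z} {w} eq = trans (solve 2 (λ z w → z := (z :- w) :+ w) refl z w)
    (trans (+-congʳ eq) (solve 1 (λ w → con (+ 0) :+ w := w) refl w))

  ≈⇒minus≈0 : ∀ {z w} → z ≈ w → z - w ≈ 0ᶜ
  ≈⇒minus≈0 {z} {w} eq = trans (+-congʳ eq) (solve 1 (λ w → w :- w := con (+ 0)) refl w)

  -- Takes the decision as an argument, so that a statement about `em` can be generalised to any
  -- decision and then split into cases.
  indicator : {P : Set} → Dec P → ℂ
  indicator d = if does d then 1ᶜ else 0ᶜ

  norm² : Vector ℂ n → ℝ
  norm² x = ℝ.sum λ j → ∣ x j ∣²

  norm²≈0⇒≈0 : (x : Vector ℂ n) → norm² x ℝ.≈ ℝ.0# → ∀ j → x j ≈ 0ᶜ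
  norm²≈0⇒≈0 x eq j = ∣∣²≈0⇒≈0 (sum≈0⇒≈0 (λ j → ∣ x j ∣²) (λ j → 0≤∣z∣² (x j)) eq j)
    where open SpectralTheorem em R using (sum≈0⇒≈0)

  ⟨x,x⟩≈norm² : (x : Vector ℂ n) → ⟨ x , x ⟩ ≈ ofReal (norm² x)
  ⟨x,x⟩≈norm² x = trans (sum-cong-≋ (λ j → trans (*-comm (conj (x j)) (x j)) (∣∣²-conj (x j)))) (sym (ofReal-sum (λ j → ∣ x j ∣²)))

  module Spectral {n : ℕ} {m : Matrix ℝ n} (B : Eigenbasis m) (m-sym : ℝL.Symmetricᵐ m)
                  (M : Matrix ℂ n) (M≈m : ∀ i j → M i j ≈ ofReal (m i j)) where

    open Eigenbasis B

    V : Fin n → Vector ℂ n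
    V k j = ofReal (basis k j)

    θ : Fin n → ℂ
    θ k = ofReal (eigenvalueOf k)

    M-sym : Symmetricᵐ M
    M-sym i j = trans (M≈m i j) (trans (ofReal-cong (m-sym i j)) (sym (M≈m j i)))

    M-real : ∀ i j → conj (M i j) ≈ M i j
    M-real i j = trans (conj-cong (M≈m i j)) (trans (conj-ofReal (m i j)) (sym (M≈m i j)))

    V-eigen : ∀ k → V k ∈ InEigenspace M (θ k)
    V-eigen k j = begin
      M j ᵀ· V k                                        ≈⟨ dot-congˡ (V k) (M≈m j) ⟩
      sum (λ l → ofReal (m j l) * ofReal (basis k l))   ≈⟨ sum-cong-≋ (λ l → ofReal-* (m j l) (basis k l)) ⟨
      sum (λ l → ofReal (m j l ℝ.* basis k l))          ≈⟨ ofReal-sum (λ l → m j l ℝ.* basis k l) ⟨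
      ofReal (ℝL.dot (m j) (basis k))                   ≈⟨ ofReal-cong (eigenvector k j) ⟩
      ofReal (eigenvalueOf k ℝ.* basis k j)             ≈⟨ ofReal-* (eigenvalueOf k) (basis k j) ⟩
      θ k * V k j                                       ∎

    basis-complete : ∀ i j → ℝ.sum (λ k → basis k i ℝ.* basis k j) ℝ.≈ ℝL.δ i j
    basis-complete i j = ℝ.trans (ℝL.sum-cong-≋ (λ k → ℝ.*-cong (ℝ.sym (pick k i)) (ℝ.sym (pick k j))))
      (ℝ.trans (parseval (ℝL.δ i) (ℝL.δ j)) (ℝ.trans (ℝL.dot-δ i (ℝL.δ j)) (ℝR.reflexive (ℝL.δ-sym j i))))
      where
      module ℝR = CommutativeRing ℝ.commutativeRing
      pick : ∀ k i → ℝL.dot (basis k) (ℝL.δ i) ℝ.≈ basis k i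
      pick k i = ℝ.trans (ℝL.dot-comm (basis k) (ℝL.δ i)) (ℝL.dot-δ i (basis k))

    V-complete : ∀ i j → sum (λ k → V k i * V k j) ≈ δ i j
    V-complete i j = begin
      sum (λ k → V k i * V k j)                         ≈⟨ sum-cong-≋ (λ k → ofReal-* (basis k i) (basis k j)) ⟨
      sum (λ k → ofReal (basis k i ℝ.* basis k j))      ≈⟨ ofReal-sum (λ k → basis k i ℝ.* basis k j) ⟨
      ofReal (ℝ.sum (λ k → basis k i ℝ.* basis k j))    ≈⟨ ofReal-cong (basis-complete i j) ⟩
      ofReal (ℝL.δ i j)                                 ≈⟨ ofReal-δ i j ⟩
      δ i j                                             ∎

    -- Functional calculus: the matrix ∑ gₖ Vₖ Vₖᵀ. Constant 1 gives the identity, indicators give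
    -- projections, and exponentials give the matrix exponential.
    spectral : (Fin n → ℂ) → Matrix ℂ n
    spectral g j l = sum λ k → g k * (V k j * V k l)

    spectral-*ᵥ : ∀ g x j → (spectral g *ᵥ x) j ≈ sum (λ k → g k * (V k j * (V k ᵀ· x)))
    spectral-*ᵥ g x j = begin
      sum (λ l → sum (λ k → g k * (V k j * V k l)) * x l)
        ≈⟨ sum-cong-≋ (λ l → *-comm (spectral g j l) (x l)) ⟩
      x ᵀ· (λ l → sum λ k → g k * (V k j * V k l))
        ≈⟨ dot-∑ʳ x (λ k l → g k * (V k j * V k l)) ⟩
      sum (λ k → x ᵀ· (λ l → g k * (V k j * V k l)))
        ≈⟨ sum-cong-≋ (λ k → trans (dot-*ʳ x (g k) (λ l → V k j * V k l))
             (*-congˡ (trans (dot-*ʳ x (V k j) (V k)) (*-congˡ (dot-comm x (V k)))))) ⟩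
      sum (λ k → g k * (V k j * (V k ᵀ· x))) ∎

    dot-spectral : ∀ g a x → a ᵀ· (spectral g *ᵥ x) ≈ sum (λ k → g k * ((a ᵀ· V k) * (V k ᵀ· x)))
    dot-spectral g a x = begin
      a ᵀ· (spectral g *ᵥ x)
        ≈⟨ dot-congʳ a (spectral-*ᵥ g x) ⟩
      a ᵀ· (λ j → sum λ k → g k * (V k j * (V k ᵀ· x)))
        ≈⟨ dot-∑ʳ a (λ k j → g k * (V k j * (V k ᵀ· x))) ⟩
      sum (λ k → a ᵀ· (λ j → g k * (V k j * (V k ᵀ· x))))
        ≈⟨ sum-cong-≋ (λ k → trans (dot-*ʳ a (g k) (λ j → V k j * (V k ᵀ· x)))
             (*-congˡ (trans (dot-congʳ a (λ j → *-comm (V k j) (V k ᵀ· x)))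
               (trans (dot-*ʳ a (V k ᵀ· x) (V k)) (*-comm (V k ᵀ· x) (a ᵀ· V k)))))) ⟩
      sum (λ k → g k * ((a ᵀ· V k) * (V k ᵀ· x))) ∎

    spectral-1 : ∀ i j → spectral (λ _ → 1ᶜ) i j ≈ δ i j
    spectral-1 i j = trans (sum-cong-≋ (λ k → *-identityˡ (V k i * V k j))) (V-complete i j)

    dot-expand : ∀ a x → a ᵀ· x ≈ sum (λ k → (a ᵀ· V k) * (V k ᵀ· x))
    dot-expand a x = begin
      a ᵀ· x
        ≈⟨ dot-congʳ a (λ j → trans (dot-congˡ x (spectral-1 j)) (dot-δ j x)) ⟨
      a ᵀ· (spectral (λ _ → 1ᶜ) *ᵥ x)
        ≈⟨ dot-spectral (λ _ → 1ᶜ) a x ⟩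
      sum (λ k → 1ᶜ * ((a ᵀ· V k) * (V k ᵀ· x)))
        ≈⟨ sum-cong-≋ (λ k → *-identityˡ ((a ᵀ· V k) * (V k ᵀ· x))) ⟩
      sum (λ k → (a ᵀ· V k) * (V k ᵀ· x)) ∎

    dot-𝐞 : ∀ (x : Vector ℂ n) u → x ᵀ· 𝐞 u ≈ x u
    dot-𝐞 x u = trans (dot-comm x (𝐞 u)) (trans (dot-congˡ x (λ j → reflexive (δ-sym j u))) (dot-δ u x))

    -- Symmetry of M under the bilinear pairing gives t (vᵀVₖ) = θₖ (vᵀVₖ). No conjugate appears, so
    -- v and t may be complex.
    eigenspace-orthogonal : ∀ {t v} → v ∈ InEigenspace M t → ∀ k → ¬ (t ≈ θ k) → v ᵀ· V k ≈ 0ᶜ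
    eigenspace-orthogonal {t} {v} v∈W k t≉θk = zero-product difference (λ t-θk≈0 → t≉θk (minus≈0⇒≈ t-θk≈0))
      where
      difference : (v ᵀ· V k) * (t - θ k) ≈ 0ᶜ
      difference = begin
        (v ᵀ· V k) * (t - θ k)                  ≈⟨ solve 3 (λ p t s → p :* (t :- s) := t :* p :- s :* p) refl (v ᵀ· V k) t (θ k) ⟩
        t * (v ᵀ· V k) - θ k * (v ᵀ· V k)       ≈⟨ ≈⇒minus≈0 (begin
          t * (v ᵀ· V k)                        ≈⟨ *-congˡ (dot-comm v (V k)) ⟩
          t * (V k ᵀ· v)                        ≈⟨ dot-*ʳ (V k) t v ⟨
          V k ᵀ· (t • v)                        ≈⟨ dot-congʳ (V k) v∈W ⟨
          V k ᵀ· (M *ᵥ v)                       ≈⟨ dot-app-sym M-sym (V k) v ⟩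
          (M *ᵥ V k) ᵀ· v                       ≈⟨ dot-congˡ v (V-eigen k) ⟩
          (θ k • V k) ᵀ· v                      ≈⟨ dot-comm (θ k • V k) v ⟩
          v ᵀ· (θ k • V k)                      ≈⟨ dot-*ʳ v (θ k) (V k) ⟩
          θ k * (v ᵀ· V k)                      ∎) ⟩
        0ᶜ                                      ∎

    -- A t that is not real differs from every θₖ, so v would be orthogonal to the whole basis and
    -- hence zero.
    eigenvalue-real : ∀ {t v} → Eigenpair M v t → conj t ≈ t
    eigenvalue-real {t} {v} (v≉0 , v∈W) = case em
      where
      case : Dec (conj t ≈ t) → conj t ≈ t
      case (yes p) = p
      case (no ¬p) = ⊥-elim (v≉0 λ j → begin
        v j                                             ≈⟨ dot-δ j v ⟨
        δ j ᵀ· v                                        ≈⟨ dot-comm (δ j) v ⟩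
        v ᵀ· δ j                                        ≈⟨ dot-expand v (δ j) ⟩
        sum (λ k → (v ᵀ· V k) * (V k ᵀ· δ j))           ≈⟨ sum-0 _ (λ k → trans (*-congʳ (eigenspace-orthogonal {v = v} v∈W k
                                                             (λ t≈θk → ¬p (trans (conj-cong t≈θk) (trans (conj-ofReal (eigenvalueOf k)) (sym t≈θk))))))
                                                             (zeroˡ (V k ᵀ· δ j))) ⟩
        0ᶜ                                              ∎)

    conj-eigenspace : ∀ {t v} → conj t ≈ t → v ∈ InEigenspace M t → (λ j → conj (v j)) ∈ InEigenspace M t
    conj-eigenspace {t} {v} t-real v∈W j = begin
      M j ᵀ· (λ l → conj (v l))                         ≈⟨ dot-congˡ (λ l → conj (v l)) (M-real j) ⟨
      (λ l → conj (M j l)) ᵀ· (λ l → conj (v l))        ≈⟨ conj-dot (M j) v ⟨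
      conj (M j ᵀ· v)                                   ≈⟨ conj-cong (v∈W j) ⟩
      conj (t * v j)                                    ≈⟨ conj-* t (v j) ⟩
      conj t * conj (v j)                               ≈⟨ *-congʳ t-real ⟩
      t * conj (v j)                                    ∎

    module Projection (t : ℂ) where

      select : Fin n → ℂ
      select k = indicator (em {t ≈ θ k})

      select-θ : ∀ k → select k * θ k ≈ t * select k
      select-θ k = go em
        where
        go : (d : Dec (t ≈ θ k)) → indicator d * θ k ≈ t * indicator d
        go (yes t≈θk) = trans (*-comm 1ᶜ (θ k)) (*-congʳ (sym t≈θk))
        go (no _)     = trans (zeroˡ (θ k)) (sym (zeroʳ t))

      select-⟨⟩ : ∀ {w} → w ∈ InEigenspace M t → ∀ k →
                  select k * ((λ j → conj (w j)) ᵀ· V k) ≈ (λ j → conj (w j)) ᵀ· V k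
      select-⟨⟩ {w} w∈W k = go em
        where
        w̄ : Vector ℂ n
        w̄ j = conj (w j)
        go : (d : Dec (t ≈ θ k)) → indicator d * (w̄ ᵀ· V k) ≈ w̄ ᵀ· V k
        go (yes _)   = *-identityˡ (w̄ ᵀ· V k)
        go (no t≉θk) = trans (zeroˡ (w̄ ᵀ· V k)) (sym (begin
          w̄ ᵀ· V k                              ≈⟨ dot-congʳ w̄ (λ j → conj-ofReal (basis k j)) ⟨
          w̄ ᵀ· (λ j → conj (V k j))             ≈⟨ conj-dot w (V k) ⟨
          conj (w ᵀ· V k)                       ≈⟨ conj-cong (eigenspace-orthogonal {v = w} w∈W k t≉θk) ⟩
          conj 0ᶜ                               ≈⟨ conj-ofReal ℝ.0# ⟩
          0ᶜ                                    ∎))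

      -- The surviving terms all have eigenvalue t, which puts the image into the eigenspace. For w
      -- in the eigenspace, the coefficients of conj w vanish wherever `select` does, so inserting
      -- `select` into the expansion of the inner product changes nothing.
      select-projects : IsOrthogonalProjection (InEigenspace M t) (spectral select)
      select-projects x = in-eigenspace , orthogonal
        where
        in-eigenspace : spectral select *ᵥ x ∈ InEigenspace M t
        in-eigenspace j = begin
          M j ᵀ· (spectral select *ᵥ x)
            ≈⟨ dot-spectral select (M j) x ⟩
          sum (λ k → select k * ((M j ᵀ· V k) * (V k ᵀ· x)))
            ≈⟨ sum-cong-≋ (λ k → begin
                 select k * ((M j ᵀ· V k) * (V k ᵀ· x))       ≈⟨ *-congˡ (*-congʳ (V-eigen k j)) ⟩
                 select k * ((θ k * V k j) * (V k ᵀ· x))      ≈⟨ solve 4 (λ s t v p → s :* ((t :* v) :* p) := (s :* t) :* (v :* p)) refl (select k) (θ k) (V k j) (V k ᵀ· x) ⟩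
                 (select k * θ k) * (V k j * (V k ᵀ· x))      ≈⟨ *-congʳ (select-θ k) ⟩
                 (t * select k) * (V k j * (V k ᵀ· x))        ≈⟨ *-assoc t (select k) (V k j * (V k ᵀ· x)) ⟩
                 t * (select k * (V k j * (V k ᵀ· x)))        ∎) ⟩
          sum (λ k → t * (select k * (V k j * (V k ᵀ· x))))
            ≈⟨ *-distribˡ-sum t (λ k → select k * (V k j * (V k ᵀ· x))) ⟨
          t * sum (λ k → select k * (V k j * (V k ᵀ· x)))
            ≈⟨ *-congˡ (spectral-*ᵥ select x j) ⟨
          t * (spectral select *ᵥ x) j ∎
        orthogonal : ∀ w → w ∈ InEigenspace M t → ⟨ w , x -ᵛ spectral select *ᵥ x ⟩ ≈ 0ᶜ
        orthogonal w w∈W = begin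
          w̄ ᵀ· (x -ᵛ spectral select *ᵥ x)                    ≈⟨ dot-minusʳ w̄ x (spectral select *ᵥ x) ⟩
          w̄ ᵀ· x - w̄ ᵀ· (spectral select *ᵥ x)                ≈⟨ ≈⇒minus≈0 (begin
            w̄ ᵀ· x                                            ≈⟨ dot-expand w̄ x ⟩
            sum (λ k → (w̄ ᵀ· V k) * (V k ᵀ· x))               ≈⟨ sum-cong-≋ (λ k → trans (*-congʳ (sym (select-⟨⟩ {w} w∈W k))) (*-assoc (select k) (w̄ ᵀ· V k) (V k ᵀ· x))) ⟩
            sum (λ k → select k * ((w̄ ᵀ· V k) * (V k ᵀ· x)))  ≈⟨ dot-spectral select w̄ x ⟨
            w̄ ᵀ· (spectral select *ᵥ x)                       ∎) ⟩
          0ᶜ                                                  ∎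
          where
          w̄ : Vector ℂ n
          w̄ j = conj (w j)

    -- The explicit projection serves as the existence proof; `E M t` itself is then known through
    -- its defining property.
    E-projects : ∀ t → IsOrthogonalProjection (InEigenspace M t) (E M t)
    E-projects t = the-satisfies (λ _ _ → 0ᶜ) (IsOrthogonalProjection (InEigenspace M t))
      (spectral (Projection.select t) , Projection.select-projects t)

    -- The transpose pairing with v is the Hermitian pairing with conj v, which again lies in the
    -- eigenspace because t is real, and is therefore orthogonal to x - E x.
    dot-E : ∀ {t v} → conj t ≈ t → v ∈ InEigenspace M t → ∀ x → v ᵀ· (E M t *ᵥ x) ≈ v ᵀ· x
    dot-E {t} {v} t-real v∈W x = sym (minus≈0⇒≈ (begin
      v ᵀ· x - v ᵀ· (E M t *ᵥ x)                        ≈⟨ dot-minusʳ v x (E M t *ᵥ x) ⟨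
      v ᵀ· (x -ᵛ E M t *ᵥ x)                            ≈⟨ dot-congˡ (x -ᵛ E M t *ᵥ x) (λ j → conj-conj (v j)) ⟨
      ⟨ (λ j → conj (v j)) , x -ᵛ E M t *ᵥ x ⟩          ≈⟨ proj₂ (E-projects t x) (λ j → conj (v j)) (conj-eigenspace {v = v} t-real v∈W) ⟩
      0ᶜ                                                ∎))

    V-eigenpair : ∀ k → Eigenpair M (V k) (θ k)
    V-eigenpair k = (λ V≈0 → ℝ.0≉1 (ℝ.trans (ℝ.sym (ℝL.dot-0ʳ (basis k) (λ j → re-≈ (V≈0 j)))) (unit k))) , V-eigen k
      where open Analysis._≈_

    -- The basis is real, so each coefficient splits into real and imaginary parts, and the real
    -- Parseval identity applies to both.
    norm²-parseval : ∀ x → ℝ.sum (λ k → ∣ V k ᵀ· x ∣²) ℝ.≈ norm² x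
    norm²-parseval x = ℝ.trans (ℝL.sum-cong-≋ (λ k → ℝ.+-cong (ℝ.*-cong (re-dot (basis k) x) (re-dot (basis k) x)) (ℝ.*-cong (im-dot (basis k) x) (im-dot (basis k) x))))
      (ℝ.trans (ℝL.∑-distrib-+ (λ k → ℝL.dot (basis k) (λ j → re (x j)) ℝ.* ℝL.dot (basis k) (λ j → re (x j)))
                               (λ k → ℝL.dot (basis k) (λ j → im (x j)) ℝ.* ℝL.dot (basis k) (λ j → im (x j))))
      (ℝ.trans (ℝ.+-cong (parseval (λ j → re (x j)) (λ j → re (x j))) (parseval (λ j → im (x j)) (λ j → im (x j))))
        (ℝ.sym (ℝL.∑-distrib-+ (λ j → re (x j) ℝ.* re (x j)) (λ j → im (x j) ℝ.* im (x j))))))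

    -- The matrix exponential in the eigenbasis

    module MatrixExponential (c : ℂ) where

      open SemiringDefs (matrixRawSemiring n) using () renaming (_^_ to _^ᵐ_)

      power-spectral : ∀ p j l → ((c •ᵐ M) ^ᵐ p) j l ≈ spectral (λ k → (c * θ k) ^ p) j l
      power-spectral zero    j l = sym (spectral-1 j l)
      power-spectral (suc p) j l = begin
        (c •ᵐ M) j ᵀ· (λ i → ((c •ᵐ M) ^ᵐ p) i l)
          ≈⟨ dot-congʳ ((c •ᵐ M) j) (λ i → power-spectral p i l) ⟩
        (c •ᵐ M) j ᵀ· (λ i → sum λ k → (c * θ k) ^ p * (V k i * V k l))
          ≈⟨ dot-∑ʳ ((c •ᵐ M) j) (λ k i → (c * θ k) ^ p * (V k i * V k l)) ⟩
        sum (λ k → (c •ᵐ M) j ᵀ· (λ i → (c * θ k) ^ p * (V k i * V k l)))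
          ≈⟨ sum-cong-≋ (λ k → begin
               (c •ᵐ M) j ᵀ· (λ i → (c * θ k) ^ p * (V k i * V k l))
                 ≈⟨ dot-*ʳ ((c •ᵐ M) j) ((c * θ k) ^ p) (λ i → V k i * V k l) ⟩
               (c * θ k) ^ p * ((c •ᵐ M) j ᵀ· (λ i → V k i * V k l))
                 ≈⟨ *-congˡ (trans (dot-congʳ ((c •ᵐ M) j) (λ i → *-comm (V k i) (V k l))) (dot-*ʳ ((c •ᵐ M) j) (V k l) (V k))) ⟩
               (c * θ k) ^ p * (V k l * ((c •ᵐ M) j ᵀ· V k))
                 ≈⟨ *-congˡ (*-congˡ (trans (dot-comm ((c •ᵐ M) j) (V k)) (trans (dot-*ʳ (V k) c (M j)) (*-congˡ (trans (dot-comm (V k) (M j)) (V-eigen k j)))))) ⟩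
               (c * θ k) ^ p * (V k l * (c * (θ k * V k j)))
                 ≈⟨ solve 5 (λ q v c t w → q :* (v :* (c :* (t :* w))) := ((c :* t) :* q) :* (w :* v)) refl ((c * θ k) ^ p) (V k l) c (θ k) (V k j) ⟩
               (c * θ k) ^ suc p * (V k j * V k l) ∎) ⟩
        spectral (λ k → (c * θ k) ^ suc p) j l ∎

      -- After exchanging the two finite sums, each entry of a partial sum is a fixed linear
      -- combination of n scalar exponential partial sums, and the limit can be taken in each of
      -- them.
      expᵐ-spectral : ∀ j l → expᵐ (c •ᵐ M) j l ≈ spectral (λ k → exp (c * θ k)) j l
      expᵐ-spectral j l = lim-≈ (conv-cong partial-sums refl
        (conv-sum (λ k N → partial (c * θ k) N * (V k j * V k l)) (λ k → exp (c * θ k) * (V k j * V k l))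
          (λ k → conv-* (V k j * V k l) (partial→exp (c * θ k)))))
        where
        partial-sums : ∀ N → sum (λ k → partial (c * θ k) N * (V k j * V k l)) ≈ sum {N} (λ i → 1/ toℕ i ! * ((c •ᵐ M) ^ᵐ toℕ i) j l)
        partial-sums N = begin
          sum (λ k → sum {N} (λ i → term (c * θ k) (toℕ i)) * (V k j * V k l))
            ≈⟨ sum-cong-≋ (λ k → *-distribʳ-sum {N} (V k j * V k l) (λ i → term (c * θ k) (toℕ i))) ⟩
          sum (λ k → sum {N} (λ i → term (c * θ k) (toℕ i) * (V k j * V k l)))
            ≈⟨ ∑-comm (λ k (i : Fin N) → term (c * θ k) (toℕ i) * (V k j * V k l)) ⟩
          sum {N} (λ i → sum (λ k → term (c * θ k) (toℕ i) * (V k j * V k l)))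
            ≈⟨ sum-cong-≋ {N} (λ i → trans (sum-cong-≋ (λ k → *-assoc (1/ toℕ i !) ((c * θ k) ^ toℕ i) (V k j * V k l)))
                 (trans (sym (*-distribˡ-sum (1/ toℕ i !) (λ k → (c * θ k) ^ toℕ i * (V k j * V k l)))) (*-congˡ (sym (power-spectral (toℕ i) j l))))) ⟩
          sum {N} (λ i → 1/ toℕ i ! * ((c •ᵐ M) ^ᵐ toℕ i) j l) ∎

      -- The vector v need not belong to the basis: it is orthogonal to each Vₖ with θₖ different
      -- from t, and the remaining terms share the factor exp (c t).
      dot-expᵐ : ∀ {t v} → v ∈ InEigenspace M t → ∀ x → v ᵀ· (expᵐ (c •ᵐ M) *ᵥ x) ≈ exp (c * t) * (v ᵀ· x)
      dot-expᵐ {t} {v} v∈W x = begin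
        v ᵀ· (expᵐ (c •ᵐ M) *ᵥ x)
          ≈⟨ dot-congʳ v (λ j → dot-congˡ x (expᵐ-spectral j)) ⟩
        v ᵀ· (spectral (λ k → exp (c * θ k)) *ᵥ x)
          ≈⟨ dot-spectral (λ k → exp (c * θ k)) v x ⟩
        sum (λ k → exp (c * θ k) * ((v ᵀ· V k) * (V k ᵀ· x)))
          ≈⟨ sum-cong-≋ (λ k → trans (sym (*-assoc (exp (c * θ k)) (v ᵀ· V k) (V k ᵀ· x))) (trans (*-congʳ (same-phase k em)) (*-assoc (exp (c * t)) (v ᵀ· V k) (V k ᵀ· x)))) ⟩
        sum (λ k → exp (c * t) * ((v ᵀ· V k) * (V k ᵀ· x)))
          ≈⟨ *-distribˡ-sum (exp (c * t)) (λ k → (v ᵀ· V k) * (V k ᵀ· x)) ⟨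
        exp (c * t) * sum (λ k → (v ᵀ· V k) * (V k ᵀ· x))
          ≈⟨ *-congˡ (dot-expand v x) ⟨
        exp (c * t) * (v ᵀ· x) ∎
        where
        same-phase : ∀ k → Dec (t ≈ θ k) → exp (c * θ k) * (v ᵀ· V k) ≈ exp (c * t) * (v ᵀ· V k)
        same-phase k (yes t≈θk) = *-congʳ (exp-cong (*-congˡ (sym t≈θk)))
        same-phase k (no t≉θk)  = trans (*-congˡ v⊥Vk) (trans (zeroʳ (exp (c * θ k))) (sym (trans (*-congˡ v⊥Vk) (zeroʳ (exp (c * t))))))
          where v⊥Vk = eigenspace-orthogonal {v = v} v∈W k t≉θk

-- Local uniform mixing

module Mixing (em : ExcludedMiddle 0ℓ) (R : CompleteOrderedField) where

  open ComplexNumbers em R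
  open Modulus em R
  open Exponential em R
  open SpectralTheorem em R using (eigenbasis)
  open SymmetricMatrix em R
  open CommutativeRing ℂ-commutativeRing
    using (_≈_; refl; sym; trans; +-cong; +-congˡ; +-congʳ; *-cong; *-congˡ; *-congʳ; -‿cong
          ; *-assoc; *-identityˡ; *-identityʳ; zeroʳ; zeroˡ; setoid)
  open Analysis em R using (_,_)
  open IntegerCoefficients ℂ-commutativeRing
  open LinearAlgebra ℂ-commutativeRing

  module _ {n : ℕ} {m : Matrix ℝ n} (m-sym : ℝL.Symmetricᵐ m) (M : Matrix ℂ n) (M≈m : ∀ i j → M i j ≈ ofReal (m i j))
           (u : Fin n) (τ : ℝ) where

    open Spectral (eigenbasis m m-sym) m-sym M M≈m
    open MatrixExponential (𝕚 * ofReal τ)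

    √n : ℂ
    √n = ofReal (√ℕ n)

    Uᵤ : Vector ℂ n
    Uᵤ = U M τ *ᵥ 𝐞 u

    OnProjections OnEigenpairs : Vector ℂ n → Set
    OnProjections μ = ∀ t → t ∈ Φ M (𝐞 u) →
      √n * exp (𝕚 * ofReal τ * t) • E M t *ᵥ 𝐞 u ≈ᵛ E M t *ᵥ μ
    OnEigenpairs μ = ∀ v t → Eigenpair M v t → t ∈ Φ M (𝐞 u) →
      √n * exp (𝕚 * ofReal τ * t) * (v ᵀ· 𝐞 u) ≈ v ᵀ· μ

    0<n : ℝ.0# ℝ.< ℝ.fromℕ n
    0<n = go u
      where
      go : ∀ {n} → Fin n → ℝ.0# ℝ.< ℝ.fromℕ n
      go {suc n} _ = ℝ.fromℕ-positive n

    √ℕn : ℝ.0# ℝ.≤ √ℕ n × √ℕ n ℝ.* √ℕ n ℝ.≈ ℝ.fromℕ n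
    √ℕn = √-satisfies (proj₁ 0<n)

    √ℕn≉0 : √ℕ n ℝ.≉ ℝ.0#
    √ℕn≉0 √n≈0 = ℝ.0<⇒≉0 0<n (ℝ.trans (ℝ.sym (proj₂ √ℕn)) (ℝ.trans (ℝ.*-congʳ √n≈0) (ℝ.zeroˡ _)))

    ∣√n•Uᵤ∣ : ∀ j → ∣ √n * Uᵤ j ∣ ℝ.≈ √ℕ n ℝ.* ∣ U M τ j u ∣
    ∣√n•Uᵤ∣ j = ℝ.trans (∣∣-* √n (Uᵤ j)) (ℝ.*-cong (∣ofReal∣ (proj₁ √ℕn)) (∣∣-cong (dot-𝐞 (U M τ j) u)))

    mixing⇔unimodular : LocalUniformMixing M u τ ⇔ (∃[ μ ] Unimodular μ × √n • Uᵤ ≈ᵛ μ)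
    mixing⇔unimodular = mk⇔
      (λ mixing → √n • Uᵤ
                , (λ j → ℝ.trans (∣√n•Uᵤ∣ j) (ℝ.trans (ℝ.*-congˡ (mixing j)) (ℝ.⁻¹-inverseʳ √ℕn≉0)))
                , λ j → refl)
      (λ (μ , unimodular , eq) j → ℝ.*-cancelˡ √ℕn≉0
        (ℝ.trans (ℝ.sym (∣√n•Uᵤ∣ j)) (ℝ.trans (∣∣-cong (eq j)) (ℝ.trans (unimodular j) (ℝ.sym (ℝ.⁻¹-inverseʳ √ℕn≉0))))))

    -- The scaled column √n U 𝐞ᵤ satisfies the eigenpair identity at every t, inside the eigenvalue
    -- support or not.
    dot-√n•Uᵤ : ∀ {t v} → v ∈ InEigenspace M t → √n * exp (𝕚 * ofReal τ * t) * (v ᵀ· 𝐞 u) ≈ v ᵀ· (√n • Uᵤ)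
    dot-√n•Uᵤ {t} {v} v∈W = begin
      √n * exp (𝕚 * ofReal τ * t) * (v ᵀ· 𝐞 u)       ≈⟨ *-assoc √n (exp (𝕚 * ofReal τ * t)) (v ᵀ· 𝐞 u) ⟩
      √n * (exp (𝕚 * ofReal τ * t) * (v ᵀ· 𝐞 u))     ≈⟨ *-congˡ (dot-expᵐ {v = v} v∈W (𝐞 u)) ⟨
      √n * (v ᵀ· Uᵤ)                      ≈⟨ dot-*ʳ v √n Uᵤ ⟨
      v ᵀ· (√n • Uᵤ)                      ∎
      where open import Relation.Binary.Reasoning.Setoid setoid

    -- Pairing the projected equation with v removes E from both sides, by `dot-E`.
    projections⇒eigenpairs : ∀ μ → OnProjections μ → OnEigenpairs μ
    projections⇒eigenpairs μ onProjections v t pair@(_ , v∈W) t∈Φ = begin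
      s * (v ᵀ· 𝐞 u)                      ≈⟨ *-congˡ (dot-E {v = v} t-real v∈W (𝐞 u)) ⟨
      s * (v ᵀ· (E M t *ᵥ 𝐞 u))           ≈⟨ dot-*ʳ v s (E M t *ᵥ 𝐞 u) ⟨
      v ᵀ· (s • E M t *ᵥ 𝐞 u)             ≈⟨ dot-congʳ v (onProjections t t∈Φ) ⟩
      v ᵀ· (E M t *ᵥ μ)                   ≈⟨ dot-E {v = v} t-real v∈W μ ⟩
      v ᵀ· μ                              ∎
      where
      open import Relation.Binary.Reasoning.Setoid setoid
      s = √n * exp (𝕚 * ofReal τ * t)
      t-real = eigenvalue-real {v = v} pair

    -- The difference d of the two sides lies in the eigenspace, and testing with the eigenvector conj d gives ⟨ d , d ⟩ = 0.
    eigenpairs⇒projections : ∀ μ → OnEigenpairs μ → OnProjections μ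
    eigenpairs⇒projections μ onEigenpairs t t∈Φ@((v , pair) , _) j = minus≈0⇒≈ (norm²≈0⇒≈0 d ∥d∥²≈0 j)
      where
      open import Relation.Binary.Reasoning.Setoid setoid
      s = √n * exp (𝕚 * ofReal τ * t)
      t-real = eigenvalue-real {v = v} pair
      x y d d̄ : Vector ℂ n
      x = E M t *ᵥ 𝐞 u
      y = E M t *ᵥ μ
      d = (s • x) -ᵛ y
      d̄ l = conj (d l)
      d∈W : d ∈ InEigenspace M t
      d∈W i = begin
        M i ᵀ· d                          ≈⟨ dot-minusʳ (M i) (s • x) y ⟩
        M i ᵀ· (s • x) - M i ᵀ· y         ≈⟨ +-cong (trans (dot-*ʳ (M i) s x) (*-congˡ (proj₁ (E-projects t (𝐞 u)) i))) (-‿cong (proj₁ (E-projects t μ) i)) ⟩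
        s * (t * x i) - t * y i           ≈⟨ solve 4 (λ s t x y → s :* (t :* x) :- t :* y := t :* (s :* x :- y)) refl s t (x i) (y i) ⟩
        t * d i                           ∎
      d̄∈W = conj-eigenspace {v = d} t-real d∈W
      -- Eigenpairs are nonzero by definition, so a vanishing conj d cannot serve as a test vector
      -- and is treated apart.
      ⟨d,d⟩≈0 : Dec (d̄ ≈ᵛ 0ᵛ) → ⟨ d , d ⟩ ≈ 0ᶜ
      ⟨d,d⟩≈0 (yes d̄≈0) = sum-0 _ (λ l → trans (*-congʳ (d̄≈0 l)) (zeroˡ (d l)))
      ⟨d,d⟩≈0 (no d̄≉0)  = begin
        d̄ ᵀ· d                            ≈⟨ dot-minusʳ d̄ (s • x) y ⟩
        d̄ ᵀ· (s • x) - d̄ ᵀ· y             ≈⟨ ≈⇒minus≈0 (begin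
          d̄ ᵀ· (s • x)                    ≈⟨ dot-*ʳ d̄ s x ⟩
          s * (d̄ ᵀ· x)                    ≈⟨ *-congˡ (dot-E {v = d̄} t-real d̄∈W (𝐞 u)) ⟩
          s * (d̄ ᵀ· 𝐞 u)                  ≈⟨ onEigenpairs d̄ t (d̄≉0 , d̄∈W) t∈Φ ⟩
          d̄ ᵀ· μ                          ≈⟨ dot-E {v = d̄} t-real d̄∈W μ ⟨
          d̄ ᵀ· y                          ∎) ⟩
        0ᶜ                                ∎
      ∥d∥²≈0 : norm² d ℝ.≈ ℝ.0#
      ∥d∥²≈0 = re-≈ (trans (sym (⟨x,x⟩≈norm² d)) (⟨d,d⟩≈0 em))
        where open Analysis._≈_

    norm²-unimodular : {μ : Vector ℂ n} → Unimodular μ → norm² μ ℝ.≈ ℝ.fromℕ n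
    norm²-unimodular {μ} unimodular = ℝ.trans
      (ℝL.sum-cong-≋ {n} (λ j → ℝ.trans (ℝ.sym (∣z∣*∣z∣ (μ j))) (ℝ.trans (ℝ.*-cong (unimodular j) (unimodular j)) (ℝ.*-identityˡ ℝ.1#))))
      (ℝL.sum-replicate n)

    -- As θₖ is real, the exponent has real part zero, and its conjugate is its negative.
    ∣phase∣²≈1 : ∀ k → ∣ exp (𝕚 * ofReal τ * θ k) ∣² ℝ.≈ ℝ.1#
    ∣phase∣²≈1 k = ∣exp∣²≈1 {𝕚 * ofReal τ * θ k}
      ( ℝ.solve 2 (λ τ t → let 0′ = ℝ.con (+ 0) ; 1′ = ℝ.con (+ 1) ; r = (0′ ℝ.:* τ ℝ.:- 1′ ℝ.:* 0′) ℝ.:* t ℝ.:- (0′ ℝ.:* 0′ ℝ.:+ 1′ ℝ.:* τ) ℝ.:* 0′ in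
          r ℝ.:= ℝ.:- r) ℝ.refl τ (re (θ k))
      , ℝ.refl)

    ∣V·√n•Uᵤ∣² : ∀ k → ∣ V k ᵀ· (√n • Uᵤ) ∣² ℝ.≈ ℝ.fromℕ n ℝ.* ∣ V k ᵀ· 𝐞 u ∣²
    ∣V·√n•Uᵤ∣² k = begin
      ∣ V k ᵀ· (√n • Uᵤ) ∣²                              ≈⟨ ∣∣²-cong (dot-√n•Uᵤ {v = V k} (V-eigen k)) ⟨
      ∣ √n * exp (𝕚 * ofReal τ * θ k) * (V k ᵀ· 𝐞 u) ∣²                       ≈⟨ ∣∣²-* (√n * exp (𝕚 * ofReal τ * θ k)) (V k ᵀ· 𝐞 u) ⟩
      ∣ √n * exp (𝕚 * ofReal τ * θ k) ∣² ℝ.* ∣ V k ᵀ· 𝐞 u ∣²                  ≈⟨ ℝ.*-congʳ (ℝ.trans (∣∣²-* √n (exp (𝕚 * ofReal τ * θ k))) (ℝ.*-cong ∣√n∣²≈n (∣phase∣²≈1 k))) ⟩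
      ℝ.fromℕ n ℝ.* ℝ.1# ℝ.* ∣ V k ᵀ· 𝐞 u ∣²             ≈⟨ ℝ.*-congʳ (ℝ.*-identityʳ (ℝ.fromℕ n)) ⟩
      ℝ.fromℕ n ℝ.* ∣ V k ᵀ· 𝐞 u ∣²                      ∎
      where
      open import Relation.Binary.Reasoning.Setoid ℝ.setoid
      ∣√n∣²≈n : ∣ √n ∣² ℝ.≈ ℝ.fromℕ n
      ∣√n∣²≈n = ℝ.trans (ℝ.solve 1 (λ x → x ℝ.:* x ℝ.:+ ℝ.con (+ 0) ℝ.:* ℝ.con (+ 0) ℝ.:= x ℝ.:* x) ℝ.refl (√ℕ n)) (proj₂ √ℕn)

    norm²-𝐞 : norm² (𝐞 u) ℝ.≈ ℝ.1#
    norm²-𝐞 = re-≈ (begin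
      ofReal (norm² (𝐞 u))          ≈⟨ ⟨x,x⟩≈norm² (𝐞 u) ⟨
      ⟨ 𝐞 u , 𝐞 u ⟩                 ≈⟨ dot-𝐞 (λ j → conj (𝐞 u j)) u ⟩
      conj (𝐞 u u)                  ≈⟨ conj-cong (trans (sym (dot-δ u (𝐞 u))) (trans (dot-𝐞 (δ u) u) (δ-diagonal u))) ⟩
      conj 1ᶜ                       ≈⟨ conj-ofReal ℝ.1# ⟩
      1ᶜ                            ∎)
      where
      open import Relation.Binary.Reasoning.Setoid setoid
      open Analysis._≈_
      δ-diagonal : ∀ {n} (i : Fin n) → δ i i ≈ 1ᶜ
      δ-diagonal zero    = refl
      δ-diagonal (suc i) = δ-diagonal i

    -- Unitarity of U, seen in the eigenbasis: every coefficient of 𝐞ᵤ is multiplied by √n and by a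
    -- phase, and Parseval sums the squares.
    norm²-√n•Uᵤ : norm² (√n • Uᵤ) ℝ.≈ ℝ.fromℕ n
    norm²-√n•Uᵤ = begin
      norm² (√n • Uᵤ)                                    ≈⟨ norm²-parseval (√n • Uᵤ) ⟨
      ℝ.sum (λ k → ∣ V k ᵀ· (√n • Uᵤ) ∣²)                ≈⟨ ℝL.sum-cong-≋ ∣V·√n•Uᵤ∣² ⟩
      ℝ.sum (λ k → ℝ.fromℕ n ℝ.* ∣ V k ᵀ· 𝐞 u ∣²)        ≈⟨ ℝL.*-distribˡ-sum (ℝ.fromℕ n) (λ k → ∣ V k ᵀ· 𝐞 u ∣²) ⟨
      ℝ.fromℕ n ℝ.* ℝ.sum (λ k → ∣ V k ᵀ· 𝐞 u ∣²)        ≈⟨ ℝ.*-congˡ (ℝ.trans (norm²-parseval (𝐞 u)) norm²-𝐞) ⟩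
      ℝ.fromℕ n ℝ.* ℝ.1#                                 ≈⟨ ℝ.*-identityʳ (ℝ.fromℕ n) ⟩
      ℝ.fromℕ n                                          ∎
      where open import Relation.Binary.Reasoning.Setoid ℝ.setoid

    -- Off the support of 𝐞 u the condition does not constrain μ. Along the eigenbasis, however, the coefficients of
    -- y = √n U 𝐞 u vanish there and agree with those of μ elsewhere, hence ∥μ - y∥² + ∥y∥² = ∥μ∥², where ∥y∥² = n = ∥μ∥².
    eigenpairs⇒unimodular : ∀ μ → Unimodular μ → OnEigenpairs μ → √n • Uᵤ ≈ᵛ μ
    eigenpairs⇒unimodular μ unimodular onEigenpairs j = sym (minus≈0⇒≈ (norm²≈0⇒≈0 (μ -ᵛ y) ∥μ-y∥²≈0 j))
      where
      open import Relation.Binary.Reasoning.Setoid ℝ.setoid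
      y : Vector ℂ n
      y = √n • Uᵤ
      coefficient : ∀ k → Dec (θ k ∈ Φ M (𝐞 u)) →
        ∣ V k ᵀ· (μ -ᵛ y) ∣² ℝ.+ ∣ V k ᵀ· y ∣² ℝ.≈ ∣ V k ᵀ· μ ∣²
      coefficient k (yes θk∈Φ) = ℝ.trans (ℝ.+-cong (∣∣²-cong difference≈0) (∣∣²-cong (sym equal)))
        (ℝ.solve 1 (λ x → ℝ.con (+ 0) ℝ.:* ℝ.con (+ 0) ℝ.:+ ℝ.con (+ 0) ℝ.:* ℝ.con (+ 0) ℝ.:+ x ℝ.:= x) ℝ.refl ∣ V k ᵀ· μ ∣²)
        where
        equal : V k ᵀ· μ ≈ V k ᵀ· y
        equal = trans (sym (onEigenpairs (V k) (θ k) (V-eigenpair k) θk∈Φ)) (dot-√n•Uᵤ {v = V k} (V-eigen k))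
        difference≈0 : V k ᵀ· (μ -ᵛ y) ≈ 0ᶜ
        difference≈0 = trans (dot-minusʳ (V k) μ y) (≈⇒minus≈0 equal)
      coefficient k (no θk∉Φ) = ℝ.trans (ℝ.+-cong (∣∣²-cong difference≈μ) (∣∣²-cong Vy≈0))
        (ℝ.solve 1 (λ x → x ℝ.:+ (ℝ.con (+ 0) ℝ.:* ℝ.con (+ 0) ℝ.:+ ℝ.con (+ 0) ℝ.:* ℝ.con (+ 0)) ℝ.:= x) ℝ.refl ∣ V k ᵀ· μ ∣²)
        where
        -- θₖ belongs to the spectrum, so lying outside the support only says that the projection
        -- cannot be nonzero; excluded middle turns this into equality.
        projection≈0 : Dec (E M (θ k) *ᵥ 𝐞 u ≈ᵛ 0ᵛ) → E M (θ k) *ᵥ 𝐞 u ≈ᵛ 0ᵛ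
        projection≈0 (yes p) = p
        projection≈0 (no ¬p) = ⊥-elim (θk∉Φ ((V k , V-eigenpair k) , ¬p))
        V𝐞≈0 : V k ᵀ· 𝐞 u ≈ 0ᶜ
        V𝐞≈0 = trans (sym (dot-E {v = V k} (conj-ofReal _) (V-eigen k) (𝐞 u))) (dot-0ʳ (V k) (projection≈0 em))
        Vy≈0 : V k ᵀ· y ≈ 0ᶜ
        Vy≈0 = trans (sym (dot-√n•Uᵤ {v = V k} (V-eigen k))) (trans (*-congˡ V𝐞≈0) (zeroʳ (√n * exp (𝕚 * ofReal τ * θ k))))
        difference≈μ : V k ᵀ· (μ -ᵛ y) ≈ V k ᵀ· μ
        difference≈μ = trans (dot-minusʳ (V k) μ y) (trans (+-congˡ (-‿cong Vy≈0)) (solve 1 (λ x → x :- con (+ 0) := x) refl (V k ᵀ· μ)))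
      pythagoras : norm² (μ -ᵛ y) ℝ.+ norm² y ℝ.≈ norm² μ
      pythagoras = begin
        norm² (μ -ᵛ y) ℝ.+ norm² y                                   ≈⟨ ℝ.+-cong (norm²-parseval (μ -ᵛ y)) (norm²-parseval y) ⟨
        ℝ.sum (λ k → ∣ V k ᵀ· (μ -ᵛ y) ∣²) ℝ.+ ℝ.sum (λ k → ∣ V k ᵀ· y ∣²)
          ≈⟨ ℝL.∑-distrib-+ (λ k → ∣ V k ᵀ· (μ -ᵛ y) ∣²) (λ k → ∣ V k ᵀ· y ∣²) ⟨
        ℝ.sum (λ k → ∣ V k ᵀ· (μ -ᵛ y) ∣² ℝ.+ ∣ V k ᵀ· y ∣²)         ≈⟨ ℝL.sum-cong-≋ (λ k → coefficient k em) ⟩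
        ℝ.sum (λ k → ∣ V k ᵀ· μ ∣²)                                  ≈⟨ norm²-parseval μ ⟩
        norm² μ                                                      ∎
      ∥μ-y∥²≈0 : norm² (μ -ᵛ y) ℝ.≈ ℝ.0#
      ∥μ-y∥²≈0 = begin
        norm² (μ -ᵛ y)                                 ≈⟨ ℝ.solve 2 (λ d n → d ℝ.:= (d ℝ.:+ n) ℝ.:- n) ℝ.refl (norm² (μ -ᵛ y)) (ℝ.fromℕ n) ⟩
        norm² (μ -ᵛ y) ℝ.+ ℝ.fromℕ n ℝ.- ℝ.fromℕ n     ≈⟨ ℝ.+-congʳ (ℝ.trans (ℝ.+-congˡ (ℝ.sym norm²-√n•Uᵤ)) (ℝ.trans pythagoras (norm²-unimodular {μ} unimodular))) ⟩
        ℝ.fromℕ n ℝ.- ℝ.fromℕ n                        ≈⟨ ℝ.solve 1 (λ n → n ℝ.:- n ℝ.:= ℝ.con (+ 0)) ℝ.refl (ℝ.fromℕ n) ⟩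
        ℝ.0#                                           ∎

    unimodular⇔projections : (∃[ μ ] Unimodular μ × √n • Uᵤ ≈ᵛ μ) ⇔ (∃[ μ ] Unimodular μ × OnProjections μ)
    unimodular⇔projections = mk⇔
      (λ (μ , unimodular , eq) → μ , unimodular , eigenpairs⇒projections μ
        (λ v t (_ , v∈W) _ → trans (dot-√n•Uᵤ {v = v} v∈W) (dot-congʳ v eq)))
      (λ (μ , unimodular , onProjections) → μ , unimodular ,
        eigenpairs⇒unimodular μ unimodular (projections⇒eigenpairs μ onProjections))

    projections⇔eigenpairs : ∀ μ → OnProjections μ ⇔ OnEigenpairs μ
    projections⇔eigenpairs μ = mk⇔ (projections⇒eigenpairs μ) (eigenpairs⇒projections μ)

  -- Symmetry of the three graph matrices

  module _ {n : ℕ} (X : WeightedGraph n) where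

    open WeightedGraph X

    adjacency-sym : ℝL.Symmetricᵐ adjacency
    adjacency-sym i j with i ~? j | j ~? i
    ... | yes i~j | yes _   = weight-sym i~j
    ... | yes i~j | no ¬j~i = ⊥-elim (¬j~i (~-sym i~j))
    ... | no ¬i~j | yes j~i = ⊥-elim (¬i~j (~-sym j~i))
    ... | no _    | no _    = ℝ.refl

    degreeMatrix-sym : ℝL.Symmetricᵐ degreeMatrix
    degreeMatrix-sym i j with i ≟ j | j ≟ i
    ... | yes ≡.refl | yes _  = ℝ.refl
    ... | yes i≡j    | no j≢i = ⊥-elim (j≢i (≡.sym i≡j))
    ... | no i≢j     | yes j≡i = ⊥-elim (i≢j (≡.sym j≡i))
    ... | no _       | no _   = ℝ.refl

    realMatrix-sym : ∀ κ → ℝL.Symmetricᵐ (realMatrix κ X)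
    realMatrix-sym MatrixKind.A i j = adjacency-sym i j
    realMatrix-sym MatrixKind.L i j = ℝ.+-cong (degreeMatrix-sym i j) (ℝ.-‿cong (adjacency-sym i j))
    realMatrix-sym MatrixKind.Q i j = ℝ.+-cong (degreeMatrix-sym i j) (adjacency-sym i j)

corollary1 :
    (em : ExcludedMiddle 0ℓ) (R : CompleteOrderedField) →
    let open Analysis em R in
    (n : ℕ) (X : WeightedGraph n) (κ : MatrixKind) (u : Fin n) (τ : ℝ) → ℝ.0# ℝ.< τ →
    let M  = matrix κ X
        √n = ofReal (√ℕ n)
        OnProjections : Vector ℂ n → Set
        OnProjections μ = ∀ θ → θ ∈ Φ M (𝐞 u) →
          √n * exp (𝕚 * ofReal τ * θ) • E M θ *ᵥ 𝐞 u ≈ᵛ E M θ *ᵥ μ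
        OnEigenpairs : Vector ℂ n → Set
        OnEigenpairs μ = ∀ v θ → Eigenpair M v θ → θ ∈ Φ M (𝐞 u) →
          √n * exp (𝕚 * ofReal τ * θ) * (v ᵀ· 𝐞 u) ≈ v ᵀ· μ
        Condition₁ = LocalUniformMixing M u τ
        Condition₂ = ∃[ μ ] Unimodular μ × √n • U M τ *ᵥ 𝐞 u ≈ᵛ μ
        Condition₃ = ∃[ μ ] Unimodular μ × OnProjections μ
    in
    (Condition₁ ⇔ Condition₂) ×
    (Condition₂ ⇔ Condition₃) ×
    (∀ μ → Unimodular μ → OnProjections μ ⇔ OnEigenpairs μ)
corollary1 em R n X κ u τ _ =
    mixing⇔unimodular m-sym (Analysis.matrix em R κ X) (λ i j → C.refl) u τ
  , unimodular⇔projections m-sym (Analysis.matrix em R κ X) (λ i j → C.refl) u τ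
  , λ μ _ → projections⇔eigenpairs m-sym (Analysis.matrix em R κ X) (λ i j → C.refl) u τ μ
  where
  open Mixing em R
  module C = CommutativeRing (ComplexNumbers.ℂ-commutativeRing em R)
  m-sym = realMatrix-sym X κ
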